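{- Let $b\ge 2$ be an integer, $d\in\{0,1,\dots,b-1\}$, and $d'=b-1-d$. For $i\ge1$ put $\gamma'_i=\sum_{0\le a<b,\ a\ne d'}a^i$. Define $v_{0;m}$ for $m\ge0$ recursively by $$(b^{m+1}-b+1)\,v_{0;m}=b^{m+1}+\sum_{i=1}^{m}\binom{m}{i}\gamma'_i\,v_{0;m-i},$$ and for $j\ge1$, $m\ge0$, define $v_{j;m}$ recursively by $$(b^{m+1}-b+1)\,v_{j;m}=\sum_{i=1}^{m}\binom{m}{i}\gamma'_i\,v_{j;m-i}+\sum_{i=0}^{m}\binom{m}{i}(d')^i\,v_{j-1;m-i}$$ (with $0^0=1$). In particular $v_{j;0}=b$ for all $j\ge0$. Then for every $l\ge1$ and $k\ge0$, $$H^{(k)}=\sum_{\substack{0<n<b^{l-1}\\ k(n)=k}}\frac1n\;+\;b\sum_{\substack{b^{l-1}\le n<b^{l}\\ k(n)\le k}}\frac1{n+1}\;+\;\sum_{m=1}^{\infty}\ \sum_{\substack{b^{l-1}\le n<b^{l}\\ k(n)\le k}}\frac{v_{k-k(n);m}}{(n+1)^{m+1}}.$$ Moreover, the numbers $v_{j;m}$ ($j\ge0$, $m\ge1$) satisfy: (i) $0<v_{j;m}\le b$; (ii) for fixed $j$, $(v_{j;m})_{m\ge0}$ is strictly decreasing, except when $b=2$, $d=1$, $j=0$, in which case $v_{0;m}=2$ for all $m$; (iii) for each fixed $m\ge1$, $(v_{j;m})_{j\ge0}$ is strictly decreasing and converges to $b/(m+1)$.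
   Context: For an integer $n\ge0$, its (minimal) base-$b$ representation is the string of base-$b$ digits of $n$ without leading zeros (the empty string for $n=0$); $k(n)$ denotes the number of occurrences of the digit $d$ in this representation. For $k\ge0$, the Irwin sum is $H^{(k)}=\sum_{n\ge1,\ k(n)=k}1/n$ (a convergent series of positive terms; it equals $0$ when $b=2$, $d=1$, $k=0$). -}

module Defs where

open import Data.Digit using (Digit; Expansion; fromDigits; toDigits)
open import Data.Fin.Base using (toℕ; zero; suc)
import Data.Fin.Properties as Fin
open import Data.Integer.Base as ℤ using (+_)
import Data.Integer.Properties as ℤ
open import Data.List.Base using (List; []; _∷_; map; foldr; filter; length; upTo; applyUpTo)
open import Data.Nat.Base as ℕ using (ℕ; zero; suc; _∸_; _^_; _≤_; _<_; NonTrivial; nonTrivial⇒n>1; nonTrivial⇒nonZero)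
open import Data.Nat.Combinatorics using (_C_)
open import Data.Nat.ListAction using (sum)
import Data.Nat.Properties as ℕ
open import Data.Product.Base using (∃-syntax; _,_; proj₁; proj₂)
open import Data.Sum.Base using ([_,_]′)
open import Data.Rational.Base as ℚ using (ℚ; 0ℚ; 1ℚ; ½; _+_; _-_; _*_; _/_; ∣_∣)
import Data.Rational.Properties as ℚ
import Data.Rational.Unnormalised.Base as ℚᵘ
import Data.Rational.Unnormalised.Properties as ℚᵘ
open import Data.Rational.Solver using (module +-*-Solver)
open import Data.Bool.Base using (if_then_else_; true; false)
open import Relation.Binary.PropositionalEquality
open import Relation.Nullary using (does)
open import Relation.Nullary.Decidable using (¬?; dec-true; dec-false; fromWitness)

∑ : ∀ {a} {A : Set a} → List A → (A → ℚ) → ℚ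
∑ xs f = foldr _+_ 0ℚ (map f xs)

syntax ∑ xs (λ x → e) = ∑[ x ← xs ] e

infix 5 ∑

-- The integers lo ≤ n < hi, in increasing order.
[_,_⟩ : ℕ → ℕ → List ℕ
[ lo , hi ⟩ = applyUpTo (lo ℕ.+_) (hi ∸ lo)

ι : ℕ → ℚ
ι n = + n / 1

-- 1/n; the value at 0 is a dummy, every use below is at a positive argument.
recip : ℕ → ℚ
recip zero      = 0ℚ
recip n@(suc _) = + 1 / n

infix 4 _⟶_

_⟶_ : (ℕ → ℚ) → ℚ → Set
u ⟶ x = ∀ ε → 0ℚ ℚ.< ε → ∃[ N ] (∀ n → N ≤ n → ∣ u n - x ∣ ℚ.< ε)

Cauchy : (ℕ → ℚ) → Set
Cauchy u = ∀ ε → 0ℚ ℚ.< ε →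
  ∃[ N ] (∀ m n → N ≤ m → N ≤ n → ∣ u m - u n ∣ ℚ.< ε)

StrictlyDecreasing : (ℕ → ℚ) → Set
StrictlyDecreasing u = ∀ {m n} → m < n → u n ℚ.< u m

record ℝ : Set where
  constructor mkℝ
  field
    seq    : ℕ → ℚ
    cauchy : Cauchy seq

open ℝ

infix  4 _≃_
infixl 6 _+ℝ_

_≃_ : ℝ → ℝ → Set
x ≃ y = (λ n → seq x n - seq y n) ⟶ 0ℚ

fromℚ : ℚ → ℝ
fromℚ q = mkℝ (λ _ → q) λ ε 0<ε → 0 , λ _ _ _ _ →
  subst (ℚ._< ε) (sym (cong ∣_∣ (ℚ.+-inverseʳ q))) 0<ε

_+ℝ_ : ℝ → ℝ → ℝ
x +ℝ y = mkℝ (λ n → seq x n + seq y n) λ ε 0<ε →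
  let 0<½ε       = subst (ℚ._< ½ * ε) (ℚ.*-zeroʳ ½) (ℚ.*-monoʳ-<-pos ½ 0<ε)
      (M , M-ok) = cauchy x (½ * ε) 0<½ε
      (N , N-ok) = cauchy y (½ * ε) 0<½ε
  in M ℕ.⊔ N , λ m n p q →
    close ε (seq x m) (seq y m) (seq x n) (seq y n)
      (M-ok m n (ℕ.m⊔n≤o⇒m≤o M N p) (ℕ.m⊔n≤o⇒m≤o M N q))
      (N-ok m n (ℕ.m⊔n≤o⇒n≤o M N p) (ℕ.m⊔n≤o⇒n≤o M N q))
  where
  regroup : ∀ p q r s → (p + q) - (r + s) ≡ (p - r) + (q - s)
  regroup = solve 4 (λ p q r s →
    (p :+ q) :- (r :+ s) := (p :- r) :+ (q :- s)) refl
    where open +-*-Solver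

  halves : ∀ ε → ½ * ε + ½ * ε ≡ ε
  halves ε = trans (sym (ℚ.*-distribʳ-+ ε ½ ½)) (ℚ.*-identityˡ ε)

  close : ∀ ε p q r s → ∣ p - r ∣ ℚ.< ½ * ε → ∣ q - s ∣ ℚ.< ½ * ε →
          ∣ (p + q) - (r + s) ∣ ℚ.< ε
  close ε p q r s p≈r q≈s = begin-strict
    ∣ (p + q) - (r + s) ∣   ≡⟨ cong ∣_∣ (regroup p q r s) ⟩
    ∣ (p - r) + (q - s) ∣   ≤⟨ ℚ.∣p+q∣≤∣p∣+∣q∣ (p - r) (q - s) ⟩
    ∣ p - r ∣ + ∣ q - s ∣   <⟨ ℚ.+-mono-< p≈r q≈s ⟩
    ½ * ε + ½ * ε           ≡⟨ halves ε ⟩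
    ε                       ∎
    where open ℚ.≤-Reasoning

-- Convergence of the series f 1 + f 2 + f 3 + ⋯ in ℝ, and its sum.

partialSum : (ℕ → ℚ) → ℕ → ℚ
partialSum f N = ∑ [ 1 , suc N ⟩ f

Summable : (ℕ → ℚ) → Set
Summable f = Cauchy (partialSum f)

series : (f : ℕ → ℚ) → Summable f → ℝ
series f c = mkℝ (partialSum f) c

-- Expansions list the least significant digit first, so the leading
-- digits are at the end of the list.
stripLeadingZeros : ∀ {b} → Expansion b → Expansion b
stripLeadingZeros []       = []
stripLeadingZeros (a ∷ as) = cons a (stripLeadingZeros as)
  where
  cons : ∀ {b} → Digit b → Expansion b → Expansion b
  cons zero [] = []
  cons a    as = a ∷ as

-- The minimal representation.  Stripping matters only at n = 0, where
-- toDigits returns the single digit 0.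
digits : (b : ℕ) .{{_ : NonTrivial b}} → ℕ → Expansion b
digits b n = stripLeadingZeros (proj₁ (toDigits b {fromWitness (nonTrivial⇒n>1 b)} n))

fromDigits-strip : ∀ {b} (as : Expansion b) →
                   fromDigits (stripLeadingZeros as) ≡ fromDigits as
fromDigits-strip []       = refl
fromDigits-strip {b} (a ∷ as) with stripLeadingZeros as | fromDigits-strip as
fromDigits-strip {b} (zero  ∷ as) | []     | eq = cong (ℕ._* b) eq
fromDigits-strip {b} (suc a ∷ as) | []     | eq = cong (λ t → suc (toℕ a) ℕ.+ t ℕ.* b) eq
fromDigits-strip {b} (zero  ∷ as) | x ∷ xs | eq = cong (ℕ._* b) eq
fromDigits-strip {b} (suc a ∷ as) | x ∷ xs | eq = cong (λ t → suc (toℕ a) ℕ.+ t ℕ.* b) eq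

fromDigits-digits : ∀ b .{{_ : NonTrivial b}} n → fromDigits (digits b n) ≡ n
fromDigits-digits b n = trans (fromDigits-strip (proj₁ e)) (proj₂ e)
  where e = toDigits b {fromWitness (nonTrivial⇒n>1 b)} n

module Irwin (b : ℕ) .{{_ : NonTrivial b}} (d : Digit b) where

  -- The number k(n) of occurrences of d in the representation of n.
  #d : ℕ → ℕ
  #d n = length (filter (d Fin.≟_) (digits b n))

  irwinTerm : ℕ → ℕ → ℚ
  irwinTerm k n = if does (#d n ℕ.≟ k) then recip n else 0ℚ

  d′ : ℕ
  d′ = b ∸ 1 ∸ toℕ d

  γ′ : ℕ → ℕ
  γ′ i = sum (map (_^ i) (filter (λ a → ¬? (a ℕ.≟ d′)) (upTo b)))

  -- b^(m+1) − b + 1; the truncated subtraction is exact, as b ≤ b^(m+1).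
  den : ℕ → ℕ
  den m = suc (b ^ suc m ∸ b)

  γ′-sum : (ℕ → ℚ) → ℕ → ℚ
  γ′-sum u m = ∑[ i ← [ 1 , suc m ⟩ ] ι ((m C i) ℕ.* γ′ i) * u (m ∸ i)

  d′-sum : (ℕ → ℚ) → ℕ → ℚ
  d′-sum u m = ∑[ i ← [ 0 , suc m ⟩ ] ι ((m C i) ℕ.* d′ ^ i) * u (m ∸ i)

  -- solution c is the u : ℕ → ℚ with den m * u m = c m + γ′-sum u m for
  -- all m, by course-of-values recursion: table c m agrees with u below
  -- m and is junk from m on.
  table : (ℕ → ℚ) → ℕ → ℕ → ℚ
  table c zero    n = 0ℚ
  table c (suc m) n = if does (n ℕ.<? m)
    then table c m n
    else (c m + γ′-sum (table c m) m) * recip (den m)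

  solution : (ℕ → ℚ) → ℕ → ℚ
  solution c m = table c (suc m) m

  -- v j m is v_{j;m}; its defining recurrences are v-rec-zero and
  -- v-rec-suc below.
  v : ℕ → ℕ → ℚ
  v zero    = solution λ m → ι (b ^ suc m)
  v (suc j) = solution (d′-sum (v j))

  private

    if-true : ∀ {t} {x y : ℚ} → t ≡ true → (if t then x else y) ≡ x
    if-true refl = refl

    if-false : ∀ {t} {x y : ℚ} → t ≡ false → (if t then x else y) ≡ y
    if-false refl = refl

    table-suc : ∀ c {m n} → n < m → table c (suc m) n ≡ table c m n
    table-suc c {m} {n} n<m = if-true (dec-true (n ℕ.<? m) n<m)

    table-last : ∀ c m →
      table c (suc m) m ≡ (c m + γ′-sum (table c m) m) * recip (den m)
    table-last c m = if-false (dec-false (m ℕ.<? m) (ℕ.<-irrefl refl))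

    table-solution : ∀ c {m n} → n < m → table c m n ≡ solution c n
    table-solution c {suc m} {n} n<1+m =
      [ (λ n<m → trans (table-suc c n<m) (table-solution c n<m))
      , (λ n≡m → cong (λ t → table c (suc t) n) (sym n≡m))
      ]′ (ℕ.m≤n⇒m<n∨m≡n (ℕ.≤-pred n<1+m))

    ∑-applyUpTo-cong : ∀ g k (f f′ : ℕ → ℚ) → (∀ i → i < k → f (g i) ≡ f′ (g i)) →
                       ∑ (applyUpTo g k) f ≡ ∑ (applyUpTo g k) f′
    ∑-applyUpTo-cong g zero    f f′ eq = refl
    ∑-applyUpTo-cong g (suc k) f f′ eq = cong₂ _+_ (eq 0 ℕ.z<s)
      (∑-applyUpTo-cong (λ i → g (suc i)) k f f′ (λ i i<k → eq (suc i) (ℕ.s<s i<k)))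

    recip-inverse : ∀ n → recip (suc n) * ι (suc n) ≡ 1ℚ
    recip-inverse n = ℚ.toℚᵘ-injective (begin
      ℚ.toℚᵘ (recip (suc n) * ι (suc n))
        ≈⟨ ℚ.toℚᵘ-homo-* (recip (suc n)) (ι (suc n)) ⟩
      ℚ.toℚᵘ (recip (suc n)) ℚᵘ.* ℚ.toℚᵘ (ι (suc n))
        ≈⟨ ℚᵘ.*-cong (ℚ.toℚᵘ-fromℚᵘ (ℚᵘ.mkℚᵘ (+ 1) n)) (ℚ.toℚᵘ-fromℚᵘ (ℚᵘ.mkℚᵘ (+ suc n) 0)) ⟩
      ℚᵘ.mkℚᵘ (+ 1) n ℚᵘ.* ℚᵘ.mkℚᵘ (+ suc n) 0
        ≈⟨ ℚᵘ.*-inverseˡ (ℚᵘ.mkℚᵘ (+ suc n) 0) ⟩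
      ℚᵘ.1ℚᵘ ∎)
      where open ℚᵘ.≃-Reasoning

    ι-+ : ∀ m n → ι (m ℕ.+ n) ≡ ι m + ι n
    ι-+ m n = ℚ.toℚᵘ-injective (begin
      ℚ.toℚᵘ (ι (m ℕ.+ n))
        ≈⟨ ℚ.toℚᵘ-fromℚᵘ (ℚᵘ.mkℚᵘ (+ (m ℕ.+ n)) 0) ⟩
      ℚᵘ.mkℚᵘ (+ (m ℕ.+ n)) 0
        ≈⟨ ℚᵘ.*≡* (cong (λ t → t ℤ.* + 1) (sym (cong₂ ℤ._+_ (ℤ.*-identityʳ (+ m)) (ℤ.*-identityʳ (+ n))))) ⟩
      ℚᵘ.mkℚᵘ (+ m) 0 ℚᵘ.+ ℚᵘ.mkℚᵘ (+ n) 0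
        ≈⟨ ℚᵘ.+-cong (ℚ.toℚᵘ-fromℚᵘ (ℚᵘ.mkℚᵘ (+ m) 0)) (ℚ.toℚᵘ-fromℚᵘ (ℚᵘ.mkℚᵘ (+ n) 0)) ⟨
      ℚ.toℚᵘ (ι m) ℚᵘ.+ ℚ.toℚᵘ (ι n)
        ≈⟨ ℚ.toℚᵘ-homo-+ (ι m) (ι n) ⟨
      ℚ.toℚᵘ (ι m + ι n) ∎)
      where open ℚᵘ.≃-Reasoning

    ι-den : ∀ m → ι (b ^ suc m) - ι b + 1ℚ ≡ ι (den m)
    ι-den m = begin
      ι (b ^ suc m) - ι b + 1ℚ               ≡⟨ cong (λ t → ι t - ι b + 1ℚ) (ℕ.m∸n+n≡m b≤b^1+m) ⟨
      ι (b ^ suc m ∸ b ℕ.+ b) - ι b + 1ℚ     ≡⟨ cong (λ t → t - ι b + 1ℚ) (ι-+ (b ^ suc m ∸ b) b) ⟩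
      ι (b ^ suc m ∸ b) + ι b - ι b + 1ℚ     ≡⟨ cancel (ι (b ^ suc m ∸ b)) (ι b) 1ℚ ⟩
      1ℚ + ι (b ^ suc m ∸ b)                 ≡⟨ ι-+ 1 (b ^ suc m ∸ b) ⟨
      ι (den m)                              ∎
      where
      open ≡-Reasoning
      b≤b^1+m : b ≤ b ^ suc m
      b≤b^1+m = subst (_≤ b ^ suc m) (ℕ.^-identityʳ b)
        (ℕ.^-monoʳ-≤ b {{nonTrivial⇒nonZero b}} (ℕ.s≤s {0} {m} ℕ.z≤n))
      cancel : ∀ x y z → x + y - y + z ≡ z + x
      cancel = solve 3 (λ x y z → x :+ y :- y :+ z := z :+ x) refl
        where open +-*-Solver

    mul-recip : ∀ x n → ι (suc n) * (x * recip (suc n)) ≡ x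
    mul-recip x n = begin
      ι (suc n) * (x * recip (suc n))   ≡⟨ ℚ.*-comm (ι (suc n)) _ ⟩
      x * recip (suc n) * ι (suc n)     ≡⟨ ℚ.*-assoc x (recip (suc n)) (ι (suc n)) ⟩
      x * (recip (suc n) * ι (suc n))   ≡⟨ cong (x *_) (recip-inverse n) ⟩
      x * 1ℚ                            ≡⟨ ℚ.*-identityʳ x ⟩
      x                                 ∎
      where open ≡-Reasoning

    solution-rec : ∀ c m →
      (ι (b ^ suc m) - ι b + 1ℚ) * solution c m ≡ c m + γ′-sum (solution c) m
    solution-rec c m = begin
      (ι (b ^ suc m) - ι b + 1ℚ) * solution c m
        ≡⟨ cong₂ _*_ (ι-den m) (table-last c m) ⟩
      ι (den m) * ((c m + γ′-sum (table c m) m) * recip (den m))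
        ≡⟨ mul-recip (c m + γ′-sum (table c m) m) (b ^ suc m ∸ b) ⟩
      c m + γ′-sum (table c m) m
        ≡⟨ cong (λ t → c m + t) (∑-applyUpTo-cong suc m
             (λ i → ι ((m C i) ℕ.* γ′ i) * table c m (m ∸ i))
             (λ i → ι ((m C i) ℕ.* γ′ i) * solution c (m ∸ i))
             λ i i<m → cong (ι ((m C suc i) ℕ.* γ′ (suc i)) *_)
               (table-solution c (ℕ.∸-monoʳ-< {m} {suc i} {0} ℕ.z<s i<m))) ⟩
      c m + γ′-sum (solution c) m ∎
      where open ≡-Reasoning

  v-rec-zero : ∀ m →
    (ι (b ^ suc m) - ι b + 1ℚ) * v 0 m ≡
    ι (b ^ suc m) + (∑[ i ← [ 1 , suc m ⟩ ] ι ((m C i) ℕ.* γ′ i) * v 0 (m ∸ i))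
  v-rec-zero = solution-rec (λ m → ι (b ^ suc m))

  v-rec-suc : ∀ j m →
    (ι (b ^ suc m) - ι b + 1ℚ) * v (suc j) m ≡
    (∑[ i ← [ 1 , suc m ⟩ ] ι ((m C i) ℕ.* γ′ i) * v (suc j) (m ∸ i)) +
    (∑[ i ← [ 0 , suc m ⟩ ] ι ((m C i) ℕ.* d′ ^ i) * v j (m ∸ i))
  v-rec-suc j m = trans (solution-rec (d′-sum (v j)) m)
    (ℚ.+-comm (d′-sum (v j) m) (γ′-sum (v (suc j)) m))

{-# OPTIONS --safe #-}
module Submission where

-- Let μⱼ be the measure with mass b^-|w| at 1 − 0.w for every digit string w
-- containing d exactly j times.  Splitting off the first digit of w shows that
-- the moments of μⱼ satisfy the recurrences of v j, and that
-- Σ 1/n, over the n with k(n) = k whose representation starts with that of p,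
-- is ∫ dμⱼ(y)/(p + 1 − y) for j = k − k(p); the theorem is the expansion of
-- that kernel in powers of y.  To stay with finite sums, μⱼ is truncated to
-- strings of fewer than R digits, and v j minus the truncated moments, which
-- satisfies a contracting recurrence in R, is bounded by b 2ʲ (1 − 1/2b)^R.
-- The bounds and monotonicity of v come from a comparison principle for the
-- recurrences; the limit in j is the moment sequence of b times Lebesgue
-- measure, and the error decays like b 2^-j.

-- At y = 1 - 0.w one has p + 1 - y = p + 0.w, and b^|w| (p + 0.w) is the integer n whose
-- representation is that of p followed by w; so the mass b^-|w| at y contributes exactly 1/n. In
-- powers of 0.w the expansion of 1/(p + 0.w) would alternate in sign. In powers of 1 - 0.w every
-- moment and every term is nonnegative, so finite sums can be bounded from one side at a time. The
-- price is the exchange of each digit a with b - 1 - a, which is how d′ enters.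
--
-- Convergence of neither series is known beforehand. The partial sums of both sides are squeezed
-- against the integrals over truncated measures. One error depends only on the number of terms of
-- the power expansion, the other only on the truncation R. A single estimate with two independent
-- indices therefore yields the Cauchy property of both series and the equality of their sums.

open import Defs
open import Data.Bool.Base using (if_then_else_; true; false)
open import Data.Digit using (Digit; Expansion; fromDigits; toDigits)
open import Data.Fin.Base as Fin using (toℕ)
import Data.Fin.Properties as Fin
open import Data.Integer.Base as ℤ using (+_)
import Data.Integer.Properties as ℤ
open import Data.List.Base using (List; []; _∷_; _++_; foldr; map; filter; length; upTo; applyUpTo)
import Data.List.Properties as List
open import Data.List.Membership.Propositional using (_∈_)
open import Data.List.Membership.Propositional.Properties using (∈-applyUpTo⁻; ∈-upTo⁻; ∈-upTo⁺; ∈-filter⁺; ∈-filter⁻)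
open import Data.List.Relation.Unary.Any using (here; there)
open import Data.Nat.Base as ℕ using (ℕ; zero; suc; _∸_; _^_; _≤_; _<_; NonTrivial; z≤n; s≤s)
open import Data.Nat.Combinatorics using (_C_; nCk+nC[k+1]≡[n+1]C[k+1]; k>n⇒nCk≡0)
import Data.Nat.DivMod as ℕ
open import Data.Nat.Induction using (<-rec)
open import Data.Nat.ListAction using (sum)
open import Data.Nat.Properties as ℕ using (_≟_; _≤?_)
open import Data.Product.Base using (_×_; ∃-syntax; _,_; proj₁; proj₂)
open import Data.Rational.Base as ℚ using (ℚ; 0ℚ; 1ℚ; ½; _+_; _-_; -_; _*_; _/_; ∣_∣)
import Data.Rational.Properties as ℚ
open import Data.Rational.Solver using (module +-*-Solver)
import Data.Rational.Unnormalised.Base as ℚᵘ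
import Data.Rational.Unnormalised.Properties as ℚᵘ
open import Data.Sum.Base using (inj₁; inj₂)
open import Function.Base using (_∘_; id)
open import Relation.Binary.PropositionalEquality
open import Relation.Nullary using (¬_; Dec; does; yes; no; contradiction)
open import Relation.Nullary.Decidable using (¬?; fromWitness)
open import Relation.Unary using (Decidable)
open import Algebra.Definitions.RawSemiring ℚ.+-*-rawSemiring using () renaming (_^_ to _^ℚ_)

open +-*-Solver using (solve; _:+_; _:*_; _:-_; :-_; _:=_; con)

-- Ordered-field arithmetic

p≤q⇒0≤q-p : ∀ {p q} → p ℚ.≤ q → 0ℚ ℚ.≤ q - p
p≤q⇒0≤q-p {p} {q} p≤q = subst (ℚ._≤ q - p) (ℚ.+-inverseʳ p) (ℚ.+-monoˡ-≤ (- p) p≤q)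

p<q⇒0<q-p : ∀ {p q} → p ℚ.< q → 0ℚ ℚ.< q - p
p<q⇒0<q-p {p} {q} p<q = subst (ℚ._< q - p) (ℚ.+-inverseʳ p) (ℚ.+-monoˡ-< (- p) p<q)

[q-p]+p≡q : ∀ p q → q - p + p ≡ q
[q-p]+p≡q = solve 2 (λ p q → q :- p :+ p := q) refl

0≤q-p⇒p≤q : ∀ {p q} → 0ℚ ℚ.≤ q - p → p ℚ.≤ q
0≤q-p⇒p≤q {p} {q} h = subst₂ ℚ._≤_ (ℚ.+-identityˡ p) ([q-p]+p≡q p q) (ℚ.+-monoˡ-≤ p h)

0<q-p⇒p<q : ∀ {p q} → 0ℚ ℚ.< q - p → p ℚ.< q
0<q-p⇒p<q {p} {q} h = subst₂ ℚ._<_ (ℚ.+-identityˡ p) ([q-p]+p≡q p q) (ℚ.+-monoˡ-< p h)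

+-nonNeg : ∀ {p q} → 0ℚ ℚ.≤ p → 0ℚ ℚ.≤ q → 0ℚ ℚ.≤ p + q
+-nonNeg = ℚ.+-mono-≤

*-monoʳ-≤ : ∀ {c p q} → 0ℚ ℚ.≤ c → p ℚ.≤ q → c * p ℚ.≤ c * q
*-monoʳ-≤ {c} 0≤c = ℚ.*-monoˡ-≤-nonNeg c {{ℚ.nonNegative 0≤c}}

*-monoʳ-< : ∀ {c p q} → 0ℚ ℚ.< c → p ℚ.< q → c * p ℚ.< c * q
*-monoʳ-< {c} 0<c = ℚ.*-monoʳ-<-pos c {{ℚ.positive 0<c}}

*-cancelˡ-≤ : ∀ {c p q} → 0ℚ ℚ.< c → c * p ℚ.≤ c * q → p ℚ.≤ q
*-cancelˡ-≤ {c} 0<c = ℚ.*-cancelˡ-≤-pos c {{ℚ.positive 0<c}}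

*-cancelˡ-< : ∀ {c p q} → 0ℚ ℚ.< c → c * p ℚ.< c * q → p ℚ.< q
*-cancelˡ-< {c} 0<c = ℚ.*-cancelˡ-<-nonNeg c {{ℚ.nonNegative (ℚ.<⇒≤ 0<c)}}

*-nonNeg : ∀ {p q} → 0ℚ ℚ.≤ p → 0ℚ ℚ.≤ q → 0ℚ ℚ.≤ p * q
*-nonNeg {p} {q} 0≤p 0≤q = subst (ℚ._≤ p * q) (ℚ.*-zeroʳ p) (*-monoʳ-≤ 0≤p 0≤q)

*-pos : ∀ {p q} → 0ℚ ℚ.< p → 0ℚ ℚ.< q → 0ℚ ℚ.< p * q
*-pos {p} {q} 0<p 0<q = subst (ℚ._< p * q) (ℚ.*-zeroʳ p) (*-monoʳ-< 0<p 0<q)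

*-mono-≤ : ∀ {p q r s} → 0ℚ ℚ.≤ p → 0ℚ ℚ.≤ s → p ℚ.≤ q → r ℚ.≤ s → p * r ℚ.≤ q * s
*-mono-≤ {p} {q} {r} {s} 0≤p 0≤s p≤q r≤s = ℚ.≤-trans (*-monoʳ-≤ 0≤p r≤s)
  (subst₂ ℚ._≤_ (ℚ.*-comm s p) (ℚ.*-comm s q) (*-monoʳ-≤ 0≤s p≤q))

*-cancelˡ-≡ : ∀ {c p q} → 0ℚ ℚ.< c → c * p ≡ c * q → p ≡ q
*-cancelˡ-≡ 0<c eq = ℚ.≤-antisym (*-cancelˡ-≤ 0<c (ℚ.≤-reflexive eq))
                                 (*-cancelˡ-≤ 0<c (ℚ.≤-reflexive (sym eq)))

0<1 : 0ℚ ℚ.< 1ℚ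
0<1 = ℚ.positive⁻¹ 1ℚ

x*[y*z]≡y*[x*z] : ∀ x y z → x * (y * z) ≡ y * (x * z)
x*[y*z]≡y*[x*z] = solve 3 (λ x y z → x :* (y :* z) := y :* (x :* z)) refl

½<1 : ½ ℚ.< 1ℚ
½<1 = ℚ.*<* (ℤ.+<+ (s≤s (s≤s z≤n)))

∣p-q∣< : ∀ {p q ε} → p ℚ.< q + ε → q ℚ.< p + ε → ∣ p - q ∣ ℚ.< ε
∣p-q∣< {p} {q} {ε} p<q+ε q<p+ε with ∣ p - q ∣ | ℚ.∣p∣≡p∨∣p∣≡-p (p - q)
... | _ | inj₁ refl = subst₂ ℚ._<_ refl (cancel q ε) (ℚ.+-monoˡ-< (- q) p<q+ε)
  where
  cancel : ∀ q ε → q + ε - q ≡ ε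
  cancel = solve 2 (λ q ε → q :+ ε :- q := ε) refl
... | _ | inj₂ refl = subst₂ ℚ._<_ (negate p q) (cancel p ε) (ℚ.+-monoˡ-< (- p) q<p+ε)
  where
  negate : ∀ p q → q - p ≡ - (p - q)
  negate = solve 2 (λ p q → q :- p := :- (p :- q)) refl
  cancel : ∀ p ε → p + ε - p ≡ ε
  cancel = solve 2 (λ p ε → p :+ ε :- p := ε) refl

^ℚ-nonNeg : ∀ {q} → 0ℚ ℚ.≤ q → ∀ n → 0ℚ ℚ.≤ q ^ℚ n
^ℚ-nonNeg 0≤q zero    = ℚ.<⇒≤ 0<1
^ℚ-nonNeg 0≤q (suc n) = *-nonNeg 0≤q (^ℚ-nonNeg 0≤q n)

-- The embedding of ℕ

private

  toℚᵘ-ι : ∀ n → ℚ.toℚᵘ (ι n) ℚᵘ.≃ ℚᵘ.mkℚᵘ (+ n) 0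
  toℚᵘ-ι n = ℚ.toℚᵘ-fromℚᵘ (ℚᵘ.mkℚᵘ (+ n) 0)

ι-+ : ∀ m n → ι (m ℕ.+ n) ≡ ι m + ι n
ι-+ m n = ℚ.toℚᵘ-injective (begin
  ℚ.toℚᵘ (ι (m ℕ.+ n))
    ≈⟨ toℚᵘ-ι (m ℕ.+ n) ⟩
  ℚᵘ.mkℚᵘ (+ (m ℕ.+ n)) 0
    ≈⟨ ℚᵘ.*≡* (cong (ℤ._* + 1) (sym (cong₂ ℤ._+_ (ℤ.*-identityʳ (+ m)) (ℤ.*-identityʳ (+ n))))) ⟩
  ℚᵘ.mkℚᵘ (+ m) 0 ℚᵘ.+ ℚᵘ.mkℚᵘ (+ n) 0
    ≈⟨ ℚᵘ.+-cong (toℚᵘ-ι m) (toℚᵘ-ι n) ⟨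
  ℚ.toℚᵘ (ι m) ℚᵘ.+ ℚ.toℚᵘ (ι n)
    ≈⟨ ℚ.toℚᵘ-homo-+ (ι m) (ι n) ⟨
  ℚ.toℚᵘ (ι m + ι n) ∎)
  where open ℚᵘ.≃-Reasoning

ι-suc : ∀ n → ι (suc n) ≡ 1ℚ + ι n
ι-suc = ι-+ 1

ι-* : ∀ m n → ι (m ℕ.* n) ≡ ι m * ι n
ι-* zero    n = sym (ℚ.*-zeroˡ (ι n))
ι-* (suc m) n = begin
  ι (n ℕ.+ m ℕ.* n)     ≡⟨ ι-+ n (m ℕ.* n) ⟩
  ι n + ι (m ℕ.* n)     ≡⟨ cong (_+_ (ι n)) (ι-* m n) ⟩
  ι n + ι m * ι n       ≡⟨ factor (ι m) (ι n) ⟩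
  (1ℚ + ι m) * ι n      ≡⟨ cong (_* ι n) (ι-suc m) ⟨
  ι (suc m) * ι n       ∎
  where
  open ≡-Reasoning
  factor : ∀ x y → y + x * y ≡ (1ℚ + x) * y
  factor = solve 2 (λ x y → y :+ x :* y := (con 1ℚ :+ x) :* y) refl

ι-nonNeg : ∀ n → 0ℚ ℚ.≤ ι n
ι-nonNeg n = ℚ.nonNegative⁻¹ (ι n) {{ℚ.normalize-nonNeg n 1}}

ι-pos : ∀ {n} → 0 < n → 0ℚ ℚ.< ι n
ι-pos {n@(suc _)} _ = ℚ.positive⁻¹ (ι n) {{ℚ.normalize-pos n 1}}

ι-mono-≤ : ∀ {m n} → m ≤ n → ι m ℚ.≤ ι n
ι-mono-≤ {m} {n} m≤n = begin
  ι m                  ≡⟨ ℚ.+-identityʳ (ι m) ⟨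
  ι m + 0ℚ             ≤⟨ ℚ.+-monoʳ-≤ (ι m) (ι-nonNeg (n ∸ m)) ⟩
  ι m + ι (n ∸ m)      ≡⟨ ι-+ m (n ∸ m) ⟨
  ι (m ℕ.+ (n ∸ m))    ≡⟨ cong ι (ℕ.m+[n∸m]≡n m≤n) ⟩
  ι n                  ∎
  where open ℚ.≤-Reasoning

ι-mono-< : ∀ {m n} → m < n → ι m ℚ.< ι n
ι-mono-< {m} {n} m<n = ℚ.<-≤-trans
  (subst₂ ℚ._<_ (ℚ.+-identityˡ (ι m)) (sym (ι-suc m)) (ℚ.+-monoˡ-< (ι m) 0<1))
  (ι-mono-≤ m<n)

recip-pos : ∀ n → 0ℚ ℚ.< recip (suc n)
recip-pos n = ℚ.positive⁻¹ (recip (suc n)) {{ℚ.normalize-pos 1 (suc n)}}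

recip-nonNeg : ∀ n → 0ℚ ℚ.≤ recip n
recip-nonNeg zero    = ℚ.≤-refl
recip-nonNeg (suc n) = ℚ.<⇒≤ (recip-pos n)

/-≡-*recip : ∀ n m → + n / suc m ≡ ι n * recip (suc m)
/-≡-*recip n m = ℚ.toℚᵘ-injective (begin
  ℚ.toℚᵘ (+ n / suc m)
    ≈⟨ ℚ.toℚᵘ-fromℚᵘ (ℚᵘ.mkℚᵘ (+ n) m) ⟩
  ℚᵘ.mkℚᵘ (+ n) m
    ≈⟨ ℚᵘ.*≡* (cong₂ ℤ._*_ (sym (ℤ.*-identityʳ (+ n))) (cong +_ (ℕ.+-identityʳ (suc m)))) ⟩
  ℚᵘ.mkℚᵘ (+ n) 0 ℚᵘ.* ℚᵘ.mkℚᵘ (+ 1) m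
    ≈⟨ ℚᵘ.*-cong (toℚᵘ-ι n) (ℚ.toℚᵘ-fromℚᵘ (ℚᵘ.mkℚᵘ (+ 1) m)) ⟨
  ℚ.toℚᵘ (ι n) ℚᵘ.* ℚ.toℚᵘ (recip (suc m))
    ≈⟨ ℚ.toℚᵘ-homo-* (ι n) (recip (suc m)) ⟨
  ℚ.toℚᵘ (ι n * recip (suc m)) ∎)
  where open ℚᵘ.≃-Reasoning

*-recip : ∀ {n} → 0 < n → ι n * recip n ≡ 1ℚ
*-recip {suc n} _ = trans (sym (/-≡-*recip (suc n) n)) (ℚ.toℚᵘ-injective
  (ℚᵘ.≃-trans (ℚ.toℚᵘ-fromℚᵘ (ℚᵘ.mkℚᵘ (+ suc n) n))
    (ℚᵘ.*≡* (trans (ℤ.*-identityʳ (+ suc n)) (sym (ℤ.*-identityˡ (+ suc n)))))))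

-- Finite sums

module _ {a} {A : Set a} where

  ∑-cong : ∀ (xs : List A) {f g : A → ℚ} → (∀ {x} → x ∈ xs → f x ≡ g x) → ∑ xs f ≡ ∑ xs g
  ∑-cong []       eq = refl
  ∑-cong (x ∷ xs) eq = cong₂ _+_ (eq (here refl)) (∑-cong xs (eq ∘ there))

  ∑-mono-≤ : ∀ (xs : List A) {f g : A → ℚ} → (∀ {x} → x ∈ xs → f x ℚ.≤ g x) → ∑ xs f ℚ.≤ ∑ xs g
  ∑-mono-≤ []       le = ℚ.≤-refl
  ∑-mono-≤ (x ∷ xs) le = ℚ.+-mono-≤ (le (here refl)) (∑-mono-≤ xs (le ∘ there))

  ∑-zero : ∀ (xs : List A) → ∑ xs (λ _ → 0ℚ) ≡ 0ℚ
  ∑-zero []       = refl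
  ∑-zero (x ∷ xs) = trans (ℚ.+-identityˡ _) (∑-zero xs)

  ∑-nonNeg : ∀ (xs : List A) {f : A → ℚ} → (∀ {x} → x ∈ xs → 0ℚ ℚ.≤ f x) → 0ℚ ℚ.≤ ∑ xs f
  ∑-nonNeg xs {f} 0≤f = subst (ℚ._≤ ∑ xs f) (∑-zero xs) (∑-mono-≤ xs 0≤f)

  ∑-pos : ∀ {xs : List A} {x} {f : A → ℚ} → (∀ {y} → y ∈ xs → 0ℚ ℚ.≤ f y) →
          x ∈ xs → 0ℚ ℚ.< f x → 0ℚ ℚ.< ∑ xs f
  ∑-pos {_ ∷ xs} 0≤f (here refl)  0<fx = ℚ.+-mono-<-≤ 0<fx (∑-nonNeg xs (0≤f ∘ there))
  ∑-pos {_ ∷ xs} 0≤f (there x∈xs) 0<fx = ℚ.+-mono-≤-< (0≤f (here refl)) (∑-pos (0≤f ∘ there) x∈xs 0<fx)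

  ∑-distrib-+ : ∀ (xs : List A) (f g : A → ℚ) → ∑ xs (λ x → f x + g x) ≡ ∑ xs f + ∑ xs g
  ∑-distrib-+ []       f g = refl
  ∑-distrib-+ (x ∷ xs) f g =
    trans (cong (_+_ (f x + g x)) (∑-distrib-+ xs f g)) (regroup (f x) (g x) (∑ xs f) (∑ xs g))
    where
    regroup : ∀ p q r s → (p + q) + (r + s) ≡ (p + r) + (q + s)
    regroup = solve 4 (λ p q r s → (p :+ q) :+ (r :+ s) := (p :+ r) :+ (q :+ s)) refl

  ∑-*ˡ : ∀ (xs : List A) c (f : A → ℚ) → ∑ xs (λ x → c * f x) ≡ c * ∑ xs f
  ∑-*ˡ []       c f = sym (ℚ.*-zeroʳ c)
  ∑-*ˡ (x ∷ xs) c f = trans (cong (_+_ (c * f x)) (∑-*ˡ xs c f)) (sym (ℚ.*-distribˡ-+ c (f x) (∑ xs f)))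

  ∑-*ʳ : ∀ (xs : List A) (f : A → ℚ) c → ∑ xs (λ x → f x * c) ≡ ∑ xs f * c
  ∑-*ʳ xs f c = trans (∑-cong xs λ {x} _ → ℚ.*-comm (f x) c) (trans (∑-*ˡ xs c f) (ℚ.*-comm c (∑ xs f)))

  ∑-distrib-- : ∀ (xs : List A) (f g : A → ℚ) → ∑ xs (λ x → f x - g x) ≡ ∑ xs f - ∑ xs g
  ∑-distrib-- []       f g = refl
  ∑-distrib-- (x ∷ xs) f g =
    trans (cong (_+_ (f x - g x)) (∑-distrib-- xs f g)) (regroup (f x) (g x) (∑ xs f) (∑ xs g))
    where
    regroup : ∀ p q r s → (p - q) + (r - s) ≡ (p + r) - (q + s)
    regroup = solve 4 (λ p q r s → (p :- q) :+ (r :- s) := (p :+ r) :- (q :+ s)) refl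

  ∑-++ : ∀ (xs ys : List A) (f : A → ℚ) → ∑ (xs ++ ys) f ≡ ∑ xs f + ∑ ys f
  ∑-++ []       ys f = sym (ℚ.+-identityˡ _)
  ∑-++ (x ∷ xs) ys f = trans (cong (_+_ (f x)) (∑-++ xs ys f)) (sym (ℚ.+-assoc (f x) (∑ xs f) (∑ ys f)))

  ∑-filter : ∀ {p} {P : A → Set p} (P? : Decidable P) (xs : List A) (f : A → ℚ) →
             ∑ (filter P? xs) f ≡ ∑ xs (λ x → if does (P? x) then f x else 0ℚ)
  ∑-filter P? []       f = refl
  ∑-filter P? (x ∷ xs) f with does (P? x)
  ... | true  = cong (_+_ (f x)) (∑-filter P? xs f)
  ... | false = trans (∑-filter P? xs f) (sym (ℚ.+-identityˡ _))

∑-const : ∀ {a} {A : Set a} (xs : List A) x → ∑ xs (λ _ → x) ≡ ι (length xs) * x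
∑-const []       x = sym (ℚ.*-zeroˡ x)
∑-const (_ ∷ xs) x = begin
  x + ∑ xs (λ _ → x)            ≡⟨ cong (_+_ x) (∑-const xs x) ⟩
  x + ι (length xs) * x         ≡⟨ solve 2 (λ n x → x :+ n :* x := (con 1ℚ :+ n) :* x) refl (ι (length xs)) x ⟩
  (1ℚ + ι (length xs)) * x      ≡⟨ cong (_* x) (ι-suc (length xs)) ⟨
  ι (suc (length xs)) * x       ∎
  where open ≡-Reasoning

∑-comm : ∀ {a b} {A : Set a} {B : Set b} (xs : List A) (ys : List B) (f : A → B → ℚ) →
         (∑[ x ← xs ] ∑[ y ← ys ] f x y) ≡ (∑[ y ← ys ] ∑[ x ← xs ] f x y)
∑-comm []       ys f = sym (∑-zero ys)
∑-comm (x ∷ xs) ys f = trans (cong (_+_ (∑ ys (f x))) (∑-comm xs ys f))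
  (sym (∑-distrib-+ ys (f x) (λ y → ∑[ x ← xs ] f x y)))

∑-applyUpTo : ∀ (g : ℕ → ℕ) n (f : ℕ → ℚ) → ∑ (applyUpTo g n) f ≡ ∑ (upTo n) (f ∘ g)
∑-applyUpTo g n f = cong (foldr _+_ 0ℚ)
  (trans (List.map-applyUpTo g f n) (sym (List.map-applyUpTo id (f ∘ g) n)))

∑-upTo-first : ∀ n (f : ℕ → ℚ) → ∑ (upTo (suc n)) f ≡ f 0 + ∑ (upTo n) (f ∘ suc)
∑-upTo-first n f = cong (_+_ (f 0)) (∑-applyUpTo suc n f)

∑-upTo-last : ∀ n (f : ℕ → ℚ) → ∑ (upTo (suc n)) f ≡ ∑ (upTo n) f + f n
∑-upTo-last n f = begin
  ∑ (upTo (suc n)) f               ≡⟨ cong (λ xs → ∑ xs f) (List.upTo-∷ʳ n) ⟨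
  ∑ (upTo n ++ n ∷ []) f           ≡⟨ ∑-++ (upTo n) (n ∷ []) f ⟩
  ∑ (upTo n) f + (f n + 0ℚ)        ≡⟨ cong (_+_ (∑ (upTo n) f)) (ℚ.+-identityʳ (f n)) ⟩
  ∑ (upTo n) f + f n               ∎
  where open ≡-Reasoning

∑-upTo-reverse : ∀ n (f : ℕ → ℚ) → ∑ (upTo n) f ≡ ∑[ i ← upTo n ] f (n ∸ 1 ∸ i)
∑-upTo-reverse zero    f = refl
∑-upTo-reverse (suc n) f = begin
  ∑ (upTo (suc n)) f                           ≡⟨ ∑-upTo-last n f ⟩
  ∑ (upTo n) f + f n                           ≡⟨ cong (_+ f n) (∑-upTo-reverse n f) ⟩
  (∑[ i ← upTo n ] f (n ∸ 1 ∸ i)) + f n        ≡⟨ ℚ.+-comm _ (f n) ⟩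
  f n + (∑[ i ← upTo n ] f (n ∸ 1 ∸ i))        ≡⟨ cong (_+_ (f n)) (∑-cong (upTo n) λ {i} _ →
                                                    cong f (ℕ.∸-+-assoc n 1 i)) ⟩
  f n + (∑[ i ← upTo n ] f (n ∸ suc i))        ≡⟨ ∑-upTo-first n (λ i → f (n ∸ i)) ⟨
  (∑[ i ← upTo (suc n) ] f (n ∸ i))            ∎
  where open ≡-Reasoning

∑-upTo-telescope : ∀ n (f : ℕ → ℚ) → ∑[ i ← upTo n ] (f (suc i) - f i) ≡ f n - f 0
∑-upTo-telescope zero    f = sym (ℚ.+-inverseʳ (f 0))
∑-upTo-telescope (suc n) f = begin
  (∑[ i ← upTo (suc n) ] (f (suc i) - f i))             ≡⟨ ∑-upTo-last n (λ i → f (suc i) - f i) ⟩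
  (∑[ i ← upTo n ] (f (suc i) - f i)) + (f (suc n) - f n)  ≡⟨ cong (_+ (f (suc n) - f n)) (∑-upTo-telescope n f) ⟩
  (f n - f 0) + (f (suc n) - f n)                       ≡⟨ collapse (f n) (f 0) (f (suc n)) ⟩
  f (suc n) - f 0                                       ∎
  where
  open ≡-Reasoning
  collapse : ∀ x y z → (x - y) + (z - x) ≡ z - y
  collapse = solve 3 (λ x y z → (x :- y) :+ (z :- x) := z :- y) refl

∑-upTo-const : ∀ n x → ∑ (upTo n) (λ _ → x) ≡ ι n * x
∑-upTo-const n x = trans (∑-const (upTo n) x) (cong (λ k → ι k * x) (List.length-upTo n))

∑-upTo-remove : ∀ {n c} → c < n → ∀ (f : ℕ → ℚ) →
                f c + ∑ (filter (λ a → ¬? (a ≟ c)) (upTo n)) f ≡ ∑ (upTo n) f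
∑-upTo-remove {n} {c} c<n f = begin
  f c + ∑ (filter (λ a → ¬? (a ≟ c)) (upTo n)) f     ≡⟨ cong (_+_ (f c)) (∑-filter (λ a → ¬? (a ≟ c)) (upTo n) f) ⟩
  f c + ∑ (upTo n) (off c f)                         ≡⟨ go n c f c<n ⟩
  ∑ (upTo n) f                                       ∎
  where
  open ≡-Reasoning
  off : ℕ → (ℕ → ℚ) → ℕ → ℚ
  off c f a = if does (¬? (a ≟ c)) then f a else 0ℚ

  go : ∀ n c f → c < n → f c + ∑ (upTo n) (off c f) ≡ ∑ (upTo n) f
  go (suc n) zero f _ = cong (_+_ (f 0)) (begin
    0ℚ + ∑ (applyUpTo suc n) (off 0 f)   ≡⟨ ℚ.+-identityˡ _ ⟩
    ∑ (applyUpTo suc n) (off 0 f)        ≡⟨ ∑-applyUpTo suc n (off 0 f) ⟩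
    ∑ (upTo n) (f ∘ suc)                 ≡⟨ ∑-applyUpTo suc n f ⟨
    ∑ (applyUpTo suc n) f                ∎)
  go (suc n) (suc c) f (s≤s c<n) = begin
    f (suc c) + ∑ (upTo (suc n)) (off (suc c) f)             ≡⟨ cong (_+_ (f (suc c))) (∑-upTo-first n (off (suc c) f)) ⟩
    f (suc c) + (f 0 + ∑ (upTo n) (off (suc c) f ∘ suc))     ≡⟨ swap (f (suc c)) (f 0) _ ⟩
    -- The test `suc a ≟ suc c` has the same boolean as `a ≟ c` by computation, so shifting the
    -- index is definitional.
    f 0 + (f (suc c) + ∑ (upTo n) (off (suc c) f ∘ suc))     ≡⟨⟩
    f 0 + (f (suc c) + ∑ (upTo n) (off c (f ∘ suc)))         ≡⟨ cong (_+_ (f 0)) (go n c (f ∘ suc) c<n) ⟩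
    f 0 + ∑ (upTo n) (f ∘ suc)                               ≡⟨ ∑-upTo-first n f ⟨
    ∑ (upTo (suc n)) f                                       ∎
    where
    swap : ∀ x y z → x + (y + z) ≡ y + (x + z)
    swap = solve 3 (λ x y z → x :+ (y :+ z) := y :+ (x :+ z)) refl

-- Sums over intervals

∑-interval-split : ∀ {lo mid hi} → lo ≤ mid → mid ≤ hi → ∀ (f : ℕ → ℚ) →
                   ∑ [ lo , hi ⟩ f ≡ ∑ [ lo , mid ⟩ f + ∑ [ mid , hi ⟩ f
∑-interval-split {lo} {mid} {hi} lo≤mid mid≤hi f
  with m , refl ← ℕ.m≤n⇒∃[o]m+o≡n lo≤mid
  with n , refl ← ℕ.m≤n⇒∃[o]m+o≡n mid≤hi
  rewrite ℕ.+-assoc lo m n | ℕ.m+n∸m≡n lo (m ℕ.+ n) | ℕ.m+n∸m≡n lo m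
        | sym (ℕ.+-assoc lo m n) | ℕ.m+n∸m≡n (lo ℕ.+ m) n = begin
  ∑ (applyUpTo (lo ℕ.+_) (m ℕ.+ n)) f
    ≡⟨ cong (λ xs → ∑ xs f) (split (lo ℕ.+_) m n) ⟩
  ∑ (applyUpTo (lo ℕ.+_) m ++ applyUpTo (λ i → lo ℕ.+ (m ℕ.+ i)) n) f
    ≡⟨ ∑-++ (applyUpTo (lo ℕ.+_) m) _ f ⟩
  ∑ (applyUpTo (lo ℕ.+_) m) f + ∑ (applyUpTo (λ i → lo ℕ.+ (m ℕ.+ i)) n) f
    ≡⟨ cong (_+_ (∑ (applyUpTo (lo ℕ.+_) m) f)) (trans (∑-applyUpTo _ n f)
         (trans (∑-cong (upTo n) λ {i} _ → cong f (sym (ℕ.+-assoc lo m i)))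
                (sym (∑-applyUpTo (lo ℕ.+ m ℕ.+_) n f)))) ⟩
  ∑ (applyUpTo (lo ℕ.+_) m) f + ∑ (applyUpTo (lo ℕ.+ m ℕ.+_) n) f ∎
  where
  open ≡-Reasoning
  split : ∀ (g : ℕ → ℕ) m n → applyUpTo g (m ℕ.+ n) ≡ applyUpTo g m ++ applyUpTo (λ i → g (m ℕ.+ i)) n
  split g zero    n = refl
  split g (suc m) n = cong (g 0 ∷_) (split (g ∘ suc) m n)

∈-interval⁻ : ∀ {lo hi n} → n ∈ [ lo , hi ⟩ → lo ≤ n
∈-interval⁻ {lo} n∈ with i , _ , refl ← ∈-applyUpTo⁻ (lo ℕ.+_) n∈ =
  ℕ.m≤m+n lo i

-- Limits

-- Both `s m` and `s n` are compared with the single value `x N`, so nothing has to be known about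
-- `x` itself.
close⇒cauchy : ∀ (s x : ℕ → ℚ) →
  (∀ ε → 0ℚ ℚ.< ε → ∃[ N ] (∀ m n → N ≤ m → N ≤ n → ∣ s m - x n ∣ ℚ.< ε)) → Cauchy s
close⇒cauchy s x close ε 0<ε
  with N , close-N ← close (½ * ε) (*-pos (ℚ.positive⁻¹ ½) 0<ε) = N , λ m n N≤m N≤n → begin-strict
  ∣ s m - s n ∣                        ≡⟨ cong ∣_∣ (via (s m) (s n) (x N)) ⟩
  ∣ (s m - x N) - (s n - x N) ∣        ≤⟨ ℚ.∣p-q∣≤∣p∣+∣q∣ (s m - x N) (s n - x N) ⟩
  ∣ s m - x N ∣ + ∣ s n - x N ∣        <⟨ ℚ.+-mono-< (close-N m N N≤m ℕ.≤-refl) (close-N n N N≤n ℕ.≤-refl) ⟩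
  ½ * ε + ½ * ε                        ≡⟨ trans (sym (ℚ.*-distribʳ-+ ε ½ ½)) (ℚ.*-identityˡ ε) ⟩
  ε                                    ∎
  where
  open ℚ.≤-Reasoning
  via : ∀ p q r → p - q ≡ (p - r) - (q - r)
  via = solve 3 (λ p q r → p :- q := (p :- r) :- (q :- r)) refl

∣p-q∣≡∣q-p∣ : ∀ p q → ∣ p - q ∣ ≡ ∣ q - p ∣
∣p-q∣≡∣q-p∣ p q = trans (cong ∣_∣ (negate p q)) (ℚ.∣-p∣≡∣p∣ (q - p))
  where
  negate : ∀ p q → p - q ≡ - (q - p)
  negate = solve 2 (λ p q → p :- q := :- (q :- p)) refl

archimedean : ∀ p → ∃[ n ] p ℚ.< ι n
archimedean p@(ℚ.mkℚ ℤ.-[1+ _ ] _ _) = 0 , ℚ.negative⁻¹ p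
archimedean p@(ℚ.mkℚ (+ n) d _)      = suc n , (begin-strict
  p                        ≡⟨ ℚ.↥p/↧p≡p p ⟨
  + n / suc d              ≡⟨ /-≡-*recip n d ⟩
  ι n * recip (suc d)      ≤⟨ *-monoʳ-≤ (ι-nonNeg n) recip≤1 ⟩
  ι n * 1ℚ                 ≡⟨ ℚ.*-identityʳ (ι n) ⟩
  ι n                      <⟨ ι-mono-< {n} ℕ.≤-refl ⟩
  ι (suc n)                ∎)
  where
  open ℚ.≤-Reasoning
  recip≤1 : recip (suc d) ℚ.≤ 1ℚ
  recip≤1 = begin
    recip (suc d)                ≡⟨ ℚ.*-identityˡ (recip (suc d)) ⟨
    ι 1 * recip (suc d)          ≤⟨ *-mono-≤ (ι-nonNeg 1) (recip-nonNeg (suc d)) (ι-mono-≤ {1} {suc d} (s≤s z≤n)) ℚ.≤-refl ⟩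
    ι (suc d) * recip (suc d)    ≡⟨ *-recip {suc d} ℕ.z<s ⟩
    1ℚ                           ∎

archimedean-* : ∀ p {q} → 0ℚ ℚ.< q → ∃[ n ] p ℚ.< ι n * q
archimedean-* p {q} 0<q = n , (begin-strict
  p                   ≡⟨ ℚ.*-identityʳ p ⟨
  p * 1ℚ              ≡⟨ cong (p *_) (ℚ.*-inverseˡ q {{q≢0}}) ⟨
  p * (1/q * q)       ≡⟨ ℚ.*-assoc p 1/q q ⟨
  p * 1/q * q         ≡⟨ ℚ.*-comm (p * 1/q) q ⟩
  q * (p * 1/q)       <⟨ *-monoʳ-< 0<q p/q<n ⟩
  q * ι n             ≡⟨ ℚ.*-comm q (ι n) ⟩
  ι n * q             ∎)
  where
  open ℚ.≤-Reasoning
  q≢0 = ℚ.pos⇒nonZero q {{ℚ.positive 0<q}}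
  1/q = ℚ.1/_ q {{q≢0}}
  n = proj₁ (archimedean (p * 1/q))
  p/q<n = proj₂ (archimedean (p * 1/q))

-- Bernoulli's inequality for 1/q, cleared of denominators.
q^n*[1+n[1-q]]≤1 : ∀ {q} → 0ℚ ℚ.≤ q → ∀ n → q ^ℚ n * (1ℚ + ι n * (1ℚ - q)) ℚ.≤ 1ℚ
q^n*[1+n[1-q]]≤1 {q} 0≤q zero    = ℚ.≤-reflexive (base q)
  where
  base : ∀ q → 1ℚ * (1ℚ + 0ℚ * (1ℚ - q)) ≡ 1ℚ
  base = solve 1 (λ q → con 1ℚ :* (con 1ℚ :+ con 0ℚ :* (con 1ℚ :- q)) := con 1ℚ) refl
q^n*[1+n[1-q]]≤1 {q} 0≤q (suc n) = begin
  q * q ^ℚ n * (1ℚ + ι (suc n) * (1ℚ - q))        ≡⟨ cong (λ t → q * q ^ℚ n * (1ℚ + t * (1ℚ - q))) (ι-suc n) ⟩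
  q * q ^ℚ n * (1ℚ + (1ℚ + ι n) * (1ℚ - q))       ≤⟨ 0≤q-p⇒p≤q (subst (0ℚ ℚ.≤_) (sym (gap q (q ^ℚ n) (ι n)))
                                                       (*-nonNeg (^ℚ-nonNeg 0≤q n) (*-nonNeg
                                                         (+-nonNeg (ι-nonNeg n) (ℚ.<⇒≤ 0<1)) (square (1ℚ - q))))) ⟩
  q ^ℚ n * (1ℚ + ι n * (1ℚ - q))                  ≤⟨ q^n*[1+n[1-q]]≤1 0≤q n ⟩
  1ℚ                                              ∎
  where
  open ℚ.≤-Reasoning
  gap : ∀ q s n → s * (1ℚ + n * (1ℚ - q)) - q * s * (1ℚ + (1ℚ + n) * (1ℚ - q)) ≡
                  s * ((n + 1ℚ) * ((1ℚ - q) * (1ℚ - q)))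
  gap = solve 3 (λ q s n →
    s :* (con 1ℚ :+ n :* (con 1ℚ :- q)) :- q :* s :* (con 1ℚ :+ (con 1ℚ :+ n) :* (con 1ℚ :- q)) :=
    s :* ((n :+ con 1ℚ) :* ((con 1ℚ :- q) :* (con 1ℚ :- q)))) refl
  square : ∀ p → 0ℚ ℚ.≤ p * p
  square p with ℚ.≤-total 0ℚ p
  ... | inj₁ 0≤p = *-nonNeg 0≤p 0≤p
  ... | inj₂ p≤0 = subst (0ℚ ℚ.≤_) (solve 1 (λ p → (:- p) :* (:- p) := p :* p) refl p)
    (*-nonNeg (ℚ.neg-antimono-≤ p≤0) (ℚ.neg-antimono-≤ p≤0))

-- By Bernoulli, q^n is at most 1/(1 + n(1 - q)), so any N with c < N(1 - q)ε works. The inequality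
-- is verified after multiplication by 1 + n(1 - q).
geometric-decay : ∀ {q} → 0ℚ ℚ.≤ q → q ℚ.< 1ℚ → ∀ {c} → 0ℚ ℚ.≤ c → ∀ {ε} → 0ℚ ℚ.< ε →
                  ∃[ N ] (∀ n → N ≤ n → c * q ^ℚ n ℚ.< ε)
geometric-decay {q} 0≤q q<1 {c} 0≤c {ε} 0<ε = N , bound
  where
  open ℚ.≤-Reasoning
  δ = 1ℚ - q
  0<δ : 0ℚ ℚ.< δ
  0<δ = p<q⇒0<q-p q<1
  N = proj₁ (archimedean-* c (*-pos 0<δ 0<ε))
  c<Nδε : c ℚ.< ι N * (δ * ε)
  c<Nδε = proj₂ (archimedean-* c (*-pos 0<δ 0<ε))
  rotate : ∀ w c p → w * (c * p) ≡ c * (p * w)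
  rotate = solve 3 (λ w c p → w :* (c :* p) := c :* (p :* w)) refl
  gap : ∀ n d e → e + n * (d * e) ≡ (1ℚ + n * d) * e
  gap = solve 3 (λ n d e → e :+ n :* (d :* e) := (con 1ℚ :+ n :* d) :* e) refl
  bound : ∀ n → N ≤ n → c * q ^ℚ n ℚ.< ε
  bound n N≤n = *-cancelˡ-< 0<w (begin-strict
    w * (c * q ^ℚ n)            ≡⟨ rotate w c (q ^ℚ n) ⟩
    c * (q ^ℚ n * w)            ≤⟨ *-monoʳ-≤ 0≤c (q^n*[1+n[1-q]]≤1 0≤q n) ⟩
    c * 1ℚ                      ≡⟨ ℚ.*-identityʳ c ⟩
    c                           <⟨ c<Nδε ⟩
    ι N * (δ * ε)               ≤⟨ *-mono-≤ (ι-nonNeg N) (ℚ.<⇒≤ (*-pos 0<δ 0<ε)) (ι-mono-≤ N≤n) ℚ.≤-refl ⟩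
    ι n * (δ * ε)               ≡⟨ ℚ.+-identityˡ _ ⟨
    0ℚ + ι n * (δ * ε)          ≤⟨ ℚ.+-monoˡ-≤ (ι n * (δ * ε)) (ℚ.<⇒≤ 0<ε) ⟩
    ε + ι n * (δ * ε)           ≡⟨ gap (ι n) δ ε ⟩
    w * ε                       ∎)
    where
    w = 1ℚ + ι n * δ
    0<w : 0ℚ ℚ.< w
    0<w = ℚ.+-mono-<-≤ 0<1 (*-nonNeg (ι-nonNeg n) (ℚ.<⇒≤ 0<δ))

-- Binomial translation: if u is the moment sequence of a linear functional
-- on polynomials, u m = L(yᵐ), then translate x u m = L((x + y)ᵐ).

translate : ℚ → (ℕ → ℚ) → ℕ → ℚ
translate x u zero    = u zero
translate x u (suc m) = x * translate x u m + translate x (u ∘ suc) m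

translate-cong : ∀ x {u w : ℕ → ℚ} → (∀ n → u n ≡ w n) → ∀ m → translate x u m ≡ translate x w m
translate-cong x eq zero    = eq 0
translate-cong x eq (suc m) = cong₂ _+_ (cong (x *_) (translate-cong x eq m)) (translate-cong x (eq ∘ suc) m)

translate-+ : ∀ x u w m → translate x (λ n → u n + w n) m ≡ translate x u m + translate x w m
translate-+ x u w zero    = refl
translate-+ x u w (suc m) = trans
  (cong₂ (λ s t → x * s + t) (translate-+ x u w m) (translate-+ x (u ∘ suc) (w ∘ suc) m))
  (regroup x _ _ _ _)
  where
  regroup : ∀ x p q r s → x * (p + q) + (r + s) ≡ (x * p + r) + (x * q + s)
  regroup = solve 5 (λ x p q r s → x :* (p :+ q) :+ (r :+ s) := (x :* p :+ r) :+ (x :* q :+ s)) refl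

translate-* : ∀ x c u m → translate x (λ n → c * u n) m ≡ c * translate x u m
translate-* x c u zero    = refl
translate-* x c u (suc m) = trans
  (cong₂ (λ s t → x * s + t) (translate-* x c u m) (translate-* x c (u ∘ suc) m))
  (regroup x c _ _)
  where
  regroup : ∀ x c p q → x * (c * p) + c * q ≡ c * (x * p + q)
  regroup = solve 4 (λ x c p q → x :* (c :* p) :+ c :* q := c :* (x :* p :+ q)) refl

translate-- : ∀ x u w m → translate x (λ n → u n - w n) m ≡ translate x u m - translate x w m
translate-- x u w zero    = refl
translate-- x u w (suc m) = trans
  (cong₂ (λ s t → x * s + t) (translate-- x u w m) (translate-- x (u ∘ suc) (w ∘ suc) m))
  (regroup x _ _ _ _)
  where
  regroup : ∀ x p q r s → x * (p - q) + (r - s) ≡ (x * p + r) - (x * q + s)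
  regroup = solve 5 (λ x p q r s → x :* (p :- q) :+ (r :- s) := (x :* p :+ r) :- (x :* q :+ s)) refl

-- This is L(y (x + y)^m) computed with y = (x + y) - x.
translate-suc : ∀ x u m → translate x (u ∘ suc) m ≡ translate x u (suc m) - x * translate x u m
translate-suc x u m = solve 2 (λ p q → q := p :+ q :- p) refl (x * translate x u m) (translate x (u ∘ suc) m)

-- The constant sequence c is the moment sequence of the mass c at the point 1.
translate-const : ∀ a c m → translate (ι a) (λ _ → c) m ≡ c * ι (suc a ^ m)
translate-const a c zero    = sym (ℚ.*-identityʳ c)
translate-const a c (suc m) = begin
  ι a * translate (ι a) (λ _ → c) m + translate (ι a) (λ _ → c) m
    ≡⟨ cong (λ t → ι a * t + t) (translate-const a c m) ⟩
  ι a * (c * ι (suc a ^ m)) + c * ι (suc a ^ m)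
    ≡⟨ factor (ι a) c (ι (suc a ^ m)) ⟩
  c * ((1ℚ + ι a) * ι (suc a ^ m))
    ≡⟨ cong (c *_) (trans (cong (_* ι (suc a ^ m)) (sym (ι-suc a))) (sym (ι-* (suc a) (suc a ^ m)))) ⟩
  c * ι (suc a ^ suc m) ∎
  where
  open ≡-Reasoning
  factor : ∀ a c p → a * (c * p) + c * p ≡ c * ((1ℚ + a) * p)
  factor = solve 3 (λ a c p → a :* (c :* p) :+ c :* p := c :* ((con 1ℚ :+ a) :* p)) refl

translate-^ : ∀ x y m → translate x (y ^ℚ_) m ≡ (x + y) ^ℚ m
translate-^ x y zero    = refl
translate-^ x y (suc m) = begin
  x * translate x (y ^ℚ_) m + translate x (λ n → y * y ^ℚ n) m
    ≡⟨ cong₂ (λ s t → x * s + t) (translate-^ x y m) (translate-* x y (y ^ℚ_) m) ⟩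
  x * (x + y) ^ℚ m + y * translate x (y ^ℚ_) m
    ≡⟨ cong (λ t → x * (x + y) ^ℚ m + y * t) (translate-^ x y m) ⟩
  x * (x + y) ^ℚ m + y * (x + y) ^ℚ m
    ≡⟨ ℚ.*-distribʳ-+ ((x + y) ^ℚ m) x y ⟨
  (x + y) * (x + y) ^ℚ m ∎
  where open ≡-Reasoning

module _ {x : ℚ} (0≤x : 0ℚ ℚ.≤ x) where

  translate-nonNeg : ∀ {u} m → (∀ n → n ≤ m → 0ℚ ℚ.≤ u n) → 0ℚ ℚ.≤ translate x u m
  translate-nonNeg zero    0≤u = 0≤u 0 z≤n
  translate-nonNeg (suc m) 0≤u = +-nonNeg
    (*-nonNeg 0≤x (translate-nonNeg m λ n n≤m → 0≤u n (ℕ.m≤n⇒m≤1+n n≤m)))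
    (translate-nonNeg m λ n n≤m → 0≤u (suc n) (s≤s n≤m))

  translate-mono-≤ : ∀ {u w} m → (∀ n → u n ℚ.≤ w n) → translate x u m ℚ.≤ translate x w m
  translate-mono-≤ {u} {w} m u≤w = 0≤q-p⇒p≤q (subst (0ℚ ℚ.≤_) (translate-- x w u m)
    (translate-nonNeg m λ n _ → p≤q⇒0≤q-p (u≤w n)))

  -- The power y^m has coefficient 1 in (x + y)^m, and the remaining terms involve only `u n` with n
  -- < m. Nonnegativity is asked strictly below m because the bound serves inside the induction that
  -- establishes the sign of `u m`.
  u[m]≤translate : ∀ {u} m → (∀ n → n < m → 0ℚ ℚ.≤ u n) → u m ℚ.≤ translate x u m
  u[m]≤translate zero    0≤u = ℚ.≤-refl
  u[m]≤translate {u} (suc m) 0≤u = begin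
    u (suc m)                ≡⟨ ℚ.+-identityˡ _ ⟨
    0ℚ + u (suc m)           ≤⟨ ℚ.+-mono-≤ (*-nonNeg 0≤x (translate-nonNeg m λ n n≤m → 0≤u n (s≤s n≤m)))
                                          (u[m]≤translate m λ n n<m → 0≤u (suc n) (s≤s n<m)) ⟩
    translate x u (suc m)    ∎
    where open ℚ.≤-Reasoning

-- If w m = L(yᵐ), then w′ m = L′(yᵐ) for the functional L′ f = L(f′).
translate-derivative : ∀ x w {w′ : ℕ → ℚ} → (∀ n → w′ n ≡ ι n * w (ℕ.pred n)) →
                       ∀ m → translate x w′ (suc m) ≡ ι (suc m) * translate x w m
translate-derivative x w {w′} w′-def zero = begin
  x * w′ 0 + w′ 1                    ≡⟨ cong₂ (λ s t → x * s + t) (w′-def 0) (w′-def 1) ⟩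
  x * (0ℚ * w 0) + 1ℚ * w 0          ≡⟨ cong (_+ 1ℚ * w 0) (trans (cong (x *_) (ℚ.*-zeroˡ (w 0))) (ℚ.*-zeroʳ x)) ⟩
  0ℚ + 1ℚ * w 0                      ≡⟨ ℚ.+-identityˡ _ ⟩
  1ℚ * w 0                           ∎
  where open ≡-Reasoning
translate-derivative x w {w′} w′-def (suc m) = begin
  x * translate x w′ (suc m) + translate x (w′ ∘ suc) (suc m)
    ≡⟨ cong₂ (λ s t → x * s + t) (translate-derivative x w w′-def m)
         (trans (translate-cong x step (suc m)) (translate-+ x w (λ n → ι n * w n) (suc m))) ⟩
  x * (ι (suc m) * translate x w m) + (translate x w (suc m) + translate x (λ n → ι n * w n) (suc m))
    ≡⟨ cong (λ t → x * (ι (suc m) * translate x w m) + (translate x w (suc m) + t))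
         (translate-derivative x (w ∘ suc) pred-suc m) ⟩
  x * (ι (suc m) * translate x w m) + (translate x w (suc m) + ι (suc m) * translate x (w ∘ suc) m)
    ≡⟨ collect x (ι (suc m)) (translate x w m) (translate x (w ∘ suc) m) ⟩
  (1ℚ + ι (suc m)) * translate x w (suc m)
    ≡⟨ cong (_* translate x w (suc m)) (ι-suc (suc m)) ⟨
  ι (suc (suc m)) * translate x w (suc m) ∎
  where
  open ≡-Reasoning
  -- Product rule (y f)′ = f + y f′: the second part is again of derivative form, with `w ∘ suc` in
  -- place of `w`, which is where the recursive call applies.
  step : ∀ n → w′ (suc n) ≡ w n + ι n * w n
  step n = trans (w′-def (suc n)) (trans (cong (_* w n) (ι-suc n))
    (solve 2 (λ n w → (con 1ℚ :+ n) :* w := w :+ n :* w) refl (ι n) (w n)))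
  -- At 0 the two sides read different entries of `w`, both with factor zero.
  pred-suc : ∀ n → ι n * w n ≡ ι n * w (suc (ℕ.pred n))
  pred-suc zero    = trans (ℚ.*-zeroˡ (w 0)) (sym (ℚ.*-zeroˡ (w 1)))
  pred-suc (suc n) = refl
  collect : ∀ x n p q → x * (n * p) + ((x * p + q) + n * q) ≡ (1ℚ + n) * (x * p + q)
  collect = solve 4 (λ x n p q → x :* (n :* p) :+ ((x :* p :+ q) :+ n :* q) :=
                                 (con 1ℚ :+ n) :* (x :* p :+ q)) refl

-- Pascal's rule. This connects the binomial sums in the definition of `v` with the recursion
-- defining `translate`, which later inductions on m follow.
translate-binomial : ∀ a u m →
  translate (ι a) u m ≡ (∑[ i ← upTo (suc m) ] ι ((m C i) ℕ.* a ^ i) * u (m ∸ i))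
translate-binomial a u zero    = sym (trans (ℚ.+-identityʳ _) (ℚ.*-identityˡ (u 0)))
translate-binomial a u (suc m) = sym (begin
  (∑[ i ← upTo (suc (suc m)) ] ι ((suc m C i) ℕ.* a ^ i) * u (suc m ∸ i))
    ≡⟨ ∑-upTo-first (suc m) (λ i → ι ((suc m C i) ℕ.* a ^ i) * u (suc m ∸ i)) ⟩
  t₀ + (∑[ i ← upTo (suc m) ] ι ((suc m C suc i) ℕ.* a ^ suc i) * u (m ∸ i))
    ≡⟨ cong (_+_ t₀) (∑-cong (upTo (suc m)) λ {i} _ → pascal i) ⟩
  t₀ + (∑[ i ← upTo (suc m) ] (ι a * (ι ((m C i) ℕ.* a ^ i) * u (m ∸ i)) + g i))
    ≡⟨ cong (_+_ t₀) (∑-distrib-+ (upTo (suc m)) (λ i → ι a * (ι ((m C i) ℕ.* a ^ i) * u (m ∸ i))) g) ⟩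
  t₀ + ((∑[ i ← upTo (suc m) ] ι a * (ι ((m C i) ℕ.* a ^ i) * u (m ∸ i))) + ∑ (upTo (suc m)) g)
    ≡⟨ cong₂ (λ s t → t₀ + (s + t))
         (trans (∑-*ˡ (upTo (suc m)) (ι a) (λ i → ι ((m C i) ℕ.* a ^ i) * u (m ∸ i)))
                (cong (ι a *_) (sym (translate-binomial a u m))))
         (trans (∑-upTo-last m g) (trans (cong (_+_ (∑ (upTo m) g)) g-last) (ℚ.+-identityʳ _))) ⟩
  t₀ + (ι a * translate (ι a) u m + ∑ (upTo m) g)
    ≡⟨ solve 3 (λ x y z → x :+ (y :+ z) := y :+ (x :+ z)) refl t₀ (ι a * translate (ι a) u m) (∑ (upTo m) g) ⟩
  ι a * translate (ι a) u m + (t₀ + ∑ (upTo m) g)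
    ≡⟨ cong (λ t → ι a * translate (ι a) u m + (t₀ + t)) (∑-cong (upTo m) λ {i} i∈ →
         cong (λ n → ι ((m C suc i) ℕ.* a ^ suc i) * u n) (∸-suc (∈-upTo⁻ i∈))) ⟩
  ι a * translate (ι a) u m + (t₀ + (∑[ i ← upTo m ] ι ((m C suc i) ℕ.* a ^ suc i) * u (suc (m ∸ suc i))))
    ≡⟨ cong (_+_ (ι a * translate (ι a) u m))
         (∑-upTo-first m (λ i → ι ((m C i) ℕ.* a ^ i) * u (suc (m ∸ i)))) ⟨
  ι a * translate (ι a) u m + (∑[ i ← upTo (suc m) ] ι ((m C i) ℕ.* a ^ i) * u (suc (m ∸ i)))
    ≡⟨ cong (_+_ (ι a * translate (ι a) u m)) (translate-binomial a (u ∘ suc) m) ⟨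
  translate (ι a) u (suc m) ∎)
  where
  open ≡-Reasoning
  t₀ = 1ℚ * u (suc m)
  g : ℕ → ℚ
  g i = ι ((m C suc i) ℕ.* a ^ suc i) * u (m ∸ i)
  ∸-suc : ∀ {i m} → i < m → m ∸ i ≡ suc (m ∸ suc i)
  ∸-suc {i} {suc m} (s≤s i≤m) = ℕ.+-∸-assoc 1 i≤m
  g-last : g m ≡ 0ℚ
  g-last = trans (cong (λ c → ι (c ℕ.* a ^ suc m) * u (m ∸ m)) (k>n⇒nCk≡0 (ℕ.n<1+n m)))
                 (ℚ.*-zeroˡ (u (m ∸ m)))
  pascal : ∀ i → ι ((suc m C suc i) ℕ.* a ^ suc i) * u (m ∸ i) ≡ ι a * (ι ((m C i) ℕ.* a ^ i) * u (m ∸ i)) + g i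
  pascal i = begin
    ι ((suc m C suc i) ℕ.* a ^ suc i) * u (m ∸ i)
      ≡⟨ cong (λ c → ι (c ℕ.* a ^ suc i) * u (m ∸ i)) (nCk+nC[k+1]≡[n+1]C[k+1] m i) ⟨
    ι ((m C i ℕ.+ m C suc i) ℕ.* a ^ suc i) * u (m ∸ i)
      ≡⟨ cong (_* u (m ∸ i)) (trans (cong ι (ℕ.*-distribʳ-+ (a ^ suc i) (m C i) (m C suc i)))
           (ι-+ ((m C i) ℕ.* a ^ suc i) ((m C suc i) ℕ.* a ^ suc i))) ⟩
    (ι ((m C i) ℕ.* (a ℕ.* a ^ i)) + ι ((m C suc i) ℕ.* a ^ suc i)) * u (m ∸ i)
      ≡⟨ cong (λ t → (t + ι ((m C suc i) ℕ.* a ^ suc i)) * u (m ∸ i))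
           (trans (cong ι (exchange (m C i) a (a ^ i))) (ι-* a ((m C i) ℕ.* a ^ i))) ⟩
    (ι a * ι ((m C i) ℕ.* a ^ i) + ι ((m C suc i) ℕ.* a ^ suc i)) * u (m ∸ i)
      ≡⟨ solve 4 (λ a p q u → (a :* p :+ q) :* u := a :* (p :* u) :+ q :* u) refl
           (ι a) (ι ((m C i) ℕ.* a ^ i)) (ι ((m C suc i) ℕ.* a ^ suc i)) (u (m ∸ i)) ⟩
    ι a * (ι ((m C i) ℕ.* a ^ i) * u (m ∸ i)) + g i ∎
    where
    exchange : ∀ x y z → x ℕ.* (y ℕ.* z) ≡ y ℕ.* (x ℕ.* z)
    exchange x y z = trans (sym (ℕ.*-assoc x y z)) (trans (cong (ℕ._* z) (ℕ.*-comm x y)) (ℕ.*-assoc y x z))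

-- Encodes the branch of the distinguished digit: it uses up one occurrence of d, so it refers to j
-- - 1, and at j = 0 the contribution of the empty string stands in its place.
prev : ∀ {a} {A : Set a} → A → (ℕ → A) → ℕ → A
prev x f zero    = x
prev x f (suc j) = f j

-- The moments of f ↦ f 1 − f 0: their translates by a = 0, 1, 2, … telescope.
positive : ℕ → ℚ
positive zero    = 0ℚ
positive (suc _) = 1ℚ

ι-*-sum : ∀ c (f : ℕ → ℕ) xs → ι (c ℕ.* sum (map f xs)) ≡ (∑[ a ← xs ] ι (c ℕ.* f a))
ι-*-sum c f []       = cong ι (ℕ.*-zeroʳ c)
ι-*-sum c f (a ∷ as) = begin
  ι (c ℕ.* (f a ℕ.+ sum (map f as)))            ≡⟨ cong ι (ℕ.*-distribˡ-+ c (f a) (sum (map f as))) ⟩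
  ι (c ℕ.* f a ℕ.+ c ℕ.* sum (map f as))        ≡⟨ ι-+ (c ℕ.* f a) (c ℕ.* sum (map f as)) ⟩
  ι (c ℕ.* f a) + ι (c ℕ.* sum (map f as))      ≡⟨ cong (_+_ (ι (c ℕ.* f a))) (ι-*-sum c f as) ⟩
  ι (c ℕ.* f a) + (∑[ a ← as ] ι (c ℕ.* f a))   ∎
  where open ≡-Reasoning

translate-positive : ∀ a m → translate (ι a) positive m ≡ ι (suc a ^ m) - ι (a ^ m)
translate-positive a zero    = refl
translate-positive a (suc m) = begin
  ι a * translate (ι a) positive m + translate (ι a) (λ _ → 1ℚ) m
    ≡⟨ cong₂ (λ s t → ι a * s + t) (translate-positive a m) (translate-const a 1ℚ m) ⟩
  ι a * (ι (suc a ^ m) - ι (a ^ m)) + 1ℚ * ι (suc a ^ m)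
    ≡⟨ regroup (ι a) (ι (suc a ^ m)) (ι (a ^ m)) ⟩
  (1ℚ + ι a) * ι (suc a ^ m) - ι a * ι (a ^ m)
    ≡⟨ cong₂ _-_ (trans (cong (_* ι (suc a ^ m)) (sym (ι-suc a))) (sym (ι-* (suc a) (suc a ^ m))))
                 (sym (ι-* a (a ^ m))) ⟩
  ι (suc a ^ suc m) - ι (a ^ suc m) ∎
  where
  open ≡-Reasoning
  regroup : ∀ a p q → a * (p - q) + 1ℚ * p ≡ (1ℚ + a) * p - a * q
  regroup = solve 3 (λ a p q → a :* (p :- q) :+ con 1ℚ :* p := (con 1ℚ :+ a) :* p :- a :* q) refl

∑-translate-positive : ∀ n m → (∑[ a ← upTo n ] translate (ι a) positive (suc m)) ≡ ι (n ^ suc m)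
∑-translate-positive n m = begin
  (∑[ a ← upTo n ] translate (ι a) positive (suc m))        ≡⟨ ∑-cong (upTo n) (λ {a} _ → translate-positive a (suc m)) ⟩
  (∑[ a ← upTo n ] (ι (suc a ^ suc m) - ι (a ^ suc m)))     ≡⟨ ∑-upTo-telescope n (λ a → ι (a ^ suc m)) ⟩
  -- The lower end `0 ^ suc m` computes to 0; with exponent 0 it would be 1.
  ι (n ^ suc m) - 0ℚ                                        ≡⟨ ℚ.+-identityʳ (ι (n ^ suc m)) ⟩
  ι (n ^ suc m)                                             ∎
  where open ≡-Reasoning

-- ∑ₐ ∫₀¹ (a + y)ᵐ dy = ∫₀ⁿ yᵐ dy.
∑-translate-recip : ∀ n m →
  (∑[ a ← upTo n ] translate (ι a) (recip ∘ suc) m) ≡ ι (n ^ suc m) * recip (suc m)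
∑-translate-recip n m = *-cancelˡ-≡ (ι-pos {suc m} ℕ.z<s) (begin
  ι (suc m) * (∑[ a ← upTo n ] translate (ι a) (recip ∘ suc) m)
    ≡⟨ ∑-*ˡ (upTo n) (ι (suc m)) (λ a → translate (ι a) (recip ∘ suc) m) ⟨
  (∑[ a ← upTo n ] ι (suc m) * translate (ι a) (recip ∘ suc) m)
    ≡⟨ ∑-cong (upTo n) (λ {a} _ → translate-derivative (ι a) (recip ∘ suc) positive-def m) ⟨
  (∑[ a ← upTo n ] translate (ι a) positive (suc m))
    ≡⟨ ∑-translate-positive n m ⟩
  ι (n ^ suc m)
    ≡⟨ ℚ.*-identityʳ (ι (n ^ suc m)) ⟨
  ι (n ^ suc m) * 1ℚ
    ≡⟨ cong (ι (n ^ suc m) *_) (*-recip {suc m} ℕ.z<s) ⟨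
  ι (n ^ suc m) * (ι (suc m) * recip (suc m))
    ≡⟨ x*[y*z]≡y*[x*z] (ι (n ^ suc m)) (ι (suc m)) (recip (suc m)) ⟩
  ι (suc m) * (ι (n ^ suc m) * recip (suc m)) ∎)
  where
  open ≡-Reasoning
  -- Fundamental theorem of calculus in moment form: the derivative of the Lebesgue functional on
  -- [0, 1] is f ↦ f 1 - f 0. At i = 0 the factor i cancels the value of the truncated predecessor.
  positive-def : ∀ i → positive i ≡ ι i * recip (suc (ℕ.pred i))
  positive-def zero    = refl
  positive-def (suc i) = sym (*-recip {suc i} ℕ.z<s)

-- Digits

fromDigits-∷-injective : ∀ {b} (x y : Digit b) (m n : ℕ) →
                         toℕ x ℕ.+ m ℕ.* b ≡ toℕ y ℕ.+ n ℕ.* b → x ≡ y × m ≡ n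
fromDigits-∷-injective {b@(suc _)} x y m n eq = Fin.toℕ-injective x≡y ,
  ℕ.*-cancelʳ-≡ m n b (ℕ.+-cancelˡ-≡ (toℕ x) (m ℕ.* b) (n ℕ.* b) (trans eq (cong (ℕ._+ n ℕ.* b) (sym x≡y))))
  where
  low : ∀ (z : Digit b) k → (toℕ z ℕ.+ k ℕ.* b) ℕ.% b ≡ toℕ z
  low z k = trans (ℕ.[m+kn]%n≡m%n (toℕ z) k b) (ℕ.m<n⇒m%n≡m (Fin.toℕ<n z))
  x≡y : toℕ x ≡ toℕ y
  x≡y = trans (sym (low x m)) (trans (cong (ℕ._% b) eq) (low y n))

strip-zeros : ∀ {b} (as : Expansion b) → fromDigits as ≡ 0 → stripLeadingZeros as ≡ []
strip-zeros []              eq = refl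
strip-zeros {suc b} (Fin.zero ∷ as) eq
  rewrite strip-zeros as (ℕ.m*n≡0⇒m≡0 (fromDigits as) (suc b) eq) = refl

-- Division with remainder recovers the digits one by one, up to leading zeros. Hence `digits` can
-- be identified from values alone, without unfolding `toDigits`.
strip-unique : ∀ {b} (as bs : Expansion b) → fromDigits as ≡ fromDigits bs →
               stripLeadingZeros as ≡ stripLeadingZeros bs
strip-unique []       bs       eq = sym (strip-zeros bs (sym eq))
strip-unique (a ∷ as) []       eq = strip-zeros (a ∷ as) eq
strip-unique (a ∷ as) (c ∷ cs) eq with fromDigits-∷-injective a c (fromDigits as) (fromDigits cs) eq
... | refl , eq′ rewrite strip-unique as cs eq′ = refl

strip-∷ : ∀ {b} (a : Digit b) as → stripLeadingZeros as ≢ [] → stripLeadingZeros (a ∷ as) ≡ a ∷ stripLeadingZeros as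
strip-∷ a as ne with stripLeadingZeros as
strip-∷ a            as ne | []     = contradiction refl ne
strip-∷ Fin.zero     as ne | x ∷ xs = refl
strip-∷ (Fin.suc a)  as ne | x ∷ xs = refl

n<b^n : ∀ {b} → 1 < b → ∀ n → n < b ^ n
n<b^n 1<b zero    = ℕ.z<s
n<b^n {b@(suc _)} 1<b (suc n) = ℕ.≤-<-trans (n<b^n 1<b n)
  (subst (ℕ._< b ^ suc n) (ℕ.*-identityˡ (b ^ n)) (ℕ.*-monoˡ-< (b ^ n) {{ℕ.m^n≢0 b n}} 1<b))

-- Reciprocals

-- A total inverse, so that the kernels below are plain functions on ℚ that can be integrated; the
-- value at 0 is a default, and the equations below are stated at positive arguments.
inv : ℚ → ℚ
inv q with q ℚ.≟ 0ℚ
... | yes _   = 0ℚ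
... | no q≢0 = ℚ.1/_ q {{ℚ.≢-nonZero q≢0}}

*-inv : ∀ {q} → 0ℚ ℚ.< q → q * inv q ≡ 1ℚ
*-inv {q} 0<q with q ℚ.≟ 0ℚ
... | yes q≡0 = contradiction (sym q≡0) (ℚ.<⇒≢ 0<q)
... | no q≢0 = ℚ.*-inverseʳ q {{ℚ.≢-nonZero q≢0}}

recip-scale : ∀ {m n} → 0 < m → 0 < n → recip n ≡ ι m * recip (m ℕ.* n)
recip-scale {m} {n} 0<m 0<n = *-cancelˡ-≡ (ι-pos 0<n) (begin
  ι n * recip n                          ≡⟨ *-recip 0<n ⟩
  1ℚ                                     ≡⟨ *-recip (ℕ.*-mono-≤ 0<m 0<n) ⟨
  ι (m ℕ.* n) * recip (m ℕ.* n)          ≡⟨ cong (_* recip (m ℕ.* n)) (ι-* m n) ⟩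
  ι m * ι n * recip (m ℕ.* n)            ≡⟨ solve 3 (λ x y z → x :* y :* z := y :* (x :* z)) refl
                                              (ι m) (ι n) (recip (m ℕ.* n)) ⟩
  ι n * (ι m * recip (m ℕ.* n))          ∎)
  where open ≡-Reasoning

1^ : ∀ m → 1ℚ ^ℚ m ≡ 1ℚ
1^ zero    = refl
1^ (suc m) = trans (ℚ.*-identityˡ (1ℚ ^ℚ m)) (1^ m)

^ℚ≤1 : ∀ {y} → 0ℚ ℚ.≤ y → y ℚ.≤ 1ℚ → ∀ m → y ^ℚ m ℚ.≤ 1ℚ
^ℚ≤1 0≤y y≤1 zero    = ℚ.≤-refl
^ℚ≤1 0≤y y≤1 (suc m) = *-mono-≤ 0≤y (ℚ.<⇒≤ 0<1) y≤1 (^ℚ≤1 0≤y y≤1 m)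

prev-lift : ∀ {a ℓ} {A : Set a} (_∼_ : A → A → Set ℓ) {x y} {f g : ℕ → A} →
            x ∼ y → (∀ i → f i ∼ g i) → ∀ j → prev x f j ∼ prev y g j
prev-lift _∼_ x∼y f∼g zero    = x∼y
prev-lift _∼_ x∼y f∼g (suc j) = f∼g j

prev-map : ∀ {a} {A : Set a} (h : A → A) x f j → h (prev x f j) ≡ prev (h x) (h ∘ f) j
prev-map h x f zero    = refl
prev-map h x f (suc j) = refl

prev-+ : ∀ x y f g j → prev (x + y) (λ i → f i + g i) j ≡ prev x f j + prev y g j
prev-+ x y f g zero    = refl
prev-+ x y f g (suc j) = refl

-- Sums over intervals of integers grouped by leading digits

∑-interval : ∀ lo n (f : ℕ → ℚ) → ∑ [ lo , lo ℕ.+ n ⟩ f ≡ (∑[ i ← upTo n ] f (lo ℕ.+ i))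
∑-interval lo n f = trans (cong (λ k → ∑ (applyUpTo (lo ℕ.+_) k) f) (ℕ.m+n∸m≡n lo n))
                          (∑-applyUpTo (lo ℕ.+_) n f)

∑-interval-empty : ∀ n (f : ℕ → ℚ) → ∑ [ n , n ⟩ f ≡ 0ℚ
∑-interval-empty n f = cong (λ k → ∑ (applyUpTo (n ℕ.+_) k) f) (ℕ.n∸n≡0 n)

∑-interval-children : ∀ b lo n (f : ℕ → ℚ) →
  (∑[ p ← [ lo , lo ℕ.+ n ⟩ ] ∑[ a ← upTo b ] f (a ℕ.+ p ℕ.* b)) ≡ ∑ [ lo ℕ.* b , (lo ℕ.+ n) ℕ.* b ⟩ f
∑-interval-children b lo zero f = begin
  ∑ [ lo , lo ℕ.+ 0 ⟩ children                ≡⟨ ∑-interval lo 0 children ⟩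
  0ℚ                                          ≡⟨ ∑-interval-empty (lo ℕ.* b) f ⟨
  ∑ [ lo ℕ.* b , lo ℕ.* b ⟩ f                 ≡⟨ cong (λ k → ∑ [ lo ℕ.* b , k ℕ.* b ⟩ f) (ℕ.+-identityʳ lo) ⟨
  ∑ [ lo ℕ.* b , (lo ℕ.+ 0) ℕ.* b ⟩ f         ∎
  where
  open ≡-Reasoning
  children : ℕ → ℚ
  children p = ∑[ a ← upTo b ] f (a ℕ.+ p ℕ.* b)
∑-interval-children b lo (suc n) f = begin
  ∑ [ lo , lo ℕ.+ suc n ⟩ children
    ≡⟨ trans (∑-interval lo (suc n) children) (∑-upTo-last n (λ i → children (lo ℕ.+ i))) ⟩
  (∑[ i ← upTo n ] children (lo ℕ.+ i)) + children p
    ≡⟨ cong₂ _+_ (trans (sym (∑-interval lo n children)) (∑-interval-children b lo n f)) last ⟩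
  ∑ [ lo ℕ.* b , p ℕ.* b ⟩ f + ∑ [ p ℕ.* b , (lo ℕ.+ suc n) ℕ.* b ⟩ f
    ≡⟨ ∑-interval-split (ℕ.*-monoˡ-≤ b (ℕ.m≤m+n lo n)) (ℕ.*-monoˡ-≤ b (ℕ.+-monoʳ-≤ lo (ℕ.n≤1+n n))) f ⟨
  ∑ [ lo ℕ.* b , (lo ℕ.+ suc n) ℕ.* b ⟩ f ∎
  where
  open ≡-Reasoning
  p = lo ℕ.+ n
  children : ℕ → ℚ
  children p = ∑[ a ← upTo b ] f (a ℕ.+ p ℕ.* b)
  last : children p ≡ ∑ [ p ℕ.* b , (lo ℕ.+ suc n) ℕ.* b ⟩ f
  last = begin
    children p                                     ≡⟨ ∑-cong (upTo b) (λ {a} _ → cong f (ℕ.+-comm a (p ℕ.* b))) ⟩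
    (∑[ a ← upTo b ] f (p ℕ.* b ℕ.+ a))            ≡⟨ ∑-interval (p ℕ.* b) b f ⟨
    ∑ [ p ℕ.* b , p ℕ.* b ℕ.+ b ⟩ f                ≡⟨ cong (λ k → ∑ [ p ℕ.* b , k ⟩ f)
                                                        (trans (ℕ.+-comm (p ℕ.* b) b) (cong (ℕ._* b) (sym (ℕ.+-suc lo n)))) ⟩
    ∑ [ p ℕ.* b , (lo ℕ.+ suc n) ℕ.* b ⟩ f         ∎

∑-interval-mono-≤ : ∀ {f : ℕ → ℚ} → (∀ n → 0ℚ ℚ.≤ f n) → ∀ {lo x y} → lo ≤ x → x ≤ y →
                    ∑ [ lo , x ⟩ f ℚ.≤ ∑ [ lo , y ⟩ f
∑-interval-mono-≤ {f} 0≤f {lo} {x} {y} lo≤x x≤y = begin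
  ∑ [ lo , x ⟩ f                        ≡⟨ ℚ.+-identityʳ _ ⟨
  ∑ [ lo , x ⟩ f + 0ℚ                   ≤⟨ ℚ.+-monoʳ-≤ (∑ [ lo , x ⟩ f) (∑-nonNeg [ x , y ⟩ λ {n} _ → 0≤f n) ⟩
  ∑ [ lo , x ⟩ f + ∑ [ x , y ⟩ f        ≡⟨ ∑-interval-split lo≤x x≤y f ⟨
  ∑ [ lo , y ⟩ f                        ∎
  where open ℚ.≤-Reasoning

-- The kernels y ↦ 1/(p + 1 − y)

kernel : ℕ → ℚ → ℚ
kernel p y = inv (ι (suc p) - y)

1≤gap : ∀ {p y} → 1 ≤ p → y ℚ.≤ 1ℚ → 1ℚ ℚ.≤ ι (suc p) - y
1≤gap {p} {y} 1≤p y≤1 = begin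
  ι 1                 ≤⟨ ι-mono-≤ 1≤p ⟩
  ι p                 ≡⟨ solve 1 (λ p → p := con 1ℚ :+ p :- con 1ℚ) refl (ι p) ⟩
  1ℚ + ι p - 1ℚ       ≡⟨ cong (_- 1ℚ) (ι-suc p) ⟨
  ι (suc p) - 1ℚ      ≤⟨ ℚ.+-monoʳ-≤ (ι (suc p)) (ℚ.neg-antimono-≤ y≤1) ⟩
  ι (suc p) - y       ∎
  where open ℚ.≤-Reasoning

ρ : ℕ → ℕ → ℚ
ρ p m = recip (suc p ^ m)

module _ {p : ℕ} (1≤p : 1 ≤ p) where

  0<gap : ∀ {y} → y ℚ.≤ 1ℚ → 0ℚ ℚ.< ι (suc p) - y
  0<gap y≤1 = ℚ.<-≤-trans 0<1 (1≤gap 1≤p y≤1)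

  *-kernel : ∀ {y} → y ℚ.≤ 1ℚ → (ι (suc p) - y) * kernel p y ≡ 1ℚ
  *-kernel y≤1 = *-inv (0<gap y≤1)

  kernel-unique : ∀ {y x} → y ℚ.≤ 1ℚ → (ι (suc p) - y) * x ≡ 1ℚ → kernel p y ≡ x
  kernel-unique y≤1 eq = *-cancelˡ-≡ (0<gap y≤1) (trans (*-kernel y≤1) (sym eq))

  kernel-nonNeg : ∀ {y} → y ℚ.≤ 1ℚ → 0ℚ ℚ.≤ kernel p y
  kernel-nonNeg {y} y≤1 = *-cancelˡ-≤ (0<gap y≤1) (subst₂ ℚ._≤_ (sym (ℚ.*-zeroʳ (ι (suc p) - y)))
    (sym (*-kernel y≤1)) (ℚ.<⇒≤ 0<1))

  kernel≤1 : ∀ {y} → y ℚ.≤ 1ℚ → kernel p y ℚ.≤ 1ℚ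
  kernel≤1 {y} y≤1 = begin
    kernel p y                          ≡⟨ ℚ.*-identityˡ (kernel p y) ⟨
    1ℚ * kernel p y                     ≤⟨ *-mono-≤ (ℚ.<⇒≤ 0<1) (kernel-nonNeg y≤1) (1≤gap 1≤p y≤1) ℚ.≤-refl ⟩
    (ι (suc p) - y) * kernel p y        ≡⟨ *-kernel y≤1 ⟩
    1ℚ                                  ∎
    where open ℚ.≤-Reasoning

  kernel-1 : kernel p 1ℚ ≡ recip p
  kernel-1 = kernel-unique ℚ.≤-refl (trans (cong (_* recip p)
    (trans (cong (_- 1ℚ) (ι-suc p)) (solve 1 (λ p → con 1ℚ :+ p :- con 1ℚ := p) refl (ι p)))) (*-recip 1≤p))

  ρ-suc : ∀ m → ρ p m ≡ ι (suc p) * ρ p (suc m)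
  ρ-suc m = recip-scale {suc p} {suc p ^ m} ℕ.z<s (ℕ.m^n>0 (suc p) m)

  ρ-nonNeg : ∀ m → 0ℚ ℚ.≤ ρ p m
  ρ-nonNeg m = recip-nonNeg (suc p ^ m)

  ρ≤½^ : ∀ m → ρ p m ℚ.≤ ½ ^ℚ m
  ρ≤½^ zero    = ℚ.≤-refl
  ρ≤½^ (suc m) = *-cancelˡ-≤ (ι-pos {suc p} ℕ.z<s) (begin
    ι (suc p) * ρ p (suc m)         ≡⟨ ρ-suc m ⟨
    ρ p m                           ≤⟨ ρ≤½^ m ⟩
    ½ ^ℚ m                        ≡⟨ solve 1 (λ x → x := con (ι 2) :* (con ½ :* x)) refl (½ ^ℚ m) ⟩
    ι 2 * ½ ^ℚ suc m              ≤⟨ *-mono-≤ (ι-nonNeg 2) (^ℚ-nonNeg (ℚ.nonNegative⁻¹ ½) (suc m))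
                                       (ι-mono-≤ (s≤s 1≤p)) ℚ.≤-refl ⟩
    ι (suc p) * ½ ^ℚ suc m        ∎)
    where open ℚ.≤-Reasoning

  -- Finite geometric series with its exact remainder. Exactness gives both one-sided bounds later:
  -- dropping the remainder bounds the kernel from below, estimating it bounds the kernel from
  -- above.
  kernel-expansion : ∀ M {y} → y ℚ.≤ 1ℚ →
    kernel p y ≡ (∑[ m ← upTo M ] ρ p (suc m) * y ^ℚ m) + ρ p M * (y ^ℚ M * kernel p y)
  kernel-expansion zero {y} y≤1 = solve 1 (λ x → x := con 0ℚ :+ con 1ℚ :* (con 1ℚ :* x)) refl (kernel p y)
  kernel-expansion (suc M) {y} y≤1 = begin
    K
      ≡⟨ kernel-expansion M y≤1 ⟩
    S + ρ p M * (y ^ℚ M * K)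
      ≡⟨ cong (λ t → S + t * (y ^ℚ M * K)) (ρ-suc M) ⟩
    S + ι (suc p) * ρ p (suc M) * (y ^ℚ M * K)
      ≡⟨ solve 6 (λ S n ρ y q K → S :+ n :* ρ :* (q :* K) :=
                                (S :+ ρ :* q :* ((n :- y) :* K)) :+ ρ :* (y :* q :* K)) refl
           S (ι (suc p)) (ρ p (suc M)) y (y ^ℚ M) K ⟩
    (S + ρ p (suc M) * y ^ℚ M * ((ι (suc p) - y) * K)) + ρ p (suc M) * (y ^ℚ suc M * K)
      ≡⟨ cong (λ t → (S + t) + ρ p (suc M) * (y ^ℚ suc M * K))
           (trans (cong (ρ p (suc M) * y ^ℚ M *_) (*-kernel y≤1)) (ℚ.*-identityʳ _)) ⟩
    (S + ρ p (suc M) * y ^ℚ M) + ρ p (suc M) * (y ^ℚ suc M * K)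
      ≡⟨ cong (_+ ρ p (suc M) * (y ^ℚ suc M * K)) (∑-upTo-last M (λ m → ρ p (suc m) * y ^ℚ m)) ⟨
    (∑[ m ← upTo (suc M) ] ρ p (suc m) * y ^ℚ m) + ρ p (suc M) * (y ^ℚ suc M * K) ∎
    where
    open ≡-Reasoning
    K = kernel p y
    S = ∑[ m ← upTo M ] ρ p (suc m) * y ^ℚ m

  -- The expansion at y = 1, with the nonnegative remainder dropped.
  ∑ρ≤1 : ∀ M → (∑[ m ← upTo M ] ρ p (suc m)) ℚ.≤ 1ℚ
  ∑ρ≤1 M = begin
    (∑[ m ← upTo M ] ρ p (suc m))
      ≡⟨ ∑-cong (upTo M) (λ {m} _ → trans (cong (ρ p (suc m) *_) (1^ m)) (ℚ.*-identityʳ (ρ p (suc m)))) ⟨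
    (∑[ m ← upTo M ] ρ p (suc m) * 1ℚ ^ℚ m)
      ≡⟨ ℚ.+-identityʳ _ ⟨
    (∑[ m ← upTo M ] ρ p (suc m) * 1ℚ ^ℚ m) + 0ℚ
      ≤⟨ ℚ.+-monoʳ-≤ (∑[ m ← upTo M ] ρ p (suc m) * 1ℚ ^ℚ m) (*-nonNeg (ρ-nonNeg M)
           (*-nonNeg (^ℚ-nonNeg (ℚ.<⇒≤ 0<1) M) (kernel-nonNeg ℚ.≤-refl))) ⟩
    (∑[ m ← upTo M ] ρ p (suc m) * 1ℚ ^ℚ m) + ρ p M * (1ℚ ^ℚ M * kernel p 1ℚ)
      ≡⟨ kernel-expansion M ℚ.≤-refl ⟨
    kernel p 1ℚ
      ≤⟨ kernel≤1 ℚ.≤-refl ⟩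
    1ℚ ∎
    where open ℚ.≤-Reasoning

-- The total of `g` over the b-ary tree below p: p itself and everything obtained from p by
-- appending fewer than R digits.
descend : ℕ → (ℕ → ℚ) → ℕ → ℕ → ℚ
descend b g zero    p = 0ℚ
descend b g (suc R) p = g p + (∑[ a ← upTo b ] descend b g R (a ℕ.+ p ℕ.* b))

-- Appending one digit carries the integers with l + 1 digits onto those with l + 2 digits, so
-- consecutive levels of the trees are consecutive intervals.
∑-descend : ∀ b .{{_ : ℕ.NonZero b}} (g : ℕ → ℚ) R l → ∑ [ b ^ l , b ^ suc l ⟩ (descend b g R) ≡ ∑ [ b ^ l , b ^ (l ℕ.+ R) ⟩ g
∑-descend b g zero    l = trans (∑-zero [ b ^ l , b ^ suc l ⟩)
  (sym (trans (cong (λ k → ∑ [ b ^ l , b ^ k ⟩ g) (ℕ.+-identityʳ l)) (∑-interval-empty (b ^ l) g)))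
∑-descend b g (suc R) l = begin
  (∑[ p ← [ b ^ l , b ^ suc l ⟩ ] (g p + children p))
    ≡⟨ ∑-distrib-+ [ b ^ l , b ^ suc l ⟩ g children ⟩
  ∑ [ b ^ l , b ^ suc l ⟩ g + ∑ [ b ^ l , b ^ suc l ⟩ children
    ≡⟨ cong (_+_ (∑ [ b ^ l , b ^ suc l ⟩ g)) below ⟩
  ∑ [ b ^ l , b ^ suc l ⟩ g + ∑ [ b ^ suc l , b ^ (suc l ℕ.+ R) ⟩ g
    ≡⟨ ∑-interval-split (ℕ.^-monoʳ-≤ b (ℕ.n≤1+n l)) (ℕ.^-monoʳ-≤ b (ℕ.m≤m+n (suc l) R)) g ⟨
  ∑ [ b ^ l , b ^ (suc l ℕ.+ R) ⟩ g
    ≡⟨ cong (λ k → ∑ [ b ^ l , b ^ k ⟩ g) (ℕ.+-suc l R) ⟨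
  ∑ [ b ^ l , b ^ (l ℕ.+ suc R) ⟩ g ∎
  where
  open ≡-Reasoning
  children : ℕ → ℚ
  children p = ∑[ a ← upTo b ] descend b g R (a ℕ.+ p ℕ.* b)
  below : ∑ [ b ^ l , b ^ suc l ⟩ children ≡ ∑ [ b ^ suc l , b ^ (suc l ℕ.+ R) ⟩ g
  below = begin
    ∑ [ b ^ l , b ^ suc l ⟩ children
      ≡⟨ cong (λ k → ∑ [ b ^ l , k ⟩ children) hi ⟨
    ∑ [ b ^ l , b ^ l ℕ.+ (b ^ suc l ∸ b ^ l) ⟩ children
      ≡⟨ ∑-interval-children b (b ^ l) (b ^ suc l ∸ b ^ l) (descend b g R) ⟩
    ∑ [ b ^ l ℕ.* b , (b ^ l ℕ.+ (b ^ suc l ∸ b ^ l)) ℕ.* b ⟩ (descend b g R)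
      ≡⟨ cong₂ (λ x y → ∑ [ x , y ⟩ (descend b g R)) (ℕ.*-comm (b ^ l) b)
           (trans (cong (ℕ._* b) hi) (ℕ.*-comm (b ^ suc l) b)) ⟩
    ∑ [ b ^ suc l , b ^ suc (suc l) ⟩ (descend b g R)
      ≡⟨ ∑-descend b g R (suc l) ⟩
    ∑ [ b ^ suc l , b ^ (suc l ℕ.+ R) ⟩ g ∎
    where
    hi : b ^ l ℕ.+ (b ^ suc l ∸ b ^ l) ≡ b ^ suc l
    hi = ℕ.m+[n∸m]≡n (ℕ.^-monoʳ-≤ b (ℕ.n≤1+n l))

if-yes : ∀ {p} {P : Set p} (P? : Dec P) → P → ∀ {x y : ℚ} → (if does P? then x else y) ≡ x
if-yes (yes _) _ = refl
if-yes (no ¬p) p = contradiction p ¬p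

if-no : ∀ {p} {P : Set p} (P? : Dec P) → ¬ P → ∀ {x y : ℚ} → (if does P? then x else y) ≡ y
if-no (yes p) ¬p = contradiction p ¬p
if-no (no _)  _  = refl

-- The recurrences as operator equations, and a comparison principle

module Recurrence (b : ℕ) .{{nt : NonTrivial b}} (d : Digit b) where

  open Irwin b d

  β : ℚ
  β = ι b

  others : List ℕ
  others = filter (λ a → ¬? (a ≟ d′)) (upTo b)

  private

    instance
      b≢0 : ℕ.NonZero b
      b≢0 = ℕ.nonTrivial⇒nonZero b

  1<b : 1 < b
  1<b = ℕ.nonTrivial⇒n>1 b

  0<b : 0 < b
  0<b = ℕ.<-trans ℕ.z<s 1<b

  d′<b : d′ < b
  d′<b = ℕ.≤-<-trans (ℕ.m∸n≤m (b ∸ 1) (toℕ d)) (ℕ.≤-reflexive (ℕ.m+[n∸m]≡n 0<b))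

  others<b : ∀ {a} → a ∈ others → a < b
  others<b a∈ = ∈-upTo⁻ (proj₁ (∈-filter⁻ (λ a → ¬? (a ≟ d′)) {xs = upTo b} a∈))

  ∈-others : ∀ {a} → a < b → a ≢ d′ → a ∈ others
  ∈-others a<b a≢d′ = ∈-filter⁺ (λ a → ¬? (a ≟ d′)) (∈-upTo⁺ a<b) a≢d′

  ι-b^suc : ∀ m → ι (b ^ suc m) ≡ β * ι (b ^ m)
  ι-b^suc m = ι-* b (b ^ m)

  0<ι-b^ : ∀ m → 0ℚ ℚ.< ι (b ^ m)
  0<ι-b^ m = ι-pos (ℕ.m^n>0 b m)

  0≤β : 0ℚ ℚ.≤ β
  0≤β = ι-nonNeg b

  β≤b^suc : ∀ m → β ℚ.≤ ι (b ^ suc m)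
  β≤b^suc m = ι-mono-≤ (subst (b ℕ.≤_) refl (ℕ.m≤m*n b (b ^ m) {{ℕ.m^n≢0 b m}}))

  ι-suc^≤ : ∀ {a} → a < b → ∀ m → ι (suc a ^ m) ℚ.≤ ι (b ^ m)
  ι-suc^≤ a<b m = ι-mono-≤ (ℕ.^-monoˡ-≤ m a<b)

  ∑-others-const : ∀ x → x + ∑ others (λ _ → x) ≡ β * x
  ∑-others-const x = trans (∑-upTo-remove d′<b (λ _ → x)) (∑-upTo-const b x)

  ∑-others-suc^ : ∀ m → ι (b ^ m) + (∑[ a ← others ] ι (suc a ^ m)) ℚ.≤ β * ι (b ^ m)
  ∑-others-suc^ m = ℚ.≤-trans
    (ℚ.+-monoʳ-≤ (ι (b ^ m)) (∑-mono-≤ others λ a∈ → ι-suc^≤ (others<b a∈) m))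
    (ℚ.≤-reflexive (∑-others-const (ι (b ^ m))))

  -- In moment terms the sum of L(f(a + y)) over the digits a other than d′, that is, over the
  -- branches that leave the count j unchanged.
  T : (ℕ → ℚ) → ℕ → ℚ
  T u m = ∑[ a ← others ] translate (ι a) u m

  T-- : ∀ u w m → T (λ n → u n - w n) m ≡ T u m - T w m
  T-- u w m = trans (∑-cong others λ {a} _ → translate-- (ι a) u w m)
    (∑-distrib-- others (λ a → translate (ι a) u m) (λ a → translate (ι a) w m))

  T-* : ∀ c u m → T (λ n → c * u n) m ≡ c * T u m
  T-* c u m = trans (∑-cong others λ {a} _ → translate-* (ι a) c u m)
    (∑-*ˡ others c (λ a → translate (ι a) u m))

  T-const : ∀ c m → T (λ _ → c) m ≡ c * (∑[ a ← others ] ι (suc a ^ m))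
  T-const c m = trans (∑-cong others λ {a} _ → translate-const a c m)
    (∑-*ˡ others c (λ a → ι (suc a ^ m)))

  -- The i = 0 terms of the binomial expansions give one copy of `u m` per digit, b - 1 in all; the
  -- terms with i ≥ 1 collect into the power sums γ′ once the two sums are exchanged.
  T-γ′ : ∀ u m → T u m ≡ ∑ others (λ _ → u m) + γ′-sum u m
  T-γ′ u m = begin
    T u m
      ≡⟨ ∑-cong others (λ {a} _ → trans (translate-binomial a u m) (∑-upTo-first m (term a))) ⟩
    (∑[ a ← others ] (1ℚ * u m + ∑ (upTo m) (term a ∘ suc)))
      ≡⟨ ∑-distrib-+ others (λ _ → 1ℚ * u m) (λ a → ∑ (upTo m) (term a ∘ suc)) ⟩
    ∑ others (λ _ → 1ℚ * u m) + (∑[ a ← others ] ∑ (upTo m) (term a ∘ suc))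
      ≡⟨ cong₂ _+_ (∑-cong others λ _ → ℚ.*-identityˡ (u m)) (∑-comm others (upTo m) (λ a → term a ∘ suc)) ⟩
    ∑ others (λ _ → u m) + (∑[ i ← upTo m ] ∑[ a ← others ] term a (suc i))
      ≡⟨ cong (_+_ (∑ others (λ _ → u m))) (∑-cong (upTo m) λ {i} _ → trans
           (∑-*ʳ others (λ a → ι ((m C suc i) ℕ.* a ^ suc i)) (u (m ∸ suc i)))
           (cong (_* u (m ∸ suc i)) (sym (ι-*-sum (m C suc i) (_^ suc i) others)))) ⟩
    ∑ others (λ _ → u m) + (∑[ i ← upTo m ] ι ((m C suc i) ℕ.* γ′ (suc i)) * u (m ∸ suc i))
      ≡⟨ cong (_+_ (∑ others (λ _ → u m)))
           (∑-applyUpTo suc m (λ i → ι ((m C i) ℕ.* γ′ i) * u (m ∸ i))) ⟨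
    ∑ others (λ _ → u m) + γ′-sum u m ∎
    where
    open ≡-Reasoning
    term : ℕ → ℕ → ℚ
    term a i = ι ((m C i) ℕ.* a ^ i) * u (m ∸ i)

  source : ℕ → ℕ → ℚ
  source j m = prev (ι (b ^ suc m)) (λ i → translate (ι d′) (v i) m) j

  -- Adding b - 1 copies of `v j m` to both sides turns the coefficient b^(m+1) - b + 1 into
  -- b^(m+1). What results is the self-similarity equation of the measure under splitting off the
  -- first digit.
  v-rec : ∀ j m → ι (b ^ suc m) * v j m ≡ source j m + T (v j) m
  v-rec j m = begin
    ι (b ^ suc m) * v j m
      ≡⟨ expand (ι (b ^ suc m)) β (v j m) (∑ others (λ _ → v j m)) (sym (∑-others-const (v j m))) ⟩
    (ι (b ^ suc m) - β + 1ℚ) * v j m + ∑ others (λ _ → v j m)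
      ≡⟨ cong (_+ ∑ others (λ _ → v j m)) (rec j) ⟩
    source j m + γ′-sum (v j) m + ∑ others (λ _ → v j m)
      ≡⟨ regroup (source j m) (γ′-sum (v j) m) (∑ others (λ _ → v j m)) ⟩
    source j m + (∑ others (λ _ → v j m) + γ′-sum (v j) m)
      ≡⟨ cong (_+_ (source j m)) (T-γ′ (v j) m) ⟨
    source j m + T (v j) m ∎
    where
    open ≡-Reasoning
    rec : ∀ j → (ι (b ^ suc m) - β + 1ℚ) * v j m ≡ source j m + γ′-sum (v j) m
    rec zero    = v-rec-zero m
    rec (suc j) = trans (v-rec-suc j m) (trans (ℚ.+-comm (γ′-sum (v (suc j)) m) (d′-sum (v j) m))
      (cong (_+ γ′-sum (v (suc j)) m) (sym (translate-binomial d′ (v j) m))))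
    expand : ∀ B β x s → β * x ≡ x + s → B * x ≡ (B - β + 1ℚ) * x + s
    expand B β x s eq = trans (split B β x) (trans (cong (λ t → (B - β + 1ℚ) * x + (t - x)) eq) (cancel B β x s))
      where
      split : ∀ B β x → B * x ≡ (B - β + 1ℚ) * x + (β * x - x)
      split = solve 3 (λ B β x → B :* x := (B :- β :+ con 1ℚ) :* x :+ (β :* x :- x)) refl
      cancel : ∀ B β x s → (B - β + 1ℚ) * x + (x + s - x) ≡ (B - β + 1ℚ) * x + s
      cancel = solve 4 (λ B β x s → (B :- β :+ con 1ℚ) :* x :+ (x :+ s :- x) := (B :- β :+ con 1ℚ) :* x :+ s) refl
    regroup : ∀ p q r → p + q + r ≡ p + (r + q)
    regroup = solve 3 (λ p q r → p :+ q :+ r := p :+ (r :+ q)) refl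

  -- T u m is ∑ₐ u m plus a nonnegative combination of u 0, …, u (m ∸ 1); with only
  -- b ∸ 1 summands, the term u m can be absorbed in the left-hand side.
  module Comparison {u c B : ℕ → ℚ} (β≤B : ∀ m → β ℚ.≤ B m) (0≤c : ∀ m → 0ℚ ℚ.≤ c m)
                    (super : ∀ m → c m + T u m ℚ.≤ B m * u m) where

    private

      0<B-β+1 : ∀ m → 0ℚ ℚ.< B m - β + 1ℚ
      0<B-β+1 m = ℚ.+-mono-≤-< (p≤q⇒0≤q-p (β≤B m)) 0<1

      c≤[B-β+1]*u : ∀ m → (∀ n → n < m → 0ℚ ℚ.≤ u n) → c m ℚ.≤ (B m - β + 1ℚ) * u m
      c≤[B-β+1]*u m 0≤u = 0≤q-p⇒p≤q (subst (0ℚ ℚ.≤_) (trans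
          (cong (λ t → B m * u m - (c m + (t - u m))) (∑-others-const (u m)))
          (regroup (B m) β (u m) (c m)))
        (p≤q⇒0≤q-p (ℚ.≤-trans (ℚ.+-monoʳ-≤ (c m) below) (super m))))
        where
        below : u m + ∑ others (λ _ → u m) - u m ℚ.≤ T u m
        below = subst (ℚ._≤ T u m) (solve 2 (λ x s → s := x :+ s :- x) refl (u m) (∑ others (λ _ → u m)))
          (∑-mono-≤ others λ {a} _ → u[m]≤translate (ι-nonNeg a) m 0≤u)
        regroup : ∀ B β x c → B * x - (c + (β * x - x)) ≡ (B - β + 1ℚ) * x - c
        regroup = solve 4 (λ B β x c → B :* x :- (c :+ (β :* x :- x)) := (B :- β :+ con 1ℚ) :* x :- c) refl

    nonNeg : ∀ m → 0ℚ ℚ.≤ u m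
    nonNeg = <-rec _ λ m 0≤u → *-cancelˡ-≤ (0<B-β+1 m) (subst (ℚ._≤ (B m - β + 1ℚ) * u m)
      (sym (ℚ.*-zeroʳ (B m - β + 1ℚ))) (ℚ.≤-trans (0≤c m) (c≤[B-β+1]*u m λ n n<m → 0≤u n<m)))

    pos : ∀ {m} → 0ℚ ℚ.< c m → 0ℚ ℚ.< u m
    pos {m} 0<c = *-cancelˡ-< (0<B-β+1 m) (subst (ℚ._< (B m - β + 1ℚ) * u m)
      (sym (ℚ.*-zeroʳ (B m - β + 1ℚ))) (ℚ.<-≤-trans 0<c (c≤[B-β+1]*u m λ n _ → nonNeg n)))

  -- Positivity of v, the upper bound b, and the values at m = 0

  -- Induction on j, jointly with the source: the source at j + 1 is a translate of `v j`, hence at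
  -- least `v j m`.
  v-pos : ∀ j m → 0ℚ ℚ.< v j m
  source-pos : ∀ j m → 0ℚ ℚ.< source j m

  v-pos j m = Comparison.pos {v j} {source j} {λ n → ι (b ^ suc n)} β≤b^suc (λ n → ℚ.<⇒≤ (source-pos j n))
    (λ n → ℚ.≤-reflexive (sym (v-rec j n))) {m} (source-pos j m)

  source-pos zero    m = 0<ι-b^ (suc m)
  source-pos (suc j) m = ℚ.<-≤-trans (v-pos j m)
    (u[m]≤translate (ι-nonNeg d′) m λ n _ → ℚ.<⇒≤ (v-pos j n))

  v-nonNeg : ∀ j m → 0ℚ ℚ.≤ v j m
  v-nonNeg j m = ℚ.<⇒≤ (v-pos j m)

  -- The constant β is a supersolution, since (a + 1)^m ≤ b^m for each of the b digits a; the
  -- comparison principle is applied to β - `v j`, with the bound on the source supplied by j - 1.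
  v≤β : ∀ j m → v j m ℚ.≤ β
  source≤ : ∀ j m → source j m ℚ.≤ β * ι (b ^ m)

  source≤ zero    m = ℚ.≤-reflexive (ι-b^suc m)
  source≤ (suc j) m = begin
    translate (ι d′) (v j) m           ≤⟨ translate-mono-≤ (ι-nonNeg d′) m (v≤β j) ⟩
    translate (ι d′) (λ _ → β) m       ≡⟨ translate-const d′ β m ⟩
    β * ι (suc d′ ^ m)                 ≤⟨ *-monoʳ-≤ 0≤β (ι-suc^≤ d′<b m) ⟩
    β * ι (b ^ m)                      ∎
    where open ℚ.≤-Reasoning

  v≤β j m = 0≤q-p⇒p≤q (Comparison.nonNeg {λ n → β - v j n} {λ n → β * ι (b ^ n) - source j n}
    {λ n → ι (b ^ suc n)} β≤b^suc (λ n → p≤q⇒0≤q-p (source≤ j n)) super m)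
    where
    super : ∀ n → β * ι (b ^ n) - source j n + T (λ n → β - v j n) n ℚ.≤ ι (b ^ suc n) * (β - v j n)
    super n = begin
      β * ι (b ^ n) - source j n + T (λ n → β - v j n) n
        ≡⟨ cong (_+_ (β * ι (b ^ n) - source j n))
             (trans (T-- (λ _ → β) (v j) n) (cong (_- T (v j) n) (T-const β n))) ⟩
      β * ι (b ^ n) - source j n + (β * S - T (v j) n)
        ≡⟨ regroup β (ι (b ^ n)) S (source j n) (T (v j) n) ⟩
      β * (ι (b ^ n) + S) - (source j n + T (v j) n)
        ≤⟨ ℚ.+-monoˡ-≤ (- (source j n + T (v j) n)) (*-monoʳ-≤ 0≤β (∑-others-suc^ n)) ⟩
      β * (β * ι (b ^ n)) - (source j n + T (v j) n)
        ≡⟨ cong₂ (λ s t → β * s - t) (sym (ι-b^suc n)) (sym (v-rec j n)) ⟩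
      β * ι (b ^ suc n) - ι (b ^ suc n) * v j n
        ≡⟨ factor β (ι (b ^ suc n)) (v j n) ⟩
      ι (b ^ suc n) * (β - v j n) ∎
      where
      open ℚ.≤-Reasoning
      S = ∑[ a ← others ] ι (suc a ^ n)
      regroup : ∀ β p s x t → β * p - x + (β * s - t) ≡ β * (p + s) - (x + t)
      regroup = solve 5 (λ β p s x t → β :* p :- x :+ (β :* s :- t) := β :* (p :+ s) :- (x :+ t)) refl
      factor : ∀ β B x → β * B - B * x ≡ B * (β - x)
      factor = solve 3 (λ β B x → β :* B :- B :* x := B :* (β :- x)) refl

  -- At m = 0 the equation reads b x = source + (b - 1) x, so x equals the source, and the source at
  -- j + 1 is the value at j.
  v[j,0]≡β : ∀ j → v j 0 ≡ β
  v[j,0]≡β j = trans (sym (cancel (source j 0) (v j 0) _ (trans (trans (∑-others-const (v j 0))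
      (cong (λ n → ι n * v j 0) (sym (ℕ.^-identityʳ b)))) (v-rec j 0)))) (source-0 j)
    where
    cancel : ∀ s x t → x + t ≡ s + t → s ≡ x
    cancel s x t eq = trans (sym (drop s t)) (trans (cong (_- t) (sym eq)) (drop x t))
      where
      drop : ∀ s t → s + t - t ≡ s
      drop = solve 2 (λ s t → s :+ t :- t := s) refl
    source-0 : ∀ j → source j 0 ≡ β
    source-0 zero    = cong ι (ℕ.^-identityʳ b)
    source-0 (suc j) = v[j,0]≡β j

  -- Monotonicity in m

  Δₘ : ℕ → ℕ → ℚ
  Δₘ j m = v j m - v j (suc m)

  -- For the digit map y ↦ (a + y)/b one has b(1 - (a + y)/b) = (b - 1 - a) + (1 - y). The part 1 -
  -- y reproduces `Δₘ`; this sum collects the parts b - 1 - a, which are positive except for the top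
  -- digit.
  excess : ℕ → ℕ → ℚ
  excess j m = ∑[ a ← others ] (β - ι (suc a)) * translate (ι a) (v j) m

  Δₘ-source : ℕ → ℕ → ℚ
  Δₘ-source j m = β * source j m - source j (suc m)

  translate-Δₘ : ∀ a j m → translate (ι a) (Δₘ j) m ≡
                   ι (suc a) * translate (ι a) (v j) m - translate (ι a) (v j) (suc m)
  translate-Δₘ a j m = begin
    translate (ι a) (Δₘ j) m
      ≡⟨ translate-- (ι a) (v j) (v j ∘ suc) m ⟩
    t - translate (ι a) (v j ∘ suc) m
      ≡⟨ cong (λ s → t - s) (translate-suc (ι a) (v j) m) ⟩
    t - (translate (ι a) (v j) (suc m) - ι a * t)
      ≡⟨ regroup (ι a) t (translate (ι a) (v j) (suc m)) ⟩
    (1ℚ + ι a) * t - translate (ι a) (v j) (suc m)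
      ≡⟨ cong (λ s → s * t - translate (ι a) (v j) (suc m)) (ι-suc a) ⟨
    ι (suc a) * t - translate (ι a) (v j) (suc m) ∎
    where
    open ≡-Reasoning
    t = translate (ι a) (v j) m
    regroup : ∀ a p q → p - (q - a * p) ≡ (1ℚ + a) * p - q
    regroup = solve 3 (λ a p q → p :- (q :- a :* p) := (con 1ℚ :+ a) :* p :- q) refl

  β-Δₘ : ∀ a j m → (β - ι (suc a)) * translate (ι a) (v j) m + translate (ι a) (Δₘ j) m ≡
           β * translate (ι a) (v j) m - translate (ι a) (v j) (suc m)
  β-Δₘ a j m = trans (cong (_+_ ((β - ι (suc a)) * translate (ι a) (v j) m)) (translate-Δₘ a j m))
    (regroup β (ι (suc a)) (translate (ι a) (v j) m) (translate (ι a) (v j) (suc m)))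
    where
    regroup : ∀ β s p q → (β - s) * p + (s * p - q) ≡ β * p - q
    regroup = solve 4 (λ β s p q → (β :- s) :* p :+ (s :* p :- q) := β :* p :- q) refl

  -- b times the recurrence at m minus the recurrence at m + 1. Both left-hand sides then carry
  -- b^(m+2), which is why the comparison principle is stated for a general coefficient.
  Δₘ-rec : ∀ j m → Δₘ-source j m + excess j m + T (Δₘ j) m ≡ ι (b ^ suc (suc m)) * Δₘ j m
  Δₘ-rec j m = begin
    Δₘ-source j m + excess j m + T (Δₘ j) m
      ≡⟨ ℚ.+-assoc (Δₘ-source j m) (excess j m) (T (Δₘ j) m) ⟩
    Δₘ-source j m + (excess j m + T (Δₘ j) m)
      ≡⟨ cong (_+_ (Δₘ-source j m)) (trans
           (sym (∑-distrib-+ others (λ a → (β - ι (suc a)) * translate (ι a) (v j) m) (λ a → translate (ι a) (Δₘ j) m)))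
           (trans (∑-cong others λ {a} _ → β-Δₘ a j m)
           (trans (∑-distrib-- others (λ a → β * translate (ι a) (v j) m) (λ a → translate (ι a) (v j) (suc m)))
                  (cong (_- T (v j) (suc m)) (∑-*ˡ others β (λ a → translate (ι a) (v j) m)))))) ⟩
    Δₘ-source j m + (β * T (v j) m - T (v j) (suc m))
      ≡⟨ regroup β (source j m) (source j (suc m)) (T (v j) m) (T (v j) (suc m)) ⟩
    β * (source j m + T (v j) m) - (source j (suc m) + T (v j) (suc m))
      ≡⟨ cong₂ (λ s t → β * s - t) (sym (v-rec j m)) (sym (v-rec j (suc m))) ⟩
    β * (ι (b ^ suc m) * v j m) - ι (b ^ suc (suc m)) * v j (suc m)
      ≡⟨ cong (λ B → β * (ι (b ^ suc m) * v j m) - B * v j (suc m)) (ι-b^suc (suc m)) ⟩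
    β * (ι (b ^ suc m) * v j m) - β * ι (b ^ suc m) * v j (suc m)
      ≡⟨ factor β (ι (b ^ suc m)) (v j m) (v j (suc m)) ⟩
    β * ι (b ^ suc m) * Δₘ j m
      ≡⟨ cong (_* Δₘ j m) (ι-b^suc (suc m)) ⟨
    ι (b ^ suc (suc m)) * Δₘ j m ∎
    where
    open ≡-Reasoning
    regroup : ∀ β s s′ t t′ → (β * s - s′) + (β * t - t′) ≡ β * (s + t) - (s′ + t′)
    regroup = solve 5 (λ β s s′ t t′ → (β :* s :- s′) :+ (β :* t :- t′) := β :* (s :+ t) :- (s′ :+ t′)) refl
    factor : ∀ β B x y → β * (B * x) - β * B * y ≡ β * B * (x - y)
    factor = solve 4 (λ β B x y → β :* (B :* x) :- β :* B :* y := β :* B :* (x :- y)) refl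

  excess-term-nonNeg : ∀ {a} → a < b → ∀ j m → 0ℚ ℚ.≤ (β - ι (suc a)) * translate (ι a) (v j) m
  excess-term-nonNeg {a} a<b j m = *-nonNeg (p≤q⇒0≤q-p (ι-mono-≤ a<b))
    (translate-nonNeg (ι-nonNeg a) m λ n _ → v-nonNeg j n)

  excess-term-pos : ∀ {a} → suc a < b → ∀ j m → 0ℚ ℚ.< (β - ι (suc a)) * translate (ι a) (v j) m
  excess-term-pos {a} a+1<b j m = *-pos (p<q⇒0<q-p (ι-mono-< a+1<b))
    (ℚ.<-≤-trans (v-pos j m) (u[m]≤translate (ι-nonNeg a) m λ n _ → v-nonNeg j n))

  excess-nonNeg : ∀ j m → 0ℚ ℚ.≤ excess j m
  excess-nonNeg j m = ∑-nonNeg others λ a∈ → excess-term-nonNeg (others<b a∈) j m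

  Δₘ-nonNeg : ∀ j m → 0ℚ ℚ.≤ Δₘ j m
  Δₘ-source-nonNeg : ∀ j m → 0ℚ ℚ.≤ Δₘ-source j m

  private
    module Δₘ-Comparison (j : ℕ) = Comparison {Δₘ j} {λ n → Δₘ-source j n + excess j n} {λ n → ι (b ^ suc (suc n))}
      (λ n → β≤b^suc (suc n)) (λ n → +-nonNeg (Δₘ-source-nonNeg j n) (excess-nonNeg j n))
      (λ n → ℚ.≤-reflexive (Δₘ-rec j n))

  Δₘ-nonNeg j = Δₘ-Comparison.nonNeg j

  Δₘ-source-nonNeg zero    m = ℚ.≤-reflexive (sym
    (trans (cong (λ t → β * ι (b ^ suc m) - t) (ι-b^suc (suc m))) (ℚ.+-inverseʳ (β * ι (b ^ suc m)))))
  Δₘ-source-nonNeg (suc j) m = subst (0ℚ ℚ.≤_) (β-Δₘ d′ j m)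
    (+-nonNeg (excess-term-nonNeg d′<b j m) (translate-nonNeg (ι-nonNeg d′) m λ n _ → Δₘ-nonNeg j n))

  d+d′+1≡b : suc (toℕ d ℕ.+ d′) ≡ b
  d+d′+1≡b = begin
    suc (toℕ d ℕ.+ (b ∸ 1 ∸ toℕ d))    ≡⟨ cong suc (ℕ.m+[n∸m]≡n d≤b-1) ⟩
    suc (b ∸ 1)                        ≡⟨ ℕ.m+[n∸m]≡n 0<b ⟩
    b                                  ∎
    where
    open ≡-Reasoning
    d≤b-1 : toℕ d ≤ b ∸ 1
    d≤b-1 = ℕ.∸-monoˡ-≤ 1 (Fin.toℕ<n d)

  Δₘ-source-pos : ∀ j m → suc d′ < b → 0ℚ ℚ.< Δₘ-source (suc j) m
  Δₘ-source-pos j m d′+1<b = subst (0ℚ ℚ.<_) (β-Δₘ d′ j m)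
    (ℚ.+-mono-<-≤ (excess-term-pos d′+1<b j m) (translate-nonNeg (ι-nonNeg d′) m λ n _ → Δₘ-nonNeg j n))

  -- Mass at y = 1 contributes nothing to the moments of 1 - y, so strictness must come from a
  -- branch a with a + 1 < b. If d′ ≠ 0 the digit 0 provides it; if d′ = 0 and j ≥ 1, the branch of
  -- d′ itself; if d′ = 0, j = 0 and b > 2, the digit 1. Only the excluded case remains.
  Δₘ-pos : ∀ j → ¬ (b ≡ 2 × toℕ d ≡ 1 × j ≡ 0) → ∀ m → 0ℚ ℚ.< Δₘ j m
  Δₘ-pos j exc m = Δₘ-Comparison.pos j {m} (by-cases j exc (d′ ≟ 0) (b ≟ 2))
    where
    via-digit : ∀ j {a} → suc a < b → a ≢ d′ → 0ℚ ℚ.< Δₘ-source j m + excess j m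
    via-digit j {a} a+1<b a≢d′ = ℚ.+-mono-≤-< (Δₘ-source-nonNeg j m)
      (∑-pos (λ a∈ → excess-term-nonNeg (others<b a∈) j m) (∈-others (ℕ.<-trans (ℕ.n<1+n a) a+1<b) a≢d′)
             (excess-term-pos a+1<b j m))
    by-cases : ∀ j → ¬ (b ≡ 2 × toℕ d ≡ 1 × j ≡ 0) → Dec (d′ ≡ 0) → Dec (b ≡ 2) →
               0ℚ ℚ.< Δₘ-source j m + excess j m
    by-cases j       exc (no d′≢0) _         = via-digit j 1<b (d′≢0 ∘ sym)
    by-cases (suc j) exc (yes d′≡0) _        = ℚ.+-mono-<-≤
      (Δₘ-source-pos j m (subst (λ t → suc t < b) (sym d′≡0) 1<b)) (excess-nonNeg (suc j) m)
    by-cases zero    exc (yes d′≡0) (yes b≡2) = contradiction (b≡2 , d≡1 , refl) exc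
      where
      d≡1 : toℕ d ≡ 1
      d≡1 = ℕ.suc-injective (trans (cong suc (sym (trans (cong (toℕ d ℕ.+_) d′≡0) (ℕ.+-identityʳ (toℕ d)))))
        (trans d+d′+1≡b b≡2))
    by-cases zero    exc (yes d′≡0) (no b≢2) = via-digit zero (ℕ.≤∧≢⇒< 1<b (b≢2 ∘ sym))
      (λ 1≡d′ → contradiction (trans 1≡d′ d′≡0) λ ())

  Δₘ-pos⇒decreasing : ∀ j → (∀ m → 0ℚ ℚ.< Δₘ j m) → StrictlyDecreasing (v j)
  Δₘ-pos⇒decreasing j 0<Δₘ {m} {n} m<n = go (ℕ.≤⇒≤′ m<n)
    where
    go : ∀ {n} → suc m ℕ.≤′ n → v j n ℚ.< v j m
    go ℕ.≤′-refl       = 0<q-p⇒p<q (0<Δₘ m)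
    go (ℕ.≤′-step {n} le) = ℚ.<-trans (0<q-p⇒p<q (0<Δₘ n)) (go le)

  v-decreasing : ∀ j → ¬ (b ≡ 2 × toℕ d ≡ 1 × j ≡ 0) → StrictlyDecreasing (v j)
  v-decreasing j exc = Δₘ-pos⇒decreasing j (Δₘ-pos j exc)

  -- The hypothesis says that the constant β is also a subsolution at j = 0. It is met in the
  -- exceptional case b = 2, d = 1, where all the mass for j = 0 lies at the point 1.
  β≤v₀ : (∀ m → β * ι (b ^ suc m) ℚ.≤ ι (b ^ suc m) + β * (∑[ a ← others ] ι (suc a ^ m))) →
         ∀ m → β ℚ.≤ v 0 m
  β≤v₀ large m = 0≤q-p⇒p≤q (Comparison.nonNeg {λ n → v 0 n - β}
    {λ n → ι (b ^ suc n) + β * (∑[ a ← others ] ι (suc a ^ n)) - β * ι (b ^ suc n)}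
    {λ n → ι (b ^ suc n)} β≤b^suc (λ n → p≤q⇒0≤q-p (large n)) super m)
    where
    super : ∀ n → ι (b ^ suc n) + β * (∑[ a ← others ] ι (suc a ^ n)) - β * ι (b ^ suc n) +
                  T (λ n → v 0 n - β) n ℚ.≤ ι (b ^ suc n) * (v 0 n - β)
    super n = ℚ.≤-reflexive (begin
      B + β * S - β * B + T (λ n → v 0 n - β) n
        ≡⟨ cong (_+_ (B + β * S - β * B)) (trans (T-- (v 0) (λ _ → β) n) (cong (λ t → T (v 0) n - t) (T-const β n))) ⟩
      B + β * S - β * B + (T (v 0) n - β * S)
        ≡⟨ solve 4 (λ B β S t → B :+ β :* S :- β :* B :+ (t :- β :* S) := (B :+ t) :- β :* B) refl B β S (T (v 0) n) ⟩
      (B + T (v 0) n) - β * B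
        ≡⟨ cong (_- β * B) (v-rec 0 n) ⟨
      B * v 0 n - β * B
        ≡⟨ solve 3 (λ B x β → B :* x :- β :* B := B :* (x :- β)) refl B (v 0 n) β ⟩
      B * (v 0 n - β) ∎)
      where
      open ≡-Reasoning
      B = ι (b ^ suc n)
      S = ∑[ a ← others ] ι (suc a ^ n)

  -- Monotonicity in j

  Δⱼ : ℕ → ℕ → ℚ
  Δⱼ j m = v j m - v (suc j) m

  Δⱼ-source : ℕ → ℕ → ℚ
  Δⱼ-source j m = source j m - source (suc j) m

  Δⱼ-source≡ : ∀ j m → Δⱼ-source (suc j) m ≡ translate (ι d′) (Δⱼ j) m
  Δⱼ-source≡ j m = sym (translate-- (ι d′) (v j) (v (suc j)) m)

  difference-rec : ∀ B x y s t p q → B * x ≡ s + p → B * y ≡ t + q → (s - t) + (p - q) ≡ B * (x - y)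
  difference-rec B x y s t p q eq₁ eq₂ = trans (regroup s t p q)
    (trans (cong₂ _-_ (sym eq₁) (sym eq₂)) (factor B x y))
    where
    regroup : ∀ s t p q → (s - t) + (p - q) ≡ (s + p) - (t + q)
    regroup = solve 4 (λ s t p q → (s :- t) :+ (p :- q) := (s :+ p) :- (t :+ q)) refl
    factor : ∀ B x y → B * x - B * y ≡ B * (x - y)
    factor = solve 3 (λ B x y → B :* x :- B :* y := B :* (x :- y)) refl

  Δⱼ-rec : ∀ j m → Δⱼ-source j m + T (Δⱼ j) m ≡ ι (b ^ suc m) * Δⱼ j m
  Δⱼ-rec j m = trans (cong (_+_ (Δⱼ-source j m)) (T-- (v j) (v (suc j)) m))
    (difference-rec (ι (b ^ suc m)) (v j m) (v (suc j) m) (source j m) (source (suc j) m) _ _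
      (v-rec j m) (v-rec (suc j) m))

  Δⱼ-nonNeg : ∀ j m → 0ℚ ℚ.≤ Δⱼ j m
  Δⱼ-source-nonNeg : ∀ j m → 0ℚ ℚ.≤ Δⱼ-source j m

  private
    module Δⱼ-Comparison (j : ℕ) = Comparison {Δⱼ j} {Δⱼ-source j} {λ n → ι (b ^ suc n)}
      β≤b^suc (Δⱼ-source-nonNeg j) (λ n → ℚ.≤-reflexive (Δⱼ-rec j n))

  Δⱼ-nonNeg j = Δⱼ-Comparison.nonNeg j

  Δⱼ-source-nonNeg zero    m = p≤q⇒0≤q-p (ℚ.≤-trans (source≤ 1 m) (ℚ.≤-reflexive (sym (ι-b^suc m))))
  Δⱼ-source-nonNeg (suc j) m = subst (0ℚ ℚ.≤_) (sym (Δⱼ-source≡ j m))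
    (translate-nonNeg (ι-nonNeg d′) m λ n _ → Δⱼ-nonNeg j n)

  -- Strictness between j = 0 and j = 1, from which that for every j follows. If d′ + 1 < b, the
  -- power (d′ + 1)^(m+1) is already too small. If d′ = b - 1, then d = 0, so the exceptional case
  -- is excluded and the strict decrease of `v 0` in m gives `v 0 (suc m)` < β.
  translate-v₀< : ∀ m → translate (ι d′) (v 0) (suc m) ℚ.< ι (b ^ suc (suc m))
  translate-v₀< m with ℕ.m≤n⇒m<n∨m≡n d′<b
  ... | inj₁ d′+1<b = begin-strict
    translate (ι d′) (v 0) (suc m)            ≤⟨ translate-mono-≤ (ι-nonNeg d′) (suc m) (v≤β 0) ⟩
    translate (ι d′) (λ _ → β) (suc m)        ≡⟨ translate-const d′ β (suc m) ⟩
    β * ι (suc d′ ^ suc m)                    <⟨ *-monoʳ-< (ι-pos 0<b) (ι-mono-< (ℕ.^-monoˡ-< (suc m) d′+1<b)) ⟩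
    β * ι (b ^ suc m)                         ≡⟨ ι-b^suc (suc m) ⟨
    ι (b ^ suc (suc m))                       ∎
    where open ℚ.≤-Reasoning
  ... | inj₂ d′+1≡b = begin-strict
    translate (ι d′) (v 0) (suc m)                              <⟨ 0<q-p⇒p<q (ℚ.<-≤-trans 0<β-v (ℚ.≤-trans
        (u[m]≤translate (ι-nonNeg d′) {λ n → β - v 0 n} (suc m) λ n _ → p≤q⇒0≤q-p (v≤β 0 n))
        (ℚ.≤-reflexive (translate-- (ι d′) (λ _ → β) (v 0) (suc m))))) ⟩
    translate (ι d′) (λ _ → β) (suc m)        ≡⟨ translate-const d′ β (suc m) ⟩
    β * ι (suc d′ ^ suc m)                    ≡⟨ cong (λ n → β * ι (n ^ suc m)) d′+1≡b ⟩
    β * ι (b ^ suc m)                         ≡⟨ ι-b^suc (suc m) ⟨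
    ι (b ^ suc (suc m))                       ∎
    where
    open ℚ.≤-Reasoning
    d≡0 : toℕ d ≡ 0
    d≡0 = ℕ.+-cancelʳ-≡ (suc d′) (toℕ d) 0 (trans (ℕ.+-suc (toℕ d) d′) (trans d+d′+1≡b (sym d′+1≡b)))
    0<β-v : 0ℚ ℚ.< β - v 0 (suc m)
    0<β-v = p<q⇒0<q-p (subst (v 0 (suc m) ℚ.<_) (v[j,0]≡β 0)
      (v-decreasing 0 (λ (_ , d≡1 , _) → contradiction (trans (sym d≡0) d≡1) λ ()) {0} {suc m} ℕ.z<s))

  Δⱼ-pos : ∀ j m → 0ℚ ℚ.< Δⱼ j (suc m)
  Δⱼ-source-pos : ∀ j m → 0ℚ ℚ.< Δⱼ-source j (suc m)
  Δⱼ-pos j m = Δⱼ-Comparison.pos j {suc m} (Δⱼ-source-pos j m)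
  Δⱼ-source-pos zero    m = p<q⇒0<q-p (translate-v₀< m)
  Δⱼ-source-pos (suc j) m = subst (0ℚ ℚ.<_) (sym (Δⱼ-source≡ j (suc m)))
    (ℚ.<-≤-trans (Δⱼ-pos j m) (u[m]≤translate (ι-nonNeg d′) (suc m) λ n _ → Δⱼ-nonNeg j n))

  v-decreasing-in-j : ∀ m → StrictlyDecreasing (λ j → v j (suc m))
  v-decreasing-in-j m {i} {j} i<j = go (ℕ.≤⇒≤′ i<j)
    where
    go : ∀ {j} → suc i ℕ.≤′ j → v j (suc m) ℚ.< v i (suc m)
    go ℕ.≤′-refl          = 0<q-p⇒p<q (Δⱼ-pos i m)
    go (ℕ.≤′-step {j} le) = ℚ.<-trans (0<q-p⇒p<q (Δⱼ-pos j m)) (go le)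

  -- Convergence to the moments of b times Lebesgue measure

  h : ℕ → ℚ
  h = recip ∘ suc

  error : ℕ → ℕ → ℚ
  error j m = v j m - β * h m

  error-source : ℕ → ℕ → ℚ
  error-source j m = source j m - β * translate (ι d′) h m

  -- Lebesgue measure is self-similar under all b digit maps together. Thus β `h` solves the
  -- recurrence with its own d′-translate as source: it is the fixed point of the passage from j to
  -- j + 1.
  h-rec : ∀ m → ι (b ^ suc m) * (β * h m) ≡ β * translate (ι d′) h m + T (λ n → β * h n) m
  h-rec m = begin
    ι (b ^ suc m) * (β * h m)
      ≡⟨ x*[y*z]≡y*[x*z] (ι (b ^ suc m)) β (h m) ⟩
    β * (ι (b ^ suc m) * h m)
      ≡⟨ cong (β *_) (trans (sym (∑-translate-recip b m)) (sym (∑-upTo-remove d′<b (λ a → translate (ι a) h m)))) ⟩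
    β * (translate (ι d′) h m + T h m)
      ≡⟨ ℚ.*-distribˡ-+ β (translate (ι d′) h m) (T h m) ⟩
    β * translate (ι d′) h m + β * T h m
      ≡⟨ cong (_+_ (β * translate (ι d′) h m)) (T-* β h m) ⟨
    β * translate (ι d′) h m + T (λ n → β * h n) m ∎
    where
    open ≡-Reasoning

  error-rec : ∀ j m → error-source j m + T (error j) m ≡ ι (b ^ suc m) * error j m
  error-rec j m = trans (cong (_+_ (error-source j m)) (T-- (v j) (λ n → β * h n) m))
    (difference-rec (ι (b ^ suc m)) (v j m) (β * h m) (source j m) (β * translate (ι d′) h m) _ _
      (v-rec j m) (h-rec m))

  error-source≡ : ∀ j m → error-source (suc j) m ≡ translate (ι d′) (error j) m
  error-source≡ j m = trans (cong (λ t → translate (ι d′) (v j) m - t) (sym (translate-* (ι d′) β h m)))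
    (sym (translate-- (ι d′) (v j) (λ n → β * h n) m))

  h≤1 : ∀ m → h m ℚ.≤ 1ℚ
  h≤1 m = *-cancelˡ-≤ (ι-pos {suc m} ℕ.z<s) (subst₂ ℚ._≤_ (sym (*-recip {suc m} ℕ.z<s))
    (sym (ℚ.*-identityʳ (ι (suc m)))) (ι-mono-≤ {1} {suc m} (s≤s z≤n)))

  error-nonNeg : ∀ j m → 0ℚ ℚ.≤ error j m
  error-source-nonNeg : ∀ j m → 0ℚ ℚ.≤ error-source j m

  error-nonNeg j = Comparison.nonNeg {error j} {error-source j} {λ n → ι (b ^ suc n)}
    β≤b^suc (error-source-nonNeg j) (λ n → ℚ.≤-reflexive (error-rec j n))

  error-source-nonNeg zero    m = p≤q⇒0≤q-p (begin
    β * translate (ι d′) h m             ≤⟨ *-monoʳ-≤ 0≤β (translate-mono-≤ (ι-nonNeg d′) m h≤1) ⟩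
    β * translate (ι d′) (λ _ → 1ℚ) m    ≡⟨ cong (β *_) (trans (translate-const d′ 1ℚ m) (ℚ.*-identityˡ _)) ⟩
    β * ι (suc d′ ^ m)                   ≤⟨ *-monoʳ-≤ 0≤β (ι-suc^≤ d′<b m) ⟩
    β * ι (b ^ m)                        ≡⟨ ι-b^suc m ⟨
    ι (b ^ suc m)                        ∎)
    where open ℚ.≤-Reasoning
  error-source-nonNeg (suc j) m = subst (0ℚ ℚ.≤_) (sym (error-source≡ j m))
    (translate-nonNeg (ι-nonNeg d′) m λ n _ → error-nonNeg j n)

  positive≤1 : ∀ n → positive n ℚ.≤ 1ℚ
  positive≤1 zero    = ℚ.<⇒≤ 0<1
  positive≤1 (suc _) = ℚ.≤-refl

  -- The origin of the ratio ½: for m ≥ 1 the translates over all digits telescope to b^m, and the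
  -- one for d′ is at most b^m, so counting d′ twice costs at most 2b^m ≤ b^(m+1). A constant
  -- barrier would fail at m = 0, where the count is b + 1; `positive` vanishes there, as does the
  -- error it has to dominate.
  positive-super : ∀ m → translate (ι d′) positive m + (translate (ι d′) positive m + T positive m) ℚ.≤
                         ι (b ^ suc m) * positive m
  positive-super zero    = ℚ.≤-reflexive (trans (trans (ℚ.+-identityˡ _) (trans (ℚ.+-identityˡ _) (∑-zero others)))
    (sym (ℚ.*-zeroʳ (ι (b ^ 1)))))
  positive-super (suc m) = begin
    t + (t + T positive (suc m))          ≡⟨ cong (_+_ t) (trans (∑-upTo-remove d′<b (λ a → translate (ι a) positive (suc m)))
                                               (∑-translate-positive b m)) ⟩
    t + ι (b ^ suc m)                     ≤⟨ ℚ.+-monoˡ-≤ (ι (b ^ suc m)) t≤ ⟩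
    ι (b ^ suc m) + ι (b ^ suc m)         ≡⟨ solve 1 (λ x → x :+ x := (con 1ℚ :+ con 1ℚ) :* x) refl (ι (b ^ suc m)) ⟩
    ι 2 * ι (b ^ suc m)                   ≤⟨ *-mono-≤ (ι-nonNeg 2) (ι-nonNeg (b ^ suc m)) (ι-mono-≤ 1<b) ℚ.≤-refl ⟩
    β * ι (b ^ suc m)                     ≡⟨ ι-b^suc (suc m) ⟨
    ι (b ^ suc (suc m))                   ≡⟨ ℚ.*-identityʳ _ ⟨
    ι (b ^ suc (suc m)) * 1ℚ              ∎
    where
    open ℚ.≤-Reasoning
    t = translate (ι d′) positive (suc m)
    t≤ : t ℚ.≤ ι (b ^ suc m)
    t≤ = begin
      t                                       ≤⟨ translate-mono-≤ (ι-nonNeg d′) (suc m) positive≤1 ⟩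
      translate (ι d′) (λ _ → 1ℚ) (suc m)     ≡⟨ trans (translate-const d′ 1ℚ (suc m)) (ℚ.*-identityˡ _) ⟩
      ι (suc d′ ^ suc m)                      ≤⟨ ι-suc^≤ d′<b (suc m) ⟩
      ι (b ^ suc m)                           ∎

  θ : ℕ → ℚ
  θ j = β * ½ ^ℚ j

  0≤θ : ∀ j → 0ℚ ℚ.≤ θ j
  0≤θ j = *-nonNeg 0≤β (^ℚ-nonNeg (ℚ.nonNegative⁻¹ ½) j)

  θ-halves : ∀ j → θ j ≡ θ (suc j) + θ (suc j)
  θ-halves j = solve 2 (λ β x → β :* x := β :* (con ½ :* x) :+ β :* (con ½ :* x)) refl β (½ ^ℚ j)

  -- Induction on j: the source of the error at j + 1 is at most θ j = 2 θ (j + 1) times the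
  -- d′-translate of `positive`, exactly the doubled branch that `positive-super` allows.
  error≤ : ∀ j m → error j m ℚ.≤ θ j * positive m
  error≤ zero zero    = ℚ.≤-reflexive (trans (cong₂ _-_ (v[j,0]≡β 0) (ℚ.*-identityʳ β))
    (trans (ℚ.+-inverseʳ β) (sym (ℚ.*-zeroʳ (θ 0)))))
  error≤ zero (suc m) = begin
    v 0 (suc m) - β * h (suc m)     ≤⟨ ℚ.+-mono-≤ (v≤β 0 (suc m)) (ℚ.neg-antimono-≤ (*-nonNeg 0≤β (recip-nonNeg (suc (suc m))))) ⟩
    β + 0ℚ                          ≡⟨ solve 1 (λ β → β :+ con 0ℚ := β :* con 1ℚ :* con 1ℚ) refl β ⟩
    β * 1ℚ * 1ℚ                     ∎
    where open ℚ.≤-Reasoning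
  error≤ (suc j) m = 0≤q-p⇒p≤q (Comparison.nonNeg {λ n → θ (suc j) * positive n - error (suc j) n}
    {λ _ → 0ℚ} {λ n → ι (b ^ suc n)} β≤b^suc (λ _ → ℚ.≤-refl) super m)
    where
    super : ∀ n → 0ℚ + T (λ n → θ (suc j) * positive n - error (suc j) n) n ℚ.≤
                  ι (b ^ suc n) * (θ (suc j) * positive n - error (suc j) n)
    super n = begin
      0ℚ + T (λ n → θ (suc j) * positive n - error (suc j) n) n
        ≡⟨ ℚ.+-identityˡ _ ⟩
      T (λ n → θ (suc j) * positive n - error (suc j) n) n
        ≡⟨ trans (T-- (λ n → θ (suc j) * positive n) (error (suc j)) n)
                 (cong (_- T (error (suc j)) n) (T-* (θ (suc j)) positive n)) ⟩
      θ (suc j) * T positive n - Tε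
        ≡⟨ insert (θ (suc j) * T positive n) Tε (translate (ι d′) (error j) n) ⟩
      translate (ι d′) (error j) n + θ (suc j) * T positive n - (translate (ι d′) (error j) n + Tε)
        ≤⟨ ℚ.+-monoˡ-≤ (- (translate (ι d′) (error j) n + Tε)) (ℚ.+-monoˡ-≤ (θ (suc j) * T positive n) translated) ⟩
      θ j * t + θ (suc j) * T positive n - (translate (ι d′) (error j) n + Tε)
        ≡⟨ cong₂ _-_ (trans (cong (λ s → s * t + θ (suc j) * T positive n) (θ-halves j)) (collect (θ (suc j)) t (T positive n)))
             (trans (cong (_+ Tε) (sym (error-source≡ j n))) (error-rec (suc j) n)) ⟩
      θ (suc j) * (t + (t + T positive n)) - B * error (suc j) n
        ≤⟨ ℚ.+-monoˡ-≤ (- (B * error (suc j) n)) (*-monoʳ-≤ (0≤θ (suc j)) (positive-super n)) ⟩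
      θ (suc j) * (B * positive n) - B * error (suc j) n
        ≡⟨ factor (θ (suc j)) B (positive n) (error (suc j) n) ⟩
      B * (θ (suc j) * positive n - error (suc j) n) ∎
      where
      open ℚ.≤-Reasoning
      B = ι (b ^ suc n)
      t = translate (ι d′) positive n
      Tε = T (error (suc j)) n
      translated : translate (ι d′) (error j) n ℚ.≤ θ j * t
      translated = ℚ.≤-trans (translate-mono-≤ (ι-nonNeg d′) n (error≤ j))
        (ℚ.≤-reflexive (translate-* (ι d′) (θ j) positive n))
      insert : ∀ x y z → x - y ≡ z + x - (z + y)
      insert = solve 3 (λ x y z → x :- y := z :+ x :- (z :+ y)) refl
      collect : ∀ θ t s → (θ + θ) * t + θ * s ≡ θ * (t + (t + s))
      collect = solve 3 (λ θ t s → (θ :+ θ) :* t :+ θ :* s := θ :* (t :+ (t :+ s))) refl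
      factor : ∀ θ B p e → θ * (B * p) - B * e ≡ B * (θ * p - e)
      factor = solve 4 (λ θ B p e → θ :* (B :* p) :- B :* e := B :* (θ :* p :- e)) refl

  v-limit : ∀ m → (λ j → v j (suc m)) ⟶ (+ b / suc (suc m))
  v-limit m ε 0<ε = N , λ j N≤j → begin-strict
    ∣ v j (suc m) - + b / suc (suc m) ∣   ≡⟨ cong (λ t → ∣ v j (suc m) - t ∣) (/-≡-*recip b (suc m)) ⟩
    ∣ error j (suc m) ∣                   ≡⟨ ℚ.0≤p⇒∣p∣≡p (error-nonNeg j (suc m)) ⟩
    error j (suc m)                       ≤⟨ error≤ j (suc m) ⟩
    β * ½ ^ℚ j * 1ℚ                       ≡⟨ ℚ.*-identityʳ (β * ½ ^ℚ j) ⟩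
    β * ½ ^ℚ j                            <⟨ small j N≤j ⟩
    ε                                     ∎
    where
    open ℚ.≤-Reasoning
    decay = geometric-decay (ℚ.nonNegative⁻¹ ½) ½<1 0≤β 0<ε
    N = proj₁ decay
    small = proj₂ decay

  -- Digit counts after appending a digit

  private

    raw : ℕ → Expansion b
    raw n = proj₁ (toDigits b {fromWitness (ℕ.nonTrivial⇒n>1 b)} n)

    fromDigits-raw : ∀ n → fromDigits (raw n) ≡ n
    fromDigits-raw n = proj₂ (toDigits b {fromWitness (ℕ.nonTrivial⇒n>1 b)} n)

  -- Two digit strings of equal value agree once stripped. For p ≥ 1 an appended digit 0 is not a
  -- leading zero, so nothing is stripped.
  digits-append : ∀ (a : Digit b) {p} → 1 ≤ p → digits b (toℕ a ℕ.+ p ℕ.* b) ≡ a ∷ digits b p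
  digits-append a {p} 1≤p = trans
    (strip-unique (raw (toℕ a ℕ.+ p ℕ.* b)) (a ∷ raw p)
      (trans (fromDigits-raw _) (cong (λ n → toℕ a ℕ.+ n ℕ.* b) (sym (fromDigits-raw p)))))
    (strip-∷ a (raw p) λ eq → ℕ.<⇒≢ 1≤p (trans (cong fromDigits (sym eq)) (fromDigits-digits b p)))

  #d-append-≡ : ∀ {p} → 1 ≤ p → #d (toℕ d ℕ.+ p ℕ.* b) ≡ suc (#d p)
  #d-append-≡ 1≤p = cong length (trans (cong (filter (d Fin.≟_)) (digits-append d 1≤p))
    (List.filter-accept (d Fin.≟_) refl))

  #d-append-≢ : ∀ {a p} → a < b → a ≢ toℕ d → 1 ≤ p → #d (a ℕ.+ p ℕ.* b) ≡ #d p
  #d-append-≢ {a} {p} a<b a≢d 1≤p = trans (cong (λ t → #d (t ℕ.+ p ℕ.* b)) (sym (Fin.toℕ-fromℕ< a<b)))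
    (cong length (trans (cong (filter (d Fin.≟_)) (digits-append (Fin.fromℕ< a<b) 1≤p))
      (List.filter-reject (d Fin.≟_) λ d≡a → a≢d (trans (sym (Fin.toℕ-fromℕ< a<b)) (cong toℕ (sym d≡a))))))

  -- integral R j f is ∑ b^-|w| f(1 − 0.w), over the strings w of fewer than R
  -- digits among which d occurs j times.  A first digit a acts on 1 − 0.w as
  -- φ (b ∸ 1 ∸ a), so the branch of d is the one of d′.

  r : ℚ
  r = recip b

  β*r≡1 : β * r ≡ 1ℚ
  β*r≡1 = *-recip 0<b

  φ : ℕ → ℚ → ℚ
  φ a y = (ι a + y) * r

  integral : ℕ → ℕ → (ℚ → ℚ) → ℚ
  integral zero    j f = 0ℚ
  integral (suc R) j f = r * (prev (β * f 1ℚ) (λ i → integral R i (f ∘ φ d′)) j +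
                              (∑[ a ← others ] integral R j (f ∘ φ a)))

  0≤r : 0ℚ ℚ.≤ r
  0≤r = recip-nonNeg b

  φ-nonNeg : ∀ a {y} → 0ℚ ℚ.≤ y → 0ℚ ℚ.≤ φ a y
  φ-nonNeg a 0≤y = *-nonNeg (+-nonNeg (ι-nonNeg a) 0≤y) 0≤r

  φ≤1 : ∀ {a y} → a < b → y ℚ.≤ 1ℚ → φ a y ℚ.≤ 1ℚ
  φ≤1 {a} {y} a<b y≤1 = begin
    (ι a + y) * r    ≡⟨ ℚ.*-comm (ι a + y) r ⟩
    r * (ι a + y)    ≤⟨ *-monoʳ-≤ 0≤r (ℚ.+-monoʳ-≤ (ι a) y≤1) ⟩
    r * (ι a + 1ℚ)   ≡⟨ cong (r *_) (trans (ℚ.+-comm (ι a) 1ℚ) (sym (ι-suc a))) ⟩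
    r * ι (suc a)    ≤⟨ *-monoʳ-≤ 0≤r (ι-mono-≤ a<b) ⟩
    r * β            ≡⟨ trans (ℚ.*-comm r β) β*r≡1 ⟩
    1ℚ               ∎
    where open ℚ.≤-Reasoning

  -- The maps φ a send [0, 1] into itself and the evaluation point is 1, so only values on [0, 1]
  -- matter. The restriction is essential for the kernels, whose identities hold for y ≤ 1.
  integral-mono-≤ : ∀ R j {f g} → (∀ y → 0ℚ ℚ.≤ y → y ℚ.≤ 1ℚ → f y ℚ.≤ g y) → integral R j f ℚ.≤ integral R j g
  integral-mono-≤ zero    j f≤g = ℚ.≤-refl
  integral-mono-≤ (suc R) j f≤g = *-monoʳ-≤ 0≤r (ℚ.+-mono-≤
    (prev-lift ℚ._≤_ (*-monoʳ-≤ 0≤β (f≤g 1ℚ (ℚ.<⇒≤ 0<1) ℚ.≤-refl)) (λ i → branch i d′<b) j)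
    (∑-mono-≤ others λ a∈ → branch j (others<b a∈)))
    where
    branch : ∀ i {a} → a < b → _
    branch i {a} a<b = integral-mono-≤ R i λ y 0≤y y≤1 → f≤g (φ a y) (φ-nonNeg a 0≤y) (φ≤1 a<b y≤1)

  integral-cong : ∀ R j {f g} → (∀ y → 0ℚ ℚ.≤ y → y ℚ.≤ 1ℚ → f y ≡ g y) → integral R j f ≡ integral R j g
  integral-cong R j f≡g = ℚ.≤-antisym
    (integral-mono-≤ R j λ y 0≤y y≤1 → ℚ.≤-reflexive (f≡g y 0≤y y≤1))
    (integral-mono-≤ R j λ y 0≤y y≤1 → ℚ.≤-reflexive (sym (f≡g y 0≤y y≤1)))

  integral-* : ∀ R j c f → integral R j (λ y → c * f y) ≡ c * integral R j f
  integral-* zero    j c f = sym (ℚ.*-zeroʳ c)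
  integral-* (suc R) j c f = begin
    r * (prev (β * (c * f 1ℚ)) (λ i → integral R i (λ y → c * f (φ d′ y))) j +
         (∑[ a ← others ] integral R j (λ y → c * f (φ a y))))
      ≡⟨ cong (r *_) (cong₂ _+_
           (prev-lift _≡_ (x*[y*z]≡y*[x*z] β c (f 1ℚ)) (λ i → integral-* R i c (f ∘ φ d′)) j)
           (trans (∑-cong others λ {a} _ → integral-* R j c (f ∘ φ a))
                  (∑-*ˡ others c (λ a → integral R j (f ∘ φ a))))) ⟩
    r * (prev (c * (β * f 1ℚ)) (λ i → c * integral R i (f ∘ φ d′)) j + c * S)
      ≡⟨ cong (λ t → r * (t + c * S)) (prev-map (c *_) (β * f 1ℚ) (λ i → integral R i (f ∘ φ d′)) j) ⟨
    r * (c * P + c * S)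
      ≡⟨ solve 4 (λ r c p s → r :* (c :* p :+ c :* s) := c :* (r :* (p :+ s))) refl r c P S ⟩
    c * (r * (P + S)) ∎
    where
    open ≡-Reasoning
    P = prev (β * f 1ℚ) (λ i → integral R i (f ∘ φ d′)) j
    S = ∑[ a ← others ] integral R j (f ∘ φ a)

  integral-+ : ∀ R j f g → integral R j (λ y → f y + g y) ≡ integral R j f + integral R j g
  integral-+ zero    j f g = refl
  integral-+ (suc R) j f g = begin
    r * (prev (β * (f 1ℚ + g 1ℚ)) (λ i → integral R i (λ y → f (φ d′ y) + g (φ d′ y))) j +
         (∑[ a ← others ] integral R j (λ y → f (φ a y) + g (φ a y))))
      ≡⟨ cong (r *_) (cong₂ _+_
           (trans (prev-lift _≡_ (ℚ.*-distribˡ-+ β (f 1ℚ) (g 1ℚ)) (λ i → integral-+ R i (f ∘ φ d′) (g ∘ φ d′)) j)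
                  (prev-+ (β * f 1ℚ) (β * g 1ℚ) (λ i → integral R i (f ∘ φ d′)) (λ i → integral R i (g ∘ φ d′)) j))
           (trans (∑-cong others λ {a} _ → integral-+ R j (f ∘ φ a) (g ∘ φ a))
                  (∑-distrib-+ others (λ a → integral R j (f ∘ φ a)) (λ a → integral R j (g ∘ φ a))))) ⟩
    r * ((P f + P g) + (S f + S g))
      ≡⟨ solve 5 (λ r p q s t → r :* ((p :+ q) :+ (s :+ t)) := r :* (p :+ s) :+ r :* (q :+ t)) refl
           r (P f) (P g) (S f) (S g) ⟩
    r * (P f + S f) + r * (P g + S g) ∎
    where
    open ≡-Reasoning
    P S : (ℚ → ℚ) → ℚ
    P f = prev (β * f 1ℚ) (λ i → integral R i (f ∘ φ d′)) j
    S f = ∑[ a ← others ] integral R j (f ∘ φ a)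

  integral-zero : ∀ R j → integral R j (λ _ → 0ℚ) ≡ 0ℚ
  integral-zero R j = trans (integral-* R j 0ℚ (λ _ → 0ℚ)) (ℚ.*-zeroˡ (integral R j (λ _ → 0ℚ)))

  integral-∑ : ∀ R j {A : Set} (xs : List A) (f : A → ℚ → ℚ) →
               integral R j (λ y → ∑[ x ← xs ] f x y) ≡ (∑[ x ← xs ] integral R j (f x))
  integral-∑ R j []       f = integral-zero R j
  integral-∑ R j (x ∷ xs) f = trans (integral-+ R j (f x) (λ y → ∑[ x ← xs ] f x y))
    (cong (_+_ (integral R j (f x))) (integral-∑ R j xs f))

  integral-translate : ∀ R j x (f : ℕ → ℚ → ℚ) m →
    integral R j (λ y → translate x (λ n → f n y) m) ≡ translate x (λ n → integral R j (f n)) m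
  integral-translate R j x f zero    = refl
  integral-translate R j x f (suc m) = trans
    (integral-+ R j (λ y → x * translate x (λ n → f n y) m) (λ y → translate x (λ n → f (suc n) y) m))
    (cong₂ _+_ (trans (integral-* R j x (λ y → translate x (λ n → f n y) m)) (cong (x *_) (integral-translate R j x f m)))
               (integral-translate R j x (f ∘ suc) m))

  -- Truncated moments

  moment : ℕ → ℕ → ℕ → ℚ
  moment R j m = integral R j (_^ℚ m)

  φ^ : ∀ a m y → ι (b ^ m) * φ a y ^ℚ m ≡ translate (ι a) (y ^ℚ_) m
  φ^ a m y = trans (scale m) (sym (translate-^ (ι a) y m))
    where
    open ≡-Reasoning
    x = ι a + y
    scale : ∀ m → ι (b ^ m) * (x * r) ^ℚ m ≡ x ^ℚ m
    scale zero    = ℚ.*-identityˡ 1ℚ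
    scale (suc m) = begin
      ι (b ^ suc m) * (x * r * (x * r) ^ℚ m)       ≡⟨ cong (_* (x * r * (x * r) ^ℚ m)) (ι-b^suc m) ⟩
      β * ι (b ^ m) * (x * r * (x * r) ^ℚ m)       ≡⟨ solve 5 (λ β p x r q → β :* p :* (x :* r :* q) := (β :* r) :* (x :* (p :* q)))
                                                        refl β (ι (b ^ m)) x r ((x * r) ^ℚ m) ⟩
      (β * r) * (x * (ι (b ^ m) * (x * r) ^ℚ m))   ≡⟨ cong₂ (λ s t → s * (x * t)) β*r≡1 (scale m) ⟩
      1ℚ * (x * x ^ℚ m)                            ≡⟨ ℚ.*-identityˡ _ ⟩
      x * x ^ℚ m                                   ∎

  integral-φ^ : ∀ R j a m → ι (b ^ m) * integral R j (λ y → φ a y ^ℚ m) ≡ translate (ι a) (moment R j) m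
  integral-φ^ R j a m = begin
    ι (b ^ m) * integral R j (λ y → φ a y ^ℚ m)           ≡⟨ integral-* R j (ι (b ^ m)) (λ y → φ a y ^ℚ m) ⟨
    integral R j (λ y → ι (b ^ m) * φ a y ^ℚ m)           ≡⟨ integral-cong R j (λ y _ _ → φ^ a m y) ⟩
    integral R j (λ y → translate (ι a) (y ^ℚ_) m)        ≡⟨ integral-translate R j (ι a) (λ n y → y ^ℚ n) m ⟩
    translate (ι a) (moment R j) m                        ∎
    where open ≡-Reasoning

  -- The equation of `v-rec`, except that R drops by one on the right: splitting off the first digit
  -- shortens the string.
  moment-rec : ∀ R j m → ι (b ^ suc m) * moment (suc R) j m ≡
               prev (ι (b ^ suc m)) (λ i → translate (ι d′) (moment R i) m) j + T (moment R j) m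
  moment-rec R j m = begin
    ι (b ^ suc m) * (r * (P + S))
      ≡⟨ cong (_* (r * (P + S))) (ι-b^suc m) ⟩
    β * B * (r * (P + S))
      ≡⟨ solve 5 (λ β B r p s → β :* B :* (r :* (p :+ s)) := (β :* r) :* (B :* p :+ B :* s)) refl β B r P S ⟩
    (β * r) * (B * P + B * S)
      ≡⟨ trans (cong (_* (B * P + B * S)) β*r≡1) (ℚ.*-identityˡ _) ⟩
    B * P + B * S
      ≡⟨ cong₂ _+_
           (trans (prev-map (B *_) (β * 1ℚ ^ℚ m) (λ i → integral R i (λ y → φ d′ y ^ℚ m)) j)
                  (prev-lift _≡_ empty (λ i → integral-φ^ R i d′ m) j))
           (trans (sym (∑-*ˡ others B (λ a → integral R j (λ y → φ a y ^ℚ m))))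
                  (∑-cong others λ {a} _ → integral-φ^ R j a m)) ⟩
    prev (ι (b ^ suc m)) (λ i → translate (ι d′) (moment R i) m) j + T (moment R j) m ∎
    where
    open ≡-Reasoning
    B = ι (b ^ m)
    P = prev (β * 1ℚ ^ℚ m) (λ i → integral R i (λ y → φ d′ y ^ℚ m)) j
    S = ∑[ a ← others ] integral R j (λ y → φ a y ^ℚ m)
    empty : B * (β * 1ℚ ^ℚ m) ≡ ι (b ^ suc m)
    empty = trans (cong (λ t → B * (β * t)) (1^ m))
      (trans (solve 2 (λ B β → B :* (β :* con 1ℚ) := β :* B) refl B β) (sym (ι-b^suc m)))

  tail : ℕ → ℕ → ℕ → ℚ
  tail R j m = v j m - moment R j m

  -- The base value is 0 because the empty string contributes b^(m+1) to both equations at j = 0 and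
  -- cancels.
  tail-source : ℕ → ℕ → ℕ → ℚ
  tail-source R j m = prev 0ℚ (λ i → translate (ι d′) (tail R i) m) j

  tail-rec : ∀ R j m → ι (b ^ suc m) * tail (suc R) j m ≡ tail-source R j m + T (tail R j) m
  tail-rec R j m = sym (trans (cong₂ _+_ (sources j) (T-- (v j) (moment R j) m))
    (difference-rec (ι (b ^ suc m)) (v j m) (moment (suc R) j m) (source j m) _ _ _ (v-rec j m) (moment-rec R j m)))
    where
    sources : ∀ j → tail-source R j m ≡ source j m - prev (ι (b ^ suc m)) (λ i → translate (ι d′) (moment R i) m) j
    sources zero    = sym (ℚ.+-inverseʳ (ι (b ^ suc m)))
    sources (suc j) = translate-- (ι d′) (v j) (moment R j) m

  tail-nonNeg : ∀ R j m → 0ℚ ℚ.≤ tail R j m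
  tail-nonNeg zero    j m = p≤q⇒0≤q-p (v-nonNeg j m)
  tail-nonNeg (suc R) j m = *-cancelˡ-≤ (0<ι-b^ (suc m)) (subst₂ ℚ._≤_ (sym (ℚ.*-zeroʳ (ι (b ^ suc m))))
    (sym (tail-rec R j m)) (+-nonNeg (source-nonNeg j)
      (∑-nonNeg others λ {a} _ → translate-nonNeg (ι-nonNeg a) m λ n _ → tail-nonNeg R j n)))
    where
    source-nonNeg : ∀ j → 0ℚ ℚ.≤ tail-source R j m
    source-nonNeg zero    = ℚ.≤-refl
    source-nonNeg (suc j) = translate-nonNeg (ι-nonNeg d′) m λ n _ → tail-nonNeg R j n

  -- Contraction in the truncation length

  -- With equal weights the b branches would add up to the factor 1, which is no contraction. The
  -- weight 2^j makes the branch of d′, which lowers j, count one half, and (b - 1 + ½)/b = 1 -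
  -- 1/(2b).
  q : ℚ
  q = 1ℚ - ½ * r

  r≤1 : r ℚ.≤ 1ℚ
  r≤1 = subst₂ ℚ._≤_ (ℚ.*-identityˡ r) β*r≡1
    (*-mono-≤ (ι-nonNeg 1) 0≤r (ι-mono-≤ {1} 0<b) ℚ.≤-refl)

  0≤q : 0ℚ ℚ.≤ q
  0≤q = p≤q⇒0≤q-p (*-mono-≤ {½} {1ℚ} {r} {1ℚ} (ℚ.nonNegative⁻¹ ½) (ℚ.<⇒≤ 0<1) (ℚ.*≤* (ℤ.+≤+ (s≤s z≤n))) r≤1)

  q<1 : q ℚ.< 1ℚ
  q<1 = 0<q-p⇒p<q (subst (0ℚ ℚ.<_) (solve 1 (λ x → x := con 1ℚ :- (con 1ℚ :- x)) refl (½ * r))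
    (*-pos (ℚ.positive⁻¹ ½) 0<r))
    where
    0<r : 0ℚ ℚ.< r
    0<r = *-cancelˡ-< (ι-pos 0<b) (subst₂ ℚ._<_ (sym (ℚ.*-zeroʳ β)) (sym β*r≡1) 0<1)

  τ : ℕ → ℕ → ℚ
  τ R j = ι (2 ^ j) * β * q ^ℚ R

  τ-nonNeg : ∀ R j → 0ℚ ℚ.≤ τ R j
  τ-nonNeg R j = *-nonNeg (*-nonNeg (ι-nonNeg (2 ^ j)) 0≤β) (^ℚ-nonNeg 0≤q R)

  τ-mono-≤ : ∀ R {i j} → i ≤ j → τ R i ℚ.≤ τ R j
  τ-mono-≤ R {i} {j} i≤j = *-mono-≤ (*-nonNeg (ι-nonNeg (2 ^ i)) 0≤β) (^ℚ-nonNeg 0≤q R)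
    (*-mono-≤ (ι-nonNeg (2 ^ i)) 0≤β (ι-mono-≤ {2 ^ i} {2 ^ j} (ℕ.^-monoʳ-≤ 2 i≤j)) ℚ.≤-refl) ℚ.≤-refl

  tail≤τ : ∀ R j m → tail R j m ℚ.≤ τ R j
  tail≤τ zero    j m = begin
    v j m - 0ℚ                ≡⟨ ℚ.+-identityʳ (v j m) ⟩
    v j m                     ≤⟨ v≤β j m ⟩
    β                         ≡⟨ ℚ.*-identityˡ β ⟨
    ι 1 * β                   ≤⟨ *-mono-≤ (ι-nonNeg 1) 0≤β (ι-mono-≤ {1} (ℕ.m^n>0 2 j)) ℚ.≤-refl ⟩
    ι (2 ^ j) * β             ≡⟨ ℚ.*-identityʳ _ ⟨
    ι (2 ^ j) * β * 1ℚ        ∎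
    where open ℚ.≤-Reasoning
  tail≤τ (suc R) j m = *-cancelˡ-≤ (0<ι-b^ (suc m)) (begin
    ι (b ^ suc m) * tail (suc R) j m
      ≡⟨ tail-rec R j m ⟩
    tail-source R j m + T (tail R j) m
      ≤⟨ ℚ.+-mono-≤ (source≤½τ j) (∑-mono-≤ others λ {a} a∈ → translate≤ a j (others<b a∈)) ⟩
    ½ * (τ R j * B) + ∑ others (λ _ → τ R j * B)
      ≡⟨ solve 2 (λ x s → con ½ :* x :+ s := (x :+ s) :- con ½ :* x) refl (τ R j * B) (∑ others (λ _ → τ R j * B)) ⟩
    (τ R j * B + ∑ others (λ _ → τ R j * B)) - ½ * (τ R j * B)
      ≡⟨ cong (_- ½ * (τ R j * B)) (∑-others-const (τ R j * B)) ⟩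
    β * (τ R j * B) - ½ * (τ R j * B)
      ≡⟨ cong (λ t → β * (τ R j * B) - t) (trans (sym (ℚ.*-identityˡ (½ * (τ R j * B)))) (cong (_* (½ * (τ R j * B))) (sym β*r≡1))) ⟩
    β * (τ R j * B) - (β * r) * (½ * (τ R j * B))
      ≡⟨ solve 5 (λ β r B c p → β :* (c :* p :* B) :- (β :* r) :* (con ½ :* (c :* p :* B)) :=
                              β :* B :* (c :* ((con 1ℚ :- con ½ :* r) :* p))) refl β r B (ι (2 ^ j) * β) (q ^ℚ R) ⟩
    β * B * τ (suc R) j
      ≡⟨ cong (_* τ (suc R) j) (ι-b^suc m) ⟨
    ι (b ^ suc m) * τ (suc R) j ∎)
    where
    open ℚ.≤-Reasoning
    B = ι (b ^ m)
    translate≤ : ∀ a i → a < b → translate (ι a) (tail R i) m ℚ.≤ τ R i * B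
    translate≤ a i a<b = begin
      translate (ι a) (tail R i) m         ≤⟨ translate-mono-≤ (ι-nonNeg a) m (tail≤τ R i) ⟩
      translate (ι a) (λ _ → τ R i) m      ≡⟨ translate-const a (τ R i) m ⟩
      τ R i * ι (suc a ^ m)                ≤⟨ *-monoʳ-≤ (τ-nonNeg R i) (ι-suc^≤ a<b m) ⟩
      τ R i * B                            ∎
    source≤½τ : ∀ j → tail-source R j m ℚ.≤ ½ * (τ R j * B)
    source≤½τ zero    = *-nonNeg (ℚ.nonNegative⁻¹ ½) (*-nonNeg (τ-nonNeg R 0) (ι-nonNeg (b ^ m)))
    source≤½τ (suc i) = begin
      translate (ι d′) (tail R i) m                            ≤⟨ translate≤ d′ i d′<b ⟩
      ι (2 ^ i) * β * q ^ℚ R * B                               ≡⟨ solve 4 (λ c β p B → c :* β :* p :* B :=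
                                                                    con ½ :* (con (ι 2) :* c :* β :* p :* B)) refl (ι (2 ^ i)) β (q ^ℚ R) B ⟩
      ½ * (ι 2 * ι (2 ^ i) * β * q ^ℚ R * B)                   ≡⟨ cong (λ c → ½ * (c * β * q ^ℚ R * B)) (ι-* 2 (2 ^ i)) ⟨
      ½ * (τ R (suc i) * B)                                    ∎

  -- Integers with given leading digits as integrals of kernels

  irwinTerm-nonNeg : ∀ k n → 0ℚ ℚ.≤ irwinTerm k n
  irwinTerm-nonNeg k n with does (#d n ≟ k)
  ... | true  = recip-nonNeg n
  ... | false = ℚ.≤-refl

  child≥1 : ∀ a {p} → 1 ≤ p → 1 ≤ a ℕ.+ p ℕ.* b
  child≥1 a {p} 1≤p = ℕ.≤-trans (ℕ.*-mono-≤ 1≤p 0<b) (ℕ.m≤n+m (p ℕ.* b) a)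

  #d≤child : ∀ {a p} → a < b → 1 ≤ p → #d p ≤ #d (a ℕ.+ p ℕ.* b)
  #d≤child {a} {p} a<b 1≤p with a ≟ toℕ d
  ... | yes refl = ℕ.≤-trans (ℕ.n≤1+n (#d p)) (ℕ.≤-reflexive (sym (#d-append-≡ 1≤p)))
  ... | no a≢d   = ℕ.≤-reflexive (sym (#d-append-≢ a<b a≢d 1≤p))

  -- Appending digits never lowers the count of d.
  descend-zero : ∀ k R {p} → 1 ≤ p → k < #d p → descend b (irwinTerm k) R p ≡ 0ℚ
  descend-zero k zero    1≤p k<#d = refl
  descend-zero k (suc R) {p} 1≤p k<#d = cong₂ _+_ (if-no (#d p ≟ k) (ℕ.<⇒≢ k<#d ∘ sym))
    (trans (∑-cong (upTo b) λ {a} a∈ → descend-zero k R (child≥1 a 1≤p)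
              (ℕ.<-≤-trans k<#d (#d≤child (∈-upTo⁻ a∈) 1≤p)))
           (∑-zero (upTo b)))

  complement : ℕ → ℕ
  complement a = b ∸ 1 ∸ a

  complement-+ : ∀ {a} → a < b → suc (complement a ℕ.+ a) ≡ b
  complement-+ {a} a<b = trans (cong suc (ℕ.m∸n+n≡m (ℕ.∸-monoˡ-≤ 1 a<b))) (ℕ.m+[n∸m]≡n 0<b)

  complement<b : ∀ a → complement a < b
  complement<b a = ℕ.≤-<-trans (ℕ.m∸n≤m (b ∸ 1) a) (ℕ.≤-reflexive (ℕ.m+[n∸m]≡n 0<b))

  complement-d′ : complement d′ ≡ toℕ d
  complement-d′ = ℕ.m∸[m∸n]≡n (ℕ.∸-monoˡ-≤ 1 (Fin.toℕ<n d))

  complement-≢ : ∀ {a} → a ∈ others → complement a ≢ toℕ d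
  complement-≢ {a} a∈ eq = proj₂ (∈-filter⁻ (λ a → ¬? (a ≟ d′)) {xs = upTo b} a∈)
    (trans (sym (ℕ.m∸[m∸n]≡n (ℕ.∸-monoˡ-≤ 1 (others<b a∈)))) (cong complement eq))

  -- From b(p + 1 - (a + y)/b) = (b - 1 - a) + p b + 1 - y: a digit map in the argument amounts to
  -- appending the complementary digit to p.
  kernel-φ : ∀ {a p} → a < b → 1 ≤ p → ∀ {y} → y ℚ.≤ 1ℚ →
             kernel p (φ a y) ≡ β * kernel (complement a ℕ.+ p ℕ.* b) y
  kernel-φ {a} {p} a<b 1≤p {y} y≤1 = kernel-unique 1≤p (φ≤1 a<b y≤1) (begin
    (ι (suc p) - (ι a + y) * r) * (β * K)
      ≡⟨ cong (λ t → (t - (ι a + y) * r) * (β * K)) (ι-suc p) ⟩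
    (1ℚ + ι p - (ι a + y) * r) * (β * K)
      ≡⟨ solve 6 (λ p a y r β K → (con 1ℚ :+ p :- (a :+ y) :* r) :* (β :* K) :=
                                (β :+ p :* β :- (β :* r) :* (a :+ y)) :* K) refl (ι p) (ι a) y r β K ⟩
    (β + ι p * β - (β * r) * (ι a + y)) * K
      ≡⟨ cong₂ (λ s t → (s + ι p * β - t * (ι a + y)) * K) split β*r≡1 ⟩
    ((1ℚ + (ι c + ι a)) + ι p * β - 1ℚ * (ι a + y)) * K
      ≡⟨ cong (_* K) (solve 4 (λ c a pβ y → (con 1ℚ :+ (c :+ a)) :+ pβ :- con 1ℚ :* (a :+ y) :=
                                           (con 1ℚ :+ (c :+ pβ)) :- y) refl (ι c) (ι a) (ι p * β) y) ⟩
    ((1ℚ + (ι c + ι p * β)) - y) * K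
      ≡⟨ cong (λ t → (t - y) * K) (trans (ι-suc (c ℕ.+ p ℕ.* b))
           (cong (_+_ 1ℚ) (trans (ι-+ c (p ℕ.* b)) (cong (_+_ (ι c)) (ι-* p b))))) ⟨
    (ι (suc (c ℕ.+ p ℕ.* b)) - y) * K
      ≡⟨ *-kernel (child≥1 c 1≤p) y≤1 ⟩
    1ℚ ∎)
    where
    open ≡-Reasoning
    c = complement a
    K = kernel (c ℕ.+ p ℕ.* b) y
    split : β ≡ 1ℚ + (ι c + ι a)
    split = trans (cong ι (sym (complement-+ a<b))) (trans (ι-suc (c ℕ.+ a)) (cong (_+_ 1ℚ) (ι-+ c a)))

  ∑-children : ∀ (f : ℕ → ℚ) p → (∑[ a ← upTo b ] f (a ℕ.+ p ℕ.* b)) ≡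
               f (toℕ d ℕ.+ p ℕ.* b) + (∑[ a ← others ] f (complement a ℕ.+ p ℕ.* b))
  ∑-children f p = begin
    (∑[ a ← upTo b ] f (a ℕ.+ p ℕ.* b))
      ≡⟨ ∑-upTo-reverse b (λ a → f (a ℕ.+ p ℕ.* b)) ⟩
    (∑[ a ← upTo b ] f (complement a ℕ.+ p ℕ.* b))
      ≡⟨ ∑-upTo-remove d′<b (λ a → f (complement a ℕ.+ p ℕ.* b)) ⟨
    f (complement d′ ℕ.+ p ℕ.* b) + (∑[ a ← others ] f (complement a ℕ.+ p ℕ.* b))
      ≡⟨ cong (λ c → f (c ℕ.+ p ℕ.* b) + (∑[ a ← others ] f (complement a ℕ.+ p ℕ.* b))) complement-d′ ⟩
    f (toℕ d ℕ.+ p ℕ.* b) + (∑[ a ← others ] f (complement a ℕ.+ p ℕ.* b)) ∎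
    where open ≡-Reasoning

  integral-kernel-suc : ∀ R j {p} → 1 ≤ p → integral (suc R) j (kernel p) ≡
    prev (recip p) (λ i → integral R i (kernel (toℕ d ℕ.+ p ℕ.* b))) j +
    (∑[ a ← others ] integral R j (kernel (complement a ℕ.+ p ℕ.* b)))
  integral-kernel-suc R j {p} 1≤p = begin
    r * (prev (β * kernel p 1ℚ) (λ i → integral R i (kernel p ∘ φ d′)) j +
         (∑[ a ← others ] integral R j (kernel p ∘ φ a)))
      ≡⟨ cong (r *_) (cong₂ _+_
           (prev-lift _≡_ (cong (β *_) (kernel-1 1≤p))
             (λ i → trans (child i d′<b) (cong (λ c → β * integral R i (kernel (c ℕ.+ p ℕ.* b))) complement-d′)) j)
           (trans (∑-cong others λ a∈ → child j (others<b a∈))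
                  (∑-*ˡ others β (λ a → integral R j (kernel (complement a ℕ.+ p ℕ.* b)))))) ⟩
    r * (prev (β * recip p) (λ i → β * integral R i (kernel (toℕ d ℕ.+ p ℕ.* b))) j + β * S)
      ≡⟨ cong (λ t → r * (t + β * S)) (prev-map (β *_) (recip p) (λ i → integral R i (kernel (toℕ d ℕ.+ p ℕ.* b))) j) ⟨
    r * (β * P + β * S)
      ≡⟨ solve 4 (λ r β P S → r :* (β :* P :+ β :* S) := (β :* r) :* (P :+ S)) refl r β P S ⟩
    (β * r) * (P + S)
      ≡⟨ trans (cong (_* (P + S)) β*r≡1) (ℚ.*-identityˡ (P + S)) ⟩
    P + S ∎
    where
    open ≡-Reasoning
    P = prev (recip p) (λ i → integral R i (kernel (toℕ d ℕ.+ p ℕ.* b))) j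
    S = ∑[ a ← others ] integral R j (kernel (complement a ℕ.+ p ℕ.* b))
    child : ∀ i {a} → a < b → integral R i (kernel p ∘ φ a) ≡ β * integral R i (kernel (complement a ℕ.+ p ℕ.* b))
    child i {a} a<b = trans (integral-cong R i λ y _ y≤1 → kernel-φ a<b 1≤p y≤1)
      (integral-* R i β (kernel (complement a ℕ.+ p ℕ.* b)))

  -- Tree and measure obey the same recursion in R, so the identity is exact at every truncation. At
  -- j = 0 the integer p itself is counted and its child by d has too many d's; at j > 0 it is the
  -- other way round, and the child has j - 1 occurrences left.
  descend-integral : ∀ R {j k p} → 1 ≤ p → #d p ℕ.+ j ≡ k → descend b (irwinTerm k) R p ≡ integral R j (kernel p)
  descend-integral zero    1≤p eq = refl
  descend-integral (suc R) {j} {k} {p} 1≤p eq = begin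
    irwinTerm k p + (∑[ a ← upTo b ] D (a ℕ.+ p ℕ.* b))
      ≡⟨ cong (_+_ (irwinTerm k p)) (∑-children D p) ⟩
    irwinTerm k p + (D (toℕ d ℕ.+ p ℕ.* b) + (∑[ a ← others ] D (complement a ℕ.+ p ℕ.* b)))
      ≡⟨ ℚ.+-assoc (irwinTerm k p) (D (toℕ d ℕ.+ p ℕ.* b)) _ ⟨
    irwinTerm k p + D (toℕ d ℕ.+ p ℕ.* b) + (∑[ a ← others ] D (complement a ℕ.+ p ℕ.* b))
      ≡⟨ cong₂ _+_ (special j eq) (∑-cong others λ {a} a∈ → descend-integral R (child≥1 (complement a) 1≤p)
           (trans (cong (ℕ._+ j) (#d-append-≢ (complement<b a) (complement-≢ a∈) 1≤p)) eq)) ⟩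
    prev (recip p) (λ i → integral R i (kernel (toℕ d ℕ.+ p ℕ.* b))) j +
    (∑[ a ← others ] integral R j (kernel (complement a ℕ.+ p ℕ.* b)))
      ≡⟨ integral-kernel-suc R j 1≤p ⟨
    integral (suc R) j (kernel p) ∎
    where
    open ≡-Reasoning
    D : ℕ → ℚ
    D = descend b (irwinTerm k) R
    special : ∀ j → #d p ℕ.+ j ≡ k → irwinTerm k p + D (toℕ d ℕ.+ p ℕ.* b) ≡
              prev (recip p) (λ i → integral R i (kernel (toℕ d ℕ.+ p ℕ.* b))) j
    special zero    eq = trans (cong₂ _+_ (if-yes (#d p ≟ k) #d≡k)
      (descend-zero k R (child≥1 (toℕ d) 1≤p) (ℕ.≤-reflexive (trans (cong suc (sym #d≡k)) (sym (#d-append-≡ 1≤p))))))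
      (ℚ.+-identityʳ (recip p))
      where
      #d≡k : #d p ≡ k
      #d≡k = trans (sym (ℕ.+-identityʳ (#d p))) eq
    special (suc i) eq = trans (cong₂ _+_ (if-no (#d p ≟ k) #d≢k)
      (descend-integral R (child≥1 (toℕ d) 1≤p) (trans (cong (ℕ._+ i) (#d-append-≡ 1≤p)) (trans (sym (ℕ.+-suc (#d p) i)) eq))))
      (ℚ.+-identityˡ _)
      where
      #d≢k : #d p ≢ k
      #d≢k #d≡k = ℕ.m≢1+m+n (#d p) (trans #d≡k (trans (sym eq) (ℕ.+-suc (#d p) i)))

  -- Two-sided comparison of the kernel integrals with the power expansion

  expansion : ℕ → ℕ → ℕ → ℚ
  expansion p j M = ∑[ m ← upTo M ] v j m * ρ p (suc m)

  module _ {p : ℕ} (1≤p : 1 ≤ p) where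

    remainder : ℕ → ℕ → ℕ → ℚ
    remainder R j M = integral R j (λ y → y ^ℚ M * kernel p y)

    integral-kernel : ∀ R j M → integral R j (kernel p) ≡
      (∑[ m ← upTo M ] ρ p (suc m) * moment R j m) + ρ p M * remainder R j M
    integral-kernel R j M = begin
      integral R j (kernel p)
        ≡⟨ integral-cong R j (λ y _ y≤1 → kernel-expansion 1≤p M y≤1) ⟩
      integral R j (λ y → (∑[ m ← upTo M ] ρ p (suc m) * y ^ℚ m) + ρ p M * (y ^ℚ M * kernel p y))
        ≡⟨ integral-+ R j (λ y → ∑[ m ← upTo M ] ρ p (suc m) * y ^ℚ m) (λ y → ρ p M * (y ^ℚ M * kernel p y)) ⟩
      integral R j (λ y → ∑[ m ← upTo M ] ρ p (suc m) * y ^ℚ m) +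
      integral R j (λ y → ρ p M * (y ^ℚ M * kernel p y))
        ≡⟨ cong₂ _+_ (trans (integral-∑ R j (upTo M) (λ m y → ρ p (suc m) * y ^ℚ m))
                            (∑-cong (upTo M) λ {m} _ → integral-* R j (ρ p (suc m)) (_^ℚ m)))
                     (integral-* R j (ρ p M) (λ y → y ^ℚ M * kernel p y)) ⟩
      (∑[ m ← upTo M ] ρ p (suc m) * moment R j m) + ρ p M * remainder R j M ∎
      where open ≡-Reasoning

    remainder-nonNeg : ∀ R j M → 0ℚ ℚ.≤ remainder R j M
    remainder-nonNeg R j M = subst (ℚ._≤ remainder R j M) (integral-zero R j)
      (integral-mono-≤ R j λ y 0≤y y≤1 → *-nonNeg (^ℚ-nonNeg 0≤y M) (kernel-nonNeg 1≤p y≤1))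

    remainder≤β : ∀ R j M → remainder R j M ℚ.≤ β
    remainder≤β R j M = begin
      remainder R j M           ≤⟨ integral-mono-≤ R j (λ y 0≤y y≤1 → *-mono-≤ (^ℚ-nonNeg 0≤y M) (ℚ.<⇒≤ 0<1)
                                     (^ℚ≤1 0≤y y≤1 M) (kernel≤1 1≤p y≤1)) ⟩
      moment R j 0              ≤⟨ 0≤q-p⇒p≤q (tail-nonNeg R j 0) ⟩
      v j 0                     ≤⟨ v≤β j 0 ⟩
      β                         ∎
      where open ℚ.≤-Reasoning

    -- Truncated moments lie below `v`, and the remainder is at most β times (p + 1)^-M. The error
    -- does not involve R.
    integral≤expansion : ∀ R j M → integral R j (kernel p) ℚ.≤ expansion p j M + ½ ^ℚ M * β
    integral≤expansion R j M = begin
      integral R j (kernel p)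
        ≡⟨ integral-kernel R j M ⟩
      (∑[ m ← upTo M ] ρ p (suc m) * moment R j m) + ρ p M * remainder R j M
        ≤⟨ ℚ.+-mono-≤ (∑-mono-≤ (upTo M) λ {m} _ → ℚ.≤-trans
             (*-monoʳ-≤ (ρ-nonNeg 1≤p (suc m)) (0≤q-p⇒p≤q (tail-nonNeg R j m)))
             (ℚ.≤-reflexive (ℚ.*-comm (ρ p (suc m)) (v j m))))
           (*-mono-≤ (ρ-nonNeg 1≤p M) 0≤β (ρ≤½^ 1≤p M) (remainder≤β R j M)) ⟩
      expansion p j M + ½ ^ℚ M * β ∎
      where open ℚ.≤-Reasoning

    -- Replacing `v` by the truncated moments costs at most `τ R j` in each coefficient, and the
    -- weights ρ sum to at most 1. The error does not involve M.
    expansion≤integral : ∀ R j M → expansion p j M ℚ.≤ integral R j (kernel p) + τ R j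
    expansion≤integral R j M = begin
      expansion p j M
        ≤⟨ ∑-mono-≤ (upTo M) (λ {m} _ → term m) ⟩
      (∑[ m ← upTo M ] (ρ p (suc m) * moment R j m + τ R j * ρ p (suc m)))
        ≡⟨ trans (∑-distrib-+ (upTo M) (λ m → ρ p (suc m) * moment R j m) (λ m → τ R j * ρ p (suc m)))
                 (cong (_+_ S) (∑-*ˡ (upTo M) (τ R j) (λ m → ρ p (suc m)))) ⟩
      S + τ R j * (∑[ m ← upTo M ] ρ p (suc m))
        ≤⟨ ℚ.+-mono-≤ S≤ (ℚ.≤-trans (*-monoʳ-≤ (τ-nonNeg R j) (∑ρ≤1 1≤p M)) (ℚ.≤-reflexive (ℚ.*-identityʳ (τ R j)))) ⟩
      integral R j (kernel p) + τ R j ∎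
      where
      open ℚ.≤-Reasoning
      S = ∑[ m ← upTo M ] ρ p (suc m) * moment R j m
      S≤ : S ℚ.≤ integral R j (kernel p)
      S≤ = begin
        S                                       ≡⟨ ℚ.+-identityʳ S ⟨
        S + 0ℚ                                  ≤⟨ ℚ.+-monoʳ-≤ S (*-nonNeg (ρ-nonNeg 1≤p M) (remainder-nonNeg R j M)) ⟩
        S + ρ p M * remainder R j M           ≡⟨ integral-kernel R j M ⟨
        integral R j (kernel p)                 ∎
      term : ∀ m → v j m * ρ p (suc m) ℚ.≤ ρ p (suc m) * moment R j m + τ R j * ρ p (suc m)
      term m = begin
        v j m * ρ p (suc m)
          ≡⟨ solve 3 (λ v x ρ → v :* ρ := ρ :* x :+ ρ :* (v :- x)) refl (v j m) (moment R j m) (ρ p (suc m)) ⟩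
        ρ p (suc m) * moment R j m + ρ p (suc m) * tail R j m
          ≤⟨ ℚ.+-monoʳ-≤ (ρ p (suc m) * moment R j m) (*-monoʳ-≤ (ρ-nonNeg 1≤p (suc m)) (tail≤τ R j m)) ⟩
        ρ p (suc m) * moment R j m + ρ p (suc m) * τ R j
          ≡⟨ cong (_+_ (ρ p (suc m) * moment R j m)) (ℚ.*-comm (ρ p (suc m)) (τ R j)) ⟩
        ρ p (suc m) * moment R j m + τ R j * ρ p (suc m) ∎

  -- The identity for the Irwin sums

  module Block (l k : ℕ) where

    -- The index l is one less than in the theorem: these integers have l + 1 digits.
    block : List ℕ
    block = filter (λ n → #d n ≤? k) [ b ^ l , b ^ suc l ⟩

    correction : ℕ → ℚ
    correction m = ∑[ n ← block ] (v (k ∸ #d n) m * recip (suc n ^ suc m))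

    A : ℚ
    A = ∑[ n ← filter (λ n → #d n ≟ k) [ 1 , b ^ l ⟩ ] recip n

    B : ℚ
    B = ι b * (∑[ n ← block ] recip (suc n))

    g : ℕ → ℚ
    g = irwinTerm k

    -- `S` and `X` are the partial sums of the two sides of the identity. `P` is the part of `S`
    -- below a power of b, where the truncated integrals apply exactly.
    S X P : ℕ → ℚ
    S N = partialSum g N
    X M = A + B + partialSum correction M
    P R = ∑ [ 1 , b ^ (l ℕ.+ R) ⟩ g

    1≤b^ : ∀ n → 1 ≤ b ^ n
    1≤b^ n = ℕ.m^n>0 b n

    ∈block⇒1≤ : ∀ {p} → p ∈ block → 1 ≤ p
    ∈block⇒1≤ p∈ = ℕ.≤-trans (1≤b^ l)
      (∈-interval⁻ {b ^ l} {b ^ suc l} (proj₁ (∈-filter⁻ (λ n → #d n ≤? k) {xs = [ b ^ l , b ^ suc l ⟩} p∈)))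

    P≡ : ∀ R → P R ≡ A + (∑[ p ← block ] integral R (k ∸ #d p) (kernel p))
    P≡ R = begin
      P R
        ≡⟨ ∑-interval-split (1≤b^ l) (ℕ.^-monoʳ-≤ b (ℕ.m≤m+n l R)) g ⟩
      ∑ [ 1 , b ^ l ⟩ g + ∑ [ b ^ l , b ^ (l ℕ.+ R) ⟩ g
        ≡⟨ cong₂ _+_ (sym (∑-filter (λ n → #d n ≟ k) [ 1 , b ^ l ⟩ recip)) (sym (∑-descend b g R l)) ⟩
      A + ∑ [ b ^ l , b ^ suc l ⟩ (descend b g R)
        ≡⟨ cong (_+_ A) (trans (∑-cong [ b ^ l , b ^ suc l ⟩ λ p∈ → cases (ℕ.≤-trans (1≤b^ l) (∈-interval⁻ {b ^ l} {b ^ suc l} p∈)))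
             (sym (∑-filter (λ n → #d n ≤? k) [ b ^ l , b ^ suc l ⟩ (λ p → integral R (k ∸ #d p) (kernel p))))) ⟩
      A + (∑[ p ← block ] integral R (k ∸ #d p) (kernel p)) ∎
      where
      open ≡-Reasoning
      cases : ∀ {p} → 1 ≤ p → descend b g R p ≡ (if does (#d p ≤? k) then integral R (k ∸ #d p) (kernel p) else 0ℚ)
      cases {p} 1≤p = by (#d p ≤? k)
        where
        by : (dec : Dec (#d p ≤ k)) → descend b g R p ≡ (if does dec then integral R (k ∸ #d p) (kernel p) else 0ℚ)
        by (yes #d≤k) = descend-integral R 1≤p (ℕ.m+[n∸m]≡n #d≤k)
        by (no #d≰k)  = descend-zero k R 1≤p (ℕ.≰⇒> #d≰k)

    -- The separate sum of b/(n + 1) is the m = 0 term of the expansion, as `v j 0` is b; hence the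
    -- bound `suc M`.
    X≡ : ∀ M → X M ≡ A + (∑[ p ← block ] expansion p (k ∸ #d p) (suc M))
    X≡ M = begin
      A + B + partialSum correction M
        ≡⟨ ℚ.+-assoc A B (partialSum correction M) ⟩
      A + (B + partialSum correction M)
        ≡⟨ cong (_+_ A) (cong₂ _+_ (sym (∑-*ˡ block (ι b) (λ n → recip (suc n))))
             (trans (∑-applyUpTo suc M correction) (∑-comm (upTo M) block (λ m n → v (k ∸ #d n) (suc m) * ρ n (suc (suc m)))))) ⟩
      A + ((∑[ n ← block ] β * recip (suc n)) + (∑[ n ← block ] ∑[ m ← upTo M ] v (k ∸ #d n) (suc m) * ρ n (suc (suc m))))
        ≡⟨ cong (_+_ A) (∑-distrib-+ block (λ n → β * recip (suc n)) (λ n → ∑[ m ← upTo M ] v (k ∸ #d n) (suc m) * ρ n (suc (suc m)))) ⟨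
      A + (∑[ n ← block ] (β * recip (suc n) + (∑[ m ← upTo M ] v (k ∸ #d n) (suc m) * ρ n (suc (suc m)))))
        ≡⟨ cong (_+_ A) (∑-cong block λ {n} _ → trans
             (cong (_+ (∑[ m ← upTo M ] v (k ∸ #d n) (suc m) * ρ n (suc (suc m))))
               (cong₂ _*_ (sym (v[j,0]≡β (k ∸ #d n))) (cong recip (sym (ℕ.*-identityʳ (suc n))))))
             (sym (∑-upTo-first M (λ m → v (k ∸ #d n) m * ρ n (suc m))))) ⟩
      A + (∑[ p ← block ] expansion p (k ∸ #d p) (suc M)) ∎
      where open ≡-Reasoning

    c : ℚ
    c = ι (length block)

    ∑-shift : ∀ (f g : ℕ → ℚ) x → (∀ {p} → p ∈ block → f p ℚ.≤ g p + x) →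
              A + ∑ block f ℚ.≤ A + ∑ block g + c * x
    ∑-shift f g x f≤g+x = begin
      A + ∑ block f                            ≤⟨ ℚ.+-monoʳ-≤ A (∑-mono-≤ block f≤g+x) ⟩
      A + (∑[ p ← block ] (g p + x))           ≡⟨ cong (_+_ A) (trans (∑-distrib-+ block g (λ _ → x)) (cong (_+_ (∑ block g)) (∑-const block x))) ⟩
      A + (∑ block g + c * x)                  ≡⟨ ℚ.+-assoc A (∑ block g) (c * x) ⟨
      A + ∑ block g + c * x                    ∎
      where open ℚ.≤-Reasoning

    P≤X : ∀ R M → P R ℚ.≤ X M + c * (½ ^ℚ suc M * β)
    P≤X R M = subst₂ (λ x y → x ℚ.≤ y + c * (½ ^ℚ suc M * β)) (sym (P≡ R)) (sym (X≡ M))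
      (∑-shift (λ p → integral R (k ∸ #d p) (kernel p)) (λ p → expansion p (k ∸ #d p) (suc M)) (½ ^ℚ suc M * β)
        λ {p} p∈ → integral≤expansion (∈block⇒1≤ p∈) R (k ∸ #d p) (suc M))

    X≤P : ∀ R M → X M ℚ.≤ P R + c * τ R k
    X≤P R M = subst₂ (λ x y → x ℚ.≤ y + c * τ R k) (sym (X≡ M)) (sym (P≡ R))
      (∑-shift (λ p → expansion p (k ∸ #d p) (suc M)) (λ p → integral R (k ∸ #d p) (kernel p)) (τ R k)
        λ {p} p∈ → ℚ.≤-trans (expansion≤integral (∈block⇒1≤ p∈) R (k ∸ #d p) (suc M))
          (ℚ.+-monoʳ-≤ (integral R (k ∸ #d p) (kernel p)) (τ-mono-≤ R (ℕ.m∸n≤m k (#d p)))))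

    P≤S : ∀ {R N} → b ^ (l ℕ.+ R) ≤ N → P R ℚ.≤ S N
    P≤S {R} {N} le = ∑-interval-mono-≤ (irwinTerm-nonNeg k) (1≤b^ (l ℕ.+ R)) (ℕ.m≤n⇒m≤1+n le)

    S≤P : ∀ N → S N ℚ.≤ P N
    S≤P N = ∑-interval-mono-≤ (irwinTerm-nonNeg k) (s≤s z≤n)
      (ℕ.≤-trans (n<b^n 1<b N) (ℕ.^-monoʳ-≤ b (ℕ.m≤n+m N l)))

    -- From above, S N ≤ P N ≤ X M plus an error small for large M, whatever N is. From below, R₀ is
    -- fixed by ε, and X M ≤ P R₀ + ε' ≤ S N + ε' with ε' < ε as soon as N ≥ b^(l + R₀), whatever M
    -- is.
    close : ∀ ε → 0ℚ ℚ.< ε → ∃[ N ] (∀ m n → N ≤ m → N ≤ n → ∣ S m - X n ∣ ℚ.< ε)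
    close ε 0<ε = b ^ (l ℕ.+ R₀) ℕ.⊔ M₀ , λ N M N≥ M≥ →
      ∣p-q∣<
        (ℚ.≤-<-trans (ℚ.≤-trans (S≤P N) (P≤X N M))
          (ℚ.+-monoʳ-< (X M) (upper M (ℕ.m⊔n≤o⇒n≤o (b ^ (l ℕ.+ R₀)) M₀ M≥))))
        (ℚ.≤-<-trans (ℚ.≤-trans (X≤P R₀ M) (ℚ.+-monoˡ-≤ (c * τ R₀ k) (P≤S (ℕ.m⊔n≤o⇒m≤o (b ^ (l ℕ.+ R₀)) M₀ N≥))))
          (ℚ.+-monoʳ-< (S N) lower))
      where
      0≤½ : 0ℚ ℚ.≤ ½
      0≤½ = ℚ.nonNegative⁻¹ ½
      decay-½ = geometric-decay 0≤½ ½<1 (*-nonNeg (*-nonNeg (ι-nonNeg (length block)) 0≤β) 0≤½) 0<ε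
      decay-q = geometric-decay 0≤q q<1 (*-nonNeg (ι-nonNeg (length block)) (*-nonNeg (ι-nonNeg (2 ^ k)) 0≤β)) 0<ε
      M₀ R₀ : ℕ
      M₀ = proj₁ decay-½
      R₀ = proj₁ decay-q
      upper : ∀ M → M₀ ≤ M → c * (½ ^ℚ suc M * β) ℚ.< ε
      upper M M₀≤M = subst (ℚ._< ε)
        (solve 4 (λ c β h x → c :* β :* h :* x := c :* (h :* x :* β)) refl c β ½ (½ ^ℚ M)) (proj₂ decay-½ M M₀≤M)
      lower : c * τ R₀ k ℚ.< ε
      lower = subst (ℚ._< ε) (ℚ.*-assoc c (ι (2 ^ k) * β) (q ^ℚ R₀)) (proj₂ decay-q R₀ ℕ.≤-refl)

    irwin-summable : Summable g
    irwin-summable = close⇒cauchy S X close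

    correction-summable : Summable correction
    correction-summable = close⇒cauchy (partialSum correction) (λ n → S n - (A + B)) λ ε 0<ε →
      let N , close-N = close ε 0<ε
      in N , λ m n N≤m N≤n → subst (ℚ._< ε)
        (trans (∣p-q∣≡∣q-p∣ (S n) (X m)) (cong ∣_∣ (regroup (A + B) (partialSum correction m) (S n))))
        (close-N n m N≤n N≤m)
      where
      regroup : ∀ x y z → x + y - z ≡ y - (z - x)
      regroup = solve 3 (λ x y z → x :+ y :- z := y :- (z :- x)) refl

    irwin-expansion : series g irwin-summable ≃ fromℚ A +ℝ fromℚ B +ℝ series correction correction-summable
    irwin-expansion ε 0<ε =
      let N , close-N = close ε 0<ε
      in N , λ n N≤n → subst (ℚ._< ε) (cong ∣_∣ (sym (ℚ.+-identityʳ (S n - X n)))) (close-N n n N≤n N≤n)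

-- The exceptional case b = 2, d = 1

-- The constant 2 is both a supersolution and a subsolution. Matching on d makes `others` compute to
-- the single digit 1, so the sum in the subsolution condition becomes 2^n + 0 and the condition is
-- an equality.
v₀≡2 : (d : Digit 2) → toℕ d ≡ 1 → ∀ m → Irwin.v 2 d 0 m ≡ ι 2
v₀≡2 (Fin.suc Fin.zero) refl m = ℚ.≤-antisym (v≤β 0 m) (β≤v₀ (λ n → ℚ.≤-reflexive (large n)) m)
  where
  open Recurrence 2 (Fin.suc Fin.zero)
  large : ∀ n → ι 2 * ι (2 ^ suc n) ≡ ι (2 ^ suc n) + ι 2 * (ι (2 ^ n) + 0ℚ)
  large n = begin
    ι 2 * ι (2 ^ suc n)                              ≡⟨ cong (ι 2 *_) (ι-* 2 (2 ^ n)) ⟩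
    ι 2 * (ι 2 * ι (2 ^ n))                          ≡⟨ solve 1 (λ x → con (ι 2) :* (con (ι 2) :* x) :=
                                                          con (ι 2) :* x :+ con (ι 2) :* (x :+ con 0ℚ)) refl (ι (2 ^ n)) ⟩
    ι 2 * ι (2 ^ n) + ι 2 * (ι (2 ^ n) + 0ℚ)         ≡⟨ cong (_+ ι 2 * (ι (2 ^ n) + 0ℚ)) (ι-* 2 (2 ^ n)) ⟨
    ι (2 ^ suc n) + ι 2 * (ι (2 ^ n) + 0ℚ)           ∎
    where open ≡-Reasoning

mainTheorem2 : (b : ℕ) .{{_ : NonTrivial b}} (d : Digit b) →
    let open Irwin b d in
      (∀ l k → 1 ≤ l →
        let block = filter (λ n → #d n ≤? k) [ b ^ (l ∸ 1) , b ^ l ⟩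
            correction = λ m → ∑[ n ← block ] (v (k ∸ #d n) m * recip (suc n ^ suc m))
        in
        ∃[ cH ] ∃[ cR ]
          series (irwinTerm k) cH ≃
            fromℚ (∑[ n ← filter (λ n → #d n ≟ k) [ 1 , b ^ (l ∸ 1) ⟩ ] recip n)
            +ℝ fromℚ (ι b * (∑[ n ← block ] recip (suc n)))
            +ℝ series correction cR)
    × (∀ j → v j 0 ≡ ι b)
    × (∀ j m → 1 ≤ m → 0ℚ ℚ.< v j m × v j m ℚ.≤ ι b)
    × (∀ j → ¬ (b ≡ 2 × toℕ d ≡ 1 × j ≡ 0) → StrictlyDecreasing (v j))
    × (b ≡ 2 → toℕ d ≡ 1 → ∀ m → v 0 m ≡ ι 2)
    × (∀ m → 1 ≤ m → StrictlyDecreasing (λ j → v j m) × (λ j → v j m) ⟶ (+ b / suc m))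
mainTheorem2 b d =
    (λ { (suc l) k _ → let open Block l k in irwin-summable , correction-summable , irwin-expansion })
  , v[j,0]≡β
  , (λ j m _ → v-pos j m , v≤β j m)
  , v-decreasing
  , (λ { refl → v₀≡2 d })
  , (λ { (suc m) _ → v-decreasing-in-j m , v-limit m })
  where
  open Recurrence b d
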